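{- Let $p$ be a prime number, let $s$ be an even positive divisor of $p-1$, and let $\mathbb{K}$ be the unique subfield of $\mathbb{Q}(\zeta_p)$ with $[\mathbb{K}:\mathbb{Q}]=s$. Let $\mathcal{M}_p\subseteq\mathcal{O}_{\mathbb{K}}$ be the $\mathbb{Z}$-submodule and $\sigma$ the canonical embedding defined in the context. Then the center density of the lattice $\sigma(\mathcal{M}_p)\subset\mathbb{R}^s$ satisfies $$\delta(\sigma(\mathcal{M}_p))\geq\frac{1}{2^s\sqrt{p}}.$$
   Context: Here $\zeta_p$ is a primitive $p$-th root of unity, $\mathbb{L}=\mathbb{Q}(\zeta_p)$, and $\mathcal{O}_{\mathbb{K}}$ is the ring of algebraic integers of $\mathbb{K}$. Let $u$ be an integer whose class generates $(\mathbb{Z}/p\mathbb{Z})^{\star}$, let $\sigma_u$ be the automorphism of $\mathbb{L}$ with $\sigma_u(\zeta_p)=\zeta_p^u$, let $\theta=\sigma_u|_{\mathbb{K}}$ (a generator of $\mathrm{Gal}(\mathbb{K}/\mathbb{Q})$), and let $t=\mathrm{Tr}_{\mathbb{L}/\mathbb{K}}(\zeta_p)$. The map $(a_0,\ldots,a_{s-1})\mapsto\sum_{i=0}^{s-1}a_i\theta^i(t)$ is an isomorphism of $\mathbb{Z}$-modules $\mathbb{Z}^s\to\mathcal{O}_{\mathbb{K}}$, and through it elements ${\bf x}\in\mathcal{O}_{\mathbb{K}}$ are identified with their coordinate vectors ${\bf x}=(a_0,\ldots,a_{s-1})\in\mathbb{Z}^s$. Let $\beta\in\mathbb{Z}$ be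 a primitive root modulo $p$ (of multiplicative order $p-1$ modulo $p$), and put $\alpha=\beta^{(p-1)/s}$. For $i=0,1,\ldots,s-1$ let $\mu_i=(1,\alpha^i,\alpha^{2i},\ldots,\alpha^{(s-1)i})\in\mathbb{Z}^s$, and let $\cdot$ denote the usual dot product on $\mathbb{Z}^s$. For $s$ even, $\mathcal{M}_p=\{{\bf x}\in\mathcal{O}_{\mathbb{K}}:{\bf x}\cdot\mu_i\equiv 0\pmod p\text{ for all } i=0,1,\ldots,\frac{s}{2}\}$. Canonical embedding: let $\sigma_1,\ldots,\sigma_s$ be the embeddings $\mathbb{K}\to\mathbb{C}$, with $\sigma_1,\ldots,\sigma_{r_1}$ real and $\sigma_{r_1+1},\ldots,\sigma_{r_1+r_2}$ representatives of the $r_2$ complex-conjugate pairs of non-real ones ($s=r_1+2r_2$). Then $\sigma:\mathbb{K}\to\mathbb{R}^s$ is $\sigma(x)=(\sigma_1(x),\ldots,\sigma_{r_1}(x),\mathrm{Re}\,\sigma_{r_1+1}(x),\mathrm{Im}\,\sigma_{r_1+1}(x),\ldots,\mathrm{Re}\,\sigma_{r_1+r_2}(x),\mathrm{Im}\,\sigma_{r_1+r_2}(x))$. For a full-rank lattice $\Lambda\subset\mathbb{R}^n$, the packing radius is $\rho=\frac12\min\{\|v\|:v\in\Lambda\setminus\{0\}\}$, the volume $\mathrm{vol}(\Lambda)$ is the square root of the determinant of a Gram matrix of a $\mathbb{Z}$-basis of $\Lambda$, and the center density is $\delta(\Lambda)=\rho^n/\mathrm{vol}(\Lambda)$. -}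

module Defs where

open import Level using (Level; _⊔_) renaming (suc to lsuc)
open import Algebra.Apartness.Bundles using (HeytingField; module HeytingCommutativeRing)
open import Algebra.Bundles using (CommutativeRing)
open import Algebra.Bundles.Raw using (RawRing)
open import Algebra.Morphism.Structures using (module RingMorphisms)
import Algebra.Properties.Semiring.Exp as Exp
import Algebra.Properties.Semiring.Mult as Mult
import Algebra.Properties.Semiring.Sum as Sum
open import Data.Fin.Base using (Fin; zero; suc; toℕ; punchIn)
open import Data.Integer.Base as ℤ using (ℤ; +_; -[1+_])
import Data.Integer.Divisibility as ℤ
import Data.Integer.Properties as ℤ
open import Data.Nat.Base as ℕ using (ℕ; zero; suc; NonZero)
open import Data.Nat.DivMod using (_/_)
open import Data.Nat.GeneralisedArithmetic using (fold)
open import Data.Product.Base using (Σ; ∃; ∃-syntax; _×_; _,_; proj₁; proj₂)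
open import Data.Rational.Base as ℚ using (ℚ; 0ℚ)
open import Data.Sum.Base using (_⊎_)
open import Data.Vec.Functional using (Vector; []; _∷_; _++_; concat)
open import Relation.Binary.Core using (Rel)
open import Relation.Binary.PropositionalEquality.Core using (_≡_)
open import Relation.Binary.Structures using (IsStrictPartialOrder)
open import Relation.Nullary.Negation.Core using (¬_)
open import Relation.Unary using (Pred; _∈_)

module RingNotation {c ℓ} (R : CommutativeRing c ℓ) where
  open CommutativeRing R hiding (zero)
  open Exp semiring public using (_^_)
  open Mult semiring public using () renaming (_×_ to _·ℕ_)
  open Sum semiring public using (sum)

  infixl 7 _·ℤ_

  _·ℤ_ : ℤ → Carrier → Carrier
  (+ n)    ·ℤ x = n ·ℕ x
  -[1+ n ] ·ℤ x = - (suc n ·ℕ x)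

  sign : ℕ → Carrier → Carrier
  sign zero    x = x
  sign (suc n) x = - sign n x

  -- Laplace expansion along the first row.
  det : ∀ {n} → (Fin n → Fin n → Carrier) → Carrier
  det {zero}  A = 1#
  det {suc n} A =
    sum λ j → sign (toℕ j) (A zero j * det λ i k → A (suc i) (punchIn j k))

module _ where
  open Sum (CommutativeRing.semiring ℤ.+-*-commutativeRing) using (sum)

  GeneratesUnits : ℕ → ℤ → Set
  GeneratesUnits p u =
    ¬ ((+ p) ℤ.∣ u) ×
    (∀ a → ¬ ((+ p) ℤ.∣ a) → ∃[ k ] (+ p) ℤ.∣ (u ℤ.^ k ℤ.- a))

  -- b has multiplicative order p - 1 modulo p.
  IsPrimitiveRootMod : ℕ → ℤ → Set
  IsPrimitiveRootMod p b =
    (+ p) ℤ.∣ (b ℤ.^ (p ℕ.∸ 1) ℤ.- ℤ.1ℤ) ×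
    (∀ k → 0 ℕ.< k → k ℕ.< p ℕ.∸ 1 → ¬ ((+ p) ℤ.∣ (b ℤ.^ k ℤ.- ℤ.1ℤ)))

  μ : ∀ s → ℤ → ℕ → Vector ℤ s
  μ s α i j = α ℤ.^ (toℕ j ℕ.* i)

  dot : ∀ {s} → Vector ℤ s → Vector ℤ s → ℤ
  dot a b = sum λ j → a j ℤ.* b j

-- The real numbers, axiomatised as a Cauchy-complete Archimedean ordered
-- field, up to isomorphism the only one; the carrier is a setoid.
record Reals c ℓ₁ ℓ₂ : Set (lsuc (c ⊔ ℓ₁ ⊔ ℓ₂)) where
  field
    heytingField : HeytingField c ℓ₁ ℓ₂

  open HeytingField heytingField public

  commutativeRing : CommutativeRing c ℓ₁
  commutativeRing = HeytingCommutativeRing.commutativeRing heytingCommutativeRing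

  open RingNotation commutativeRing public

  infix 4 _<_ _≤_

  field
    _<_                  : Rel Carrier ℓ₂
    isStrictPartialOrder : IsStrictPartialOrder _≈_ _<_
    #⇒<∨>                : ∀ {x y} → x # y → x < y ⊎ y < x
    <⇒#                  : ∀ {x y} → x < y → x # y
    +-monoˡ-<            : ∀ {x y} z → x < y → x + z < y + z
    *-positive           : ∀ {x y} → 0# < x → 0# < y → 0# < x * y
    archimedean          : ∀ x → ∃[ n ] x < n ·ℕ 1#

  _≤_ : Rel Carrier ℓ₂
  x ≤ y = ¬ (y < x)

  -- No absolute value is needed, since m and n may be exchanged.
  IsCauchy : (ℕ → Carrier) → Set ℓ₂
  IsCauchy f = ∀ k → ∃[ N ] ∀ m n → N ℕ.≤ m → N ℕ.≤ n →
    suc k ·ℕ (f m - f n) < 1#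

  ConvergesTo : (ℕ → Carrier) → Carrier → Set ℓ₂
  ConvergesTo f l = ∀ k → ∃[ N ] ∀ n → N ℕ.≤ n →
    suc k ·ℕ (f n - l) < 1# × suc k ·ℕ (l - f n) < 1#

  field
    complete : ∀ f → IsCauchy f → ∃ (ConvergesTo f)

  IsSqrt : Carrier → Carrier → Set (ℓ₁ ⊔ ℓ₂)
  IsSqrt x r = 0# ≤ r × r * r ≈ x

  IsQuotient : Carrier → Carrier → Carrier → Set (ℓ₁ ⊔ ℓ₂)
  IsQuotient x y q = y # 0# × q * y ≈ x

module Complex {c ℓ₁ ℓ₂} (ℝ : Reals c ℓ₁ ℓ₂) where
  open Reals ℝ

  -- (x , y) is x + iy.
  ℂ : RawRing c ℓ₁
  ℂ = record
    { Carrier = Carrier × Carrier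
    ; _≈_     = λ (a , b) (c , d) → a ≈ c × b ≈ d
    ; _+_     = λ (a , b) (c , d) → a + c , b + d
    ; _*_     = λ (a , b) (c , d) → a * c - b * d , a * d + b * c
    ; -_      = λ (a , b) → - a , - b
    ; 0#      = 0# , 0#
    ; 1#      = 1# , 0#
    }

  conj : RawRing.Carrier ℂ → RawRing.Carrier ℂ
  conj (a , b) = a , - b

-- A lattice in ℝⁿ is given as a predicate on vectors.
module Lattice {c ℓ₁ ℓ₂} (ℝ : Reals c ℓ₁ ℓ₂) {n : ℕ} where
  open Reals ℝ

  infix 4 _≋_

  _≋_ : Rel (Vector Carrier n) ℓ₁
  v ≋ w = ∀ i → v i ≈ w i

  0ᵛ : Vector Carrier n
  0ᵛ _ = 0#

  ⟨_,_⟩ : Vector Carrier n → Vector Carrier n → Carrier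
  ⟨ v , w ⟩ = sum λ i → v i * w i

  IsNorm : Vector Carrier n → Carrier → Set (ℓ₁ ⊔ ℓ₂)
  IsNorm v = IsSqrt ⟨ v , v ⟩

  ℤ-combination : ∀ {r} → Vector ℤ r → Vector (Vector Carrier n) r → Vector Carrier n
  ℤ-combination a B i = sum λ j → a j ·ℤ B j i

  IsℤBasis : ∀ {ℓ r} → Pred (Vector Carrier n) ℓ → Vector (Vector Carrier n) r →
             Set (c ⊔ ℓ₁ ⊔ ℓ)
  IsℤBasis Λ B =
    (∀ j → B j ∈ Λ) ×
    (∀ v → v ∈ Λ → ∃[ a ] v ≋ ℤ-combination a B) ×
    (∀ a → ℤ-combination a B ≋ 0ᵛ → ∀ j → a j ≡ ℤ.0ℤ)

  gram : ∀ {r} → Vector (Vector Carrier n) r → Fin r → Fin r → Carrier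
  gram B i j = ⟨ B i , B j ⟩

  module _ {ℓ} (Λ : Pred (Vector Carrier n) ℓ) where

    IsMinimalNorm : Carrier → Set (c ⊔ ℓ₁ ⊔ ℓ₂ ⊔ ℓ)
    IsMinimalNorm r =
      (∃[ v ] v ∈ Λ × ¬ (v ≋ 0ᵛ) × IsNorm v r) ×
      (∀ v → v ∈ Λ → ¬ (v ≋ 0ᵛ) → ∀ r′ → IsNorm v r′ → r ≤ r′)

    IsPackingRadius : Carrier → Set (c ⊔ ℓ₁ ⊔ ℓ₂ ⊔ ℓ)
    IsPackingRadius ρ = IsMinimalNorm (ρ + ρ)

    -- Bases have n elements: Λ has full rank.
    IsVolume : Carrier → Set (c ⊔ ℓ₁ ⊔ ℓ₂ ⊔ ℓ)
    IsVolume vol = ∃[ B ] IsℤBasis {r = n} Λ B × IsSqrt (det (gram B)) vol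

    IsCenterDensity : Carrier → Set (c ⊔ ℓ₁ ⊔ ℓ₂ ⊔ ℓ)
    IsCenterDensity δ = ∃[ ρ ] ∃[ vol ]
      IsPackingRadius ρ × IsVolume vol × IsQuotient (ρ ^ n) vol δ

record Extensionℚ c ℓ₁ ℓ₂ : Set (lsuc (c ⊔ ℓ₁ ⊔ ℓ₂)) where
  field
    heytingField : HeytingField c ℓ₁ ℓ₂

  open HeytingField heytingField public

  commutativeRing : CommutativeRing c ℓ₁
  commutativeRing = HeytingCommutativeRing.commutativeRing heytingCommutativeRing

  open RingNotation commutativeRing public

  rawRing : RawRing c ℓ₁
  rawRing = CommutativeRing.rawRing commutativeRing

  field
    ι                : ℚ → Carrier
    ι-isHomomorphism : RingMorphisms.IsRingHomomorphism ℚ.+-*-rawRing rawRing ι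

record Subfield {c ℓ₁ ℓ₂} (L : Extensionℚ c ℓ₁ ℓ₂) ℓ : Set (c ⊔ ℓ₁ ⊔ lsuc ℓ) where
  open Extensionℚ L
  field
    Member    : Pred Carrier ℓ
    resp      : ∀ {x y} → x ≈ y → x ∈ Member → y ∈ Member
    0∈        : 0# ∈ Member
    1∈        : 1# ∈ Member
    +-closed  : ∀ {x y} → x ∈ Member → y ∈ Member → x + y ∈ Member
    *-closed  : ∀ {x y} → x ∈ Member → y ∈ Member → x * y ∈ Member
    -‿closed  : ∀ {x} → x ∈ Member → - x ∈ Member
    ⁻¹-closed : ∀ {x y} → x * y ≈ 1# → x ∈ Member → y ∈ Member

  rawRing′ : RawRing (c ⊔ ℓ) ℓ₁
  rawRing′ = record
    { Carrier = Σ Carrier Member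
    ; _≈_     = λ (x , _) (y , _) → x ≈ y
    ; _+_     = λ (x , x∈) (y , y∈) → x + y , +-closed x∈ y∈
    ; _*_     = λ (x , x∈) (y , y∈) → x * y , *-closed x∈ y∈
    ; -_      = λ (x , x∈) → - x , -‿closed x∈
    ; 0#      = 0# , 0∈
    ; 1#      = 1# , 1∈
    }

module FieldTheory {c ℓ₁ ℓ₂} (L : Extensionℚ c ℓ₁ ℓ₂) where
  open Extensionℚ L

  IsPrimitiveRootOfUnity : ℕ → Carrier → Set ℓ₁
  IsPrimitiveRootOfUnity n ζ =
    ζ ^ n ≈ 1# × (∀ k → 0 ℕ.< k → k ℕ.< n → ¬ (ζ ^ k ≈ 1#))

  -- ℚ(ζ), the smallest subfield containing ζ.
  data ℚ⟨_⟩ (ζ : Carrier) : Pred Carrier (c ⊔ ℓ₁) where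
    gen  : ζ ∈ ℚ⟨ ζ ⟩
    rat  : ∀ q → ι q ∈ ℚ⟨ ζ ⟩
    add  : ∀ {x y} → x ∈ ℚ⟨ ζ ⟩ → y ∈ ℚ⟨ ζ ⟩ → x + y ∈ ℚ⟨ ζ ⟩
    mul  : ∀ {x y} → x ∈ ℚ⟨ ζ ⟩ → y ∈ ℚ⟨ ζ ⟩ → x * y ∈ ℚ⟨ ζ ⟩
    inv  : ∀ {x y} → x * y ≈ 1# → x ∈ ℚ⟨ ζ ⟩ → y ∈ ℚ⟨ ζ ⟩
    resp : ∀ {x y} → x ≈ y → x ∈ ℚ⟨ ζ ⟩ → y ∈ ℚ⟨ ζ ⟩

  -- y = xᵘ, where u may be negative.
  IsPower : Carrier → ℤ → Carrier → Set ℓ₁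
  IsPower x (+ n)    y = y ≈ x ^ n
  IsPower x -[1+ n ] y = y * x ^ suc n ≈ 1#

  IsAutomorphism : (Carrier → Carrier) → Set (c ⊔ ℓ₁)
  IsAutomorphism = RingMorphisms.IsRingIsomorphism rawRing rawRing

  module _ {ℓ} (K : Subfield L ℓ) where
    open Subfield K using (Member)

    -- [K : ℚ] = d.
    HasDegree : ℕ → Set (c ⊔ ℓ₁ ⊔ ℓ)
    HasDegree d = Σ (Vector Carrier d) λ e →
      (∀ i → e i ∈ Member) ×
      (∀ x → x ∈ Member → Σ (Vector ℚ d) λ q → x ≈ sum λ i → ι (q i) * e i) ×
      ((q : Vector ℚ d) → sum (λ i → ι (q i) * e i) ≈ 0# → ∀ i → q i ≡ 0ℚ)

    𝒪 : Pred Carrier (ℓ₁ ⊔ ℓ)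
    𝒪 x = x ∈ Member ×
      ∃[ n ] Σ (Vector ℤ n) λ a → x ^ n + sum (λ i → a i ·ℤ x ^ toℕ i) ≈ 0#

    InGal : (Carrier → Carrier) → Set (c ⊔ ℓ₁ ⊔ ℓ)
    InGal f = IsAutomorphism f × (∀ x → x ∈ Member → f x ≈ x)

    -- g lists Gal(L/K) without repetition.
    ListsGal : ∀ {m} → Vector (Carrier → Carrier) m → Set (c ⊔ ℓ₁ ⊔ ℓ)
    ListsGal g =
      (∀ i → InGal (g i)) ×
      (∀ i j → (∀ x → g i x ≈ g j x) → i ≡ j) ×
      ((f : Carrier → Carrier) → InGal f → ∃[ i ] ∀ x → f x ≈ g i x)

    -- t = Tr(x) for L/K Galois: the sum of the conjugates of x over K.
    IsTrace : Carrier → Carrier → Set (c ⊔ ℓ₁ ⊔ ℓ)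
    IsTrace x t = ∃[ m ] Σ (Vector (Carrier → Carrier) m) λ g →
      ListsGal g × t ≈ sum λ i → g i x

    -- α is β^((p-1)/s).  As t lies in K, the
    -- conjugate θⁱ(t), with θ the restriction of σᵤ to K, is σᵤⁱ(t).
    ℳ : (p s : ℕ) .{{_ : NonZero s}} (σᵤ : Carrier → Carrier) (t : Carrier) (β : ℤ) →
        Pred Carrier (ℓ₁ ⊔ ℓ)
    ℳ p s σᵤ t β x = 𝒪 x × Σ (Vector ℤ s) λ a →
      x ≈ sum (λ i → a i ·ℤ fold t σᵤ (toℕ i)) ×
      (∀ i → i ℕ.≤ s / 2 → (+ p) ℤ.∣ dot a (μ s (β ℤ.^ ((p ℕ.∸ 1) / s)) i))

module _ {c ℓ₁ ℓ₂ c′ ℓ₁′ ℓ₂′ ℓ} (ℝ : Reals c ℓ₁ ℓ₂)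
         {L : Extensionℚ c′ ℓ₁′ ℓ₂′} (K : Subfield L ℓ) where

  open Complex ℝ
  private
    module ℝ = Reals ℝ
    module ℂ = RawRing ℂ
    module K = RawRing (Subfield.rawRing′ K)

  IsEmbedding : (K.Carrier → ℂ.Carrier) → Set (c′ ⊔ ℓ ⊔ ℓ₁′ ⊔ ℓ₁)
  IsEmbedding = RingMorphisms.IsRingHomomorphism (Subfield.rawRing′ K) ℂ

  IsReal : (K.Carrier → ℂ.Carrier) → Set (c′ ⊔ ℓ ⊔ ℓ₁)
  IsReal f = ∀ x → proj₂ (f x) ℝ.≈ ℝ.0#

  _≗_ : Rel (K.Carrier → ℂ.Carrier) (c′ ⊔ ℓ ⊔ ℓ₁)
  f ≗ g = ∀ x → f x ℂ.≈ g x

  -- The embeddings of a field K of degree s: the real ones, and one from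
  -- each pair of complex conjugate non-real ones.
  record Embeddings (s : ℕ) : Set (c ⊔ ℓ₁ ⊔ c′ ⊔ ℓ₁′ ⊔ ℓ) where
    field
      r₁ r₂            : ℕ
      signature        : s ≡ r₁ ℕ.+ 2 ℕ.* r₂
      real             : Vector (K.Carrier → ℂ.Carrier) r₁
      nonreal          : Vector (K.Carrier → ℂ.Carrier) r₂
      real-embedding   : ∀ i → IsEmbedding (real i)
      real-isReal      : ∀ i → IsReal (real i)
      real-distinct    : ∀ i j → real i ≗ real j → i ≡ j
      nonreal-embedding : ∀ i → IsEmbedding (nonreal i)
      nonreal-notReal  : ∀ i → ¬ IsReal (nonreal i)
      nonreal-distinct : ∀ i j → nonreal i ≗ nonreal j ⊎
                         nonreal i ≗ (λ x → conj (nonreal j x)) → i ≡ j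
      exhaustive       : ∀ f → IsEmbedding f →
                         (∃[ i ] f ≗ real i) ⊎
                         (∃[ i ] f ≗ nonreal i) ⊎
                         (∃[ i ] f ≗ λ x → conj (nonreal i x))

    dimension : ℕ
    dimension = r₁ ℕ.+ r₂ ℕ.* 2

    canonical : K.Carrier → Vector ℝ.Carrier dimension
    canonical x =
      (λ i → proj₁ (real i x)) ++
      concat (λ i → proj₁ (nonreal i x) ∷ proj₂ (nonreal i x) ∷ [])

    image : ∀ {ℓ′} → Pred (Extensionℚ.Carrier L) ℓ′ →
            Pred (Vector ℝ.Carrier dimension) (c′ ⊔ ℓ ⊔ ℓ₁ ⊔ ℓ′)
    image M v = ∃[ x ] proj₁ x ∈ M × (∀ i → v i ℝ.≈ canonical x i)

{-# OPTIONS --safe #-}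
-- Let N = p - 1 = m s, and let ηᵢ (i < s) be the Gaussian periods of length m. In these
-- coordinates the trace form is Tr (x y̅) = p Σ aᵢ bᵢ - m (Σ aᵢ) (Σ bᵢ), and the squared norm of
-- the canonical embedding is this form divided by k, where k = 1 if K is real and k = 2 otherwise.
-- Membership in ℳ says that â(αⁱ) ≡ 0 mod p for i ≤ s/2. By Parseval such a code is
-- self-orthogonal, so p divides Σ aᵢ² as well as Σ aᵢ, hence p² divides the positive integer
-- Tr (x x̅): this gives k (2ρ)² ≥ p². The code has index p ^ (s/2 + 1) and the form has
-- determinant p ^ (s - 1), so kˢ vol² ≤ p ^ (2 s + 1), and the bound follows.
--
-- The identification of K is Galois theory over the explicit orbit σᵏζ. An element of P[ζ] fixed
-- by σ lies in P, for P = ℚ and P = ℤ, by applying x ↦ Tr (x / ζ) - Tr x. Dedekind's independence of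
-- characters and a dimension count show that K is the fixed field of σˢ, so that t = η₀. The
-- embeddings of K are g ∘ σⁱ for one g, and complex conjugation is some g ∘ σᶜ; were σᶜ not the
-- inversion ζ ↦ ζ⁻¹ on K, the squared norm of η₀ would be - m / k < 0.
module Submission where

open import Defs
open import Algebra.Apartness.Bundles using (HeytingField)
open import Algebra.Bundles using (CommutativeRing)
open import Algebra.Bundles.Raw using (RawRing)
import Algebra.Morphism.Construct.Composition as Composition
import Algebra.Morphism.Construct.Identity as Identity
open import Algebra.Morphism.Structures using (module RingMorphisms)
import Algebra.Properties.AbelianGroup as AbelianGroupProperties
import Algebra.Properties.CommutativeSemiring.Exp as Exp
import Algebra.Properties.Ring as RingProperties
import Algebra.Properties.Semiring.Mult as Mult
import Algebra.Properties.Semiring.Sum as Sum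
import Algebra.Solver.Ring as RingSolver
open import Algebra.Solver.Ring.AlmostCommutativeRing using (fromCommutativeRing; _-Raw-AlmostCommutative⟶_)
open import Data.Empty using (⊥)
open import Data.Fin.Base as Fin using (Fin; zero; suc; toℕ; punchIn; fromℕ<; splitAt; quotRem; _↑ˡ_; _↑ʳ_)
open import Data.Fin.Permutation using (Permutation; _⟨$⟩ʳ_; permutation; _⟨$⟩ˡ_; inverseʳ)
import Data.Fin.Properties as Fin
open import Data.Integer.Base as ℤ using (ℤ; +_; -[1+_])
import Data.Integer.DivMod as ℤ
import Data.Integer.Divisibility as ℤ
open import Data.Integer.Divisibility.Signed as ℤ∣ using (divides)
import Data.Integer.Properties as ℤ
open import Data.Maybe.Base using (Maybe; just; nothing)
open import Data.Nat.Base as ℕ using (ℕ; zero; suc; s≤s; z≤n; NonZero; _∸_)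
open import Data.Nat.DivMod using (_/_; _%_; m%n<n; m≡m%n+[m/n]*n; [m+kn]%n≡m%n; m<n⇒m%n≡m; m*n/n≡m)
open import Data.Nat.Divisibility as ℕ using (_∣_)
open import Data.Nat.GeneralisedArithmetic using (fold)
open import Data.Nat.Primality using (Prime; euclidsLemma; ¬prime[1])
import Data.Nat.Properties as ℕ
open import Data.Product.Base using (_×_; _,_; ∃-syntax; proj₁; proj₂; Σ; uncurry)
open import Data.Rational.Base as ℚ using (ℚ; 0ℚ; 1ℚ; mkℚ; toℚᵘ)
import Data.Rational.Properties as ℚ
import Data.Rational.Unnormalised.Base as ℚᵘ
import Data.Rational.Unnormalised.Properties as ℚᵘ
open import Data.Sum.Base using (_⊎_; inj₁; inj₂; [_,_])
open import Data.Unit.Polymorphic.Base using (⊤; tt)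
open import Data.Vec.Functional using (Vector; _∷_; tail; insertAt; _++_; concat; [])
open import Data.Vec.Functional.Properties using (insertAt-lookup; insertAt-punchIn)
open import Function.Base using (_∘_; flip)
open import Function.Definitions using (Injective)
open import Level using (_⊔_; 0ℓ) renaming (suc to lsuc)
open import Relation.Binary.Definitions using (tri<; tri≈; tri>)
open import Relation.Binary.PropositionalEquality.Core as ≡ using (_≡_; _≢_)
open import Relation.Binary.PropositionalEquality.Properties using (module ≡-Reasoning)
import Relation.Binary.Reasoning.Setoid as SetoidReasoning
open import Relation.Binary.Structures using (IsStrictPartialOrder)
open import Relation.Nullary using (yes; no; ¬_; contradiction; Dec)
open import Relation.Unary using (Pred; _∈_)

-- The indices i = 0, ..., s/2 meet every pair i, -i modulo s, which is what kills each Parseval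
-- term; i = 0 also gives Σ aᵢ. The volume comes with an arbitrary basis: writing known codewords in
-- it factors their determinant p ^ (s/2 + 1) over ℤ, so the bound is a matter of divisibility. The
-- factor k enters ((2ρ)²)ˢ and vol² with the same power s and cancels in ρˢ / vol. The functional x
-- ↦ Tr (x / ζ) - Tr x is chosen because Tr ζⁿ takes only the values N and -1: on powers of ζ it is
-- 0 or ± p, and p can be cancelled. The fields are Heyting fields, whose axioms give no decidable
-- equality, whereas pivots and least periods must be chosen. In L decidability is won from
-- arithmetic: the constant term of the characteristic polynomial of x along the orbit of σ is
-- rational, and it vanishes exactly when x does. In ℝ the claims are inequalities x ≤ y, which are
-- negations, so cases may be distinguished under double negation.

-- Computation in commutative rings

module RingTools {c ℓ} (R : CommutativeRing c ℓ) where
  open CommutativeRing R public hiding (zero)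
  open RingNotation R public
  open Exp commutativeSemiring public hiding (_^_)
  open Mult semiring public using (×-homo-+; ×1-homo-*; ×-assoc-*; ×-congʳ)
  open Sum semiring public hiding (sum; sum-syntax; sum⁺-syntax)
  open RingProperties ring public
    using (-0#≈0#; -‿involutive; -‿distribˡ-*; -‿distribʳ-*; x∙y⁻¹≈ε⇒x≈y)
  open AbelianGroupProperties +-abelianGroup public using (⁻¹-∙-comm)
  module ≈-Reasoning = SetoidReasoning setoid

  -- The canonical homomorphism from ℤ, which carries integer identities into every ring below.
  ⟦_⟧ : ℤ → Carrier
  ⟦ a ⟧ = a ·ℤ 1#

  ⟦⟧-cong : ∀ {a b} → a ≡ b → ⟦ a ⟧ ≈ ⟦ b ⟧
  ⟦⟧-cong ≡.refl = refl

  private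
    shift : ∀ x y z → (x + y) - (x + z) ≈ y - z
    shift x y z = begin
      (x + y) - (x + z)       ≈⟨ +-congˡ (⁻¹-∙-comm x z) ⟨
      (x + y) + (- x - z)     ≈⟨ +-congʳ (+-comm x y) ⟩
      (y + x) + (- x - z)     ≈⟨ +-assoc y x _ ⟩
      y + (x + (- x - z))     ≈⟨ +-congˡ (+-assoc x (- x) _) ⟨
      y + ((x - x) - z)       ≈⟨ +-congˡ (+-congʳ (-‿inverseʳ x)) ⟩
      y + (0# - z)            ≈⟨ +-congˡ (+-identityˡ _) ⟩
      y - z                   ∎
      where open ≈-Reasoning

    ⊖-homo : ∀ m n → ⟦ m ℤ.⊖ n ⟧ ≈ m ·ℕ 1# - n ·ℕ 1#
    ⊖-homo m zero = sym (trans (+-congˡ -0#≈0#) (+-identityʳ _))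
    ⊖-homo zero (suc n) = sym (+-identityˡ _)
    ⊖-homo (suc m) (suc n) =
      trans (⟦⟧-cong (ℤ.[1+m]⊖[1+n]≡m⊖n m n)) (trans (⊖-homo m n) (sym (shift 1# _ _)))

  ⟦⟧-homo-- : ∀ a → ⟦ ℤ.- a ⟧ ≈ - ⟦ a ⟧
  ⟦⟧-homo-- (+ zero)  = sym -0#≈0#
  ⟦⟧-homo-- (+ suc n) = refl
  ⟦⟧-homo-- -[1+ n ]  = sym (-‿involutive _)

  ⟦⟧-homo-+ : ∀ a b → ⟦ a ℤ.+ b ⟧ ≈ ⟦ a ⟧ + ⟦ b ⟧
  ⟦⟧-homo-+ (+ m)    (+ n)    = ×-homo-+ 1# m n
  ⟦⟧-homo-+ (+ m)    -[1+ n ] = ⊖-homo m (suc n)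
  ⟦⟧-homo-+ -[1+ m ] (+ n)    = trans (⊖-homo n (suc m)) (+-comm _ _)
  ⟦⟧-homo-+ -[1+ m ] -[1+ n ] = begin
    - (suc (suc (m ℕ.+ n)) ·ℕ 1#)       ≡⟨ ≡.cong (λ k → - (suc k ·ℕ 1#)) (≡.sym (ℕ.+-suc m n)) ⟩
    - ((suc m ℕ.+ suc n) ·ℕ 1#)         ≈⟨ -‿cong (×-homo-+ 1# (suc m) (suc n)) ⟩
    - (suc m ·ℕ 1# + suc n ·ℕ 1#)       ≈⟨ ⁻¹-∙-comm _ _ ⟨
    - (suc m ·ℕ 1#) - (suc n ·ℕ 1#)     ∎
    where open ≈-Reasoning

  private
    homo-*-+ : ∀ m b → ⟦ + m ℤ.* b ⟧ ≈ m ·ℕ 1# * ⟦ b ⟧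
    homo-*-+ m (+ n) = trans (⟦⟧-cong (≡.sym (ℤ.pos-* m n))) (×1-homo-* m n)
    homo-*-+ m -[1+ n ] = begin
      ⟦ + m ℤ.* -[1+ n ] ⟧            ≈⟨ ⟦⟧-cong (≡.sym (ℤ.neg-distribʳ-* (+ m) (+ suc n))) ⟩
      ⟦ ℤ.- (+ m ℤ.* + suc n) ⟧       ≈⟨ ⟦⟧-homo-- (+ m ℤ.* + suc n) ⟩
      - ⟦ + m ℤ.* + suc n ⟧           ≈⟨ -‿cong (homo-*-+ m (+ suc n)) ⟩
      - (m ·ℕ 1# * (suc n ·ℕ 1#))     ≈⟨ -‿distribʳ-* _ _ ⟩
      m ·ℕ 1# * - (suc n ·ℕ 1#)       ∎
      where open ≈-Reasoning

  ⟦⟧-homo-* : ∀ a b → ⟦ a ℤ.* b ⟧ ≈ ⟦ a ⟧ * ⟦ b ⟧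
  ⟦⟧-homo-* (+ m) b = homo-*-+ m b
  ⟦⟧-homo-* -[1+ m ] b = begin
    ⟦ -[1+ m ] ℤ.* b ⟧            ≈⟨ ⟦⟧-cong (≡.sym (ℤ.neg-distribˡ-* (+ suc m) b)) ⟩
    ⟦ ℤ.- (+ suc m ℤ.* b) ⟧       ≈⟨ ⟦⟧-homo-- (+ suc m ℤ.* b) ⟩
    - ⟦ + suc m ℤ.* b ⟧           ≈⟨ -‿cong (homo-*-+ (suc m) b) ⟩
    - (suc m ·ℕ 1# * ⟦ b ⟧)       ≈⟨ -‿distribˡ-* _ _ ⟩
    - (suc m ·ℕ 1#) * ⟦ b ⟧       ∎
    where open ≈-Reasoning

  ⟦⟧-homo-1 : ⟦ ℤ.1ℤ ⟧ ≈ 1#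
  ⟦⟧-homo-1 = +-identityʳ 1#

  ·ℕ-* : ∀ n x → n ·ℕ x ≈ n ·ℕ 1# * x
  ·ℕ-* n x = sym (trans (×-assoc-* n 1# x) (×-congʳ n (*-identityˡ x)))

  ·ℤ-* : ∀ a x → a ·ℤ x ≈ ⟦ a ⟧ * x
  ·ℤ-* (+ n) x = ·ℕ-* n x
  ·ℤ-* -[1+ n ] x = trans (-‿cong (·ℕ-* (suc n) x)) (-‿distribˡ-* _ x)

  private
    -- Agrees with ⟦_⟧, but sends the literals 1 and -1 to 1# and - 1# by computation.
    literal : ℤ → Carrier
    literal (+ 1)    = 1#
    literal -[1+ 0 ] = - 1#
    literal a        = ⟦ a ⟧

    literal≈ : ∀ a → literal a ≈ ⟦ a ⟧
    literal≈ (+ 0)             = refl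
    literal≈ (+ 1)             = sym ⟦⟧-homo-1
    literal≈ (+ suc (suc n))   = refl
    literal≈ -[1+ 0 ]          = -‿cong (sym ⟦⟧-homo-1)
    literal≈ -[1+ suc n ]      = refl

    morphism : ℤ.+-*-rawRing -Raw-AlmostCommutative⟶ fromCommutativeRing R
    morphism = record
      { ⟦_⟧    = literal
      ; +-homo = λ a b → trans (literal≈ (a ℤ.+ b))
          (trans (⟦⟧-homo-+ a b) (+-cong (sym (literal≈ a)) (sym (literal≈ b))))
      ; *-homo = λ a b → trans (literal≈ (a ℤ.* b))
          (trans (⟦⟧-homo-* a b) (*-cong (sym (literal≈ a)) (sym (literal≈ b))))
      ; -‿homo = λ a → trans (literal≈ (ℤ.- a))
          (trans (⟦⟧-homo-- a) (-‿cong (sym (literal≈ a))))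
      ; 0-homo = refl
      ; 1-homo = refl
      }

    coeff≟ : ∀ a b → Maybe (literal a ≈ literal b)
    coeff≟ a b with a ℤ.≟ b
    ... | yes a≡b = just (reflexive (≡.cong literal a≡b))
    ... | no  _   = nothing

  -- Instantiating the solver module here would copy all of it into every instance of RingTools.
  module Solver where
    infix  4 _:=_
    infixl 8 _:*_
    infixl 7 _:+_ _:-_
    infix  9 :-_

    Polynomial : ℕ → Set
    Polynomial = RingSolver.Polynomial ℤ.+-*-rawRing (fromCommutativeRing R) morphism coeff≟

    con : ∀ {n} → ℤ → Polynomial n
    con = RingSolver.con

    _:+_ _:*_ _:-_ : ∀ {n} → Polynomial n → Polynomial n → Polynomial n
    _:+_ = RingSolver._:+_ ℤ.+-*-rawRing (fromCommutativeRing R) morphism coeff≟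
    _:*_ = RingSolver._:*_ ℤ.+-*-rawRing (fromCommutativeRing R) morphism coeff≟
    _:-_ = RingSolver._:-_ ℤ.+-*-rawRing (fromCommutativeRing R) morphism coeff≟

    :-_ : ∀ {n} → Polynomial n → Polynomial n
    :-_ = RingSolver.:-_

    _:=_ : ∀ {n} → Polynomial n → Polynomial n → Polynomial n × Polynomial n
    _:=_ = _,_

    solve = RingSolver.solve ℤ.+-*-rawRing (fromCommutativeRing R) morphism coeff≟

  -- ∑ is opaque so that unification does not unfold it.
  opaque
    ∑ : ∀ {n} → (Fin n → Carrier) → Carrier
    ∑ = sum

    sum≈∑ : ∀ {n} (f : Fin n → Carrier) → sum f ≈ ∑ f
    sum≈∑ f = refl

    ∑-cong : ∀ {n} {f g : Fin n → Carrier} → (∀ i → f i ≈ g i) → ∑ f ≈ ∑ g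
    ∑-cong = sum-cong-≋

    ∑-+ : ∀ {n} (f g : Fin n → Carrier) → ∑ (λ i → f i + g i) ≈ ∑ f + ∑ g
    ∑-+ = ∑-distrib-+

    ∑-*ˡ : ∀ {n} a (f : Fin n → Carrier) → ∑ (λ i → a * f i) ≈ a * ∑ f
    ∑-*ˡ a f = sym (*-distribˡ-sum a f)

    ∑-*ʳ : ∀ {n} (f : Fin n → Carrier) a → ∑ (λ i → f i * a) ≈ ∑ f * a
    ∑-*ʳ f a = sym (*-distribʳ-sum a f)

    ∑-swap : ∀ {m n} (f : Fin m → Fin n → Carrier) → ∑ (λ i → ∑ (f i)) ≈ ∑ (λ j → ∑ λ i → f i j)
    ∑-swap = ∑-comm

    ∑-remove : ∀ {n} i (f : Fin (suc n) → Carrier) → ∑ f ≈ f i + ∑ (λ k → f (punchIn i k))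
    ∑-remove i f = sum-remove {i = i} f

    ∑-permutation : ∀ {m n} (f : Fin n → Carrier) (π : Permutation m n) →
                    ∑ f ≈ ∑ (λ i → f (π ⟨$⟩ʳ i))
    ∑-permutation f π = sum-permute f π

    ∑-suc : ∀ {n} (f : Fin (suc n) → Carrier) → ∑ f ≈ f zero + ∑ (λ i → f (suc i))
    ∑-suc f = refl

    ∑-empty : ∀ (f : Fin 0 → Carrier) → ∑ f ≈ 0#
    ∑-empty f = refl

    ∑-zero : ∀ {n} {f : Fin n → Carrier} → (∀ i → f i ≈ 0#) → ∑ f ≈ 0#
    ∑-zero {n} f≈0 = trans (sum-cong-≋ f≈0) (sum-replicate-zero n)

    ∑-const : ∀ n x → ∑ {n} (λ _ → x) ≈ n ·ℕ 1# * x
    ∑-const n x = trans (sum-replicate n) (·ℕ-* n x)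

  ∑-neg : ∀ {n} (f : Fin n → Carrier) → ∑ (λ i → - f i) ≈ - ∑ f
  ∑-neg f = trans (∑-cong λ i → minusOne (f i)) (trans (∑-*ˡ (- 1#) f) (sym (minusOne _)))
    where
    open Solver
    minusOne : ∀ x → - x ≈ - 1# * x
    minusOne = solve 1 (λ x → :- x := con ℤ.-1ℤ :* x) refl

-- Determinants and alternating multilinear functions

module Determinant {c ℓ} (R : CommutativeRing c ℓ) where
  open RingTools R
  open ≈-Reasoning

  sgn : ℕ → Carrier
  sgn n = sign n 1#

  sign-sgn : ∀ n x → sign n x ≈ sgn n * x
  sign-sgn zero    x = sym (*-identityˡ x)
  sign-sgn (suc n) x = trans (-‿cong (sign-sgn n x)) (-‿distribˡ-* _ x)

  minor : ∀ {n} → (Fin (suc n) → Fin (suc n) → Carrier) → Fin (suc n) → Fin n → Fin n → Carrier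
  minor A j i k = A (suc i) (punchIn j k)

  det-laplace : ∀ {n} (A : Fin (suc n) → Fin (suc n) → Carrier) →
                det A ≈ ∑ λ j → sgn (toℕ j) * A zero j * det (minor A j)
  det-laplace A = trans (sum≈∑ (λ j → sign (toℕ j) (A zero j * det (minor A j))))
    (∑-cong λ j → trans (sign-sgn (toℕ j) _) (sym (*-assoc _ _ _)))

  det-cong : ∀ {n} (A B : Fin n → Fin n → Carrier) → (∀ i j → A i j ≈ B i j) → det A ≈ det B
  det-cong {zero}  A B A≈B = refl
  det-cong {suc n} A B A≈B = trans (det-laplace A) (trans
    (∑-cong λ j → *-cong (*-congˡ (A≈B zero j))
      (det-cong (minor A j) (minor B j) λ i k → A≈B (suc i) (punchIn j k)))
    (sym (det-laplace B)))

  det-scale : ∀ {n} a (A : Fin n → Fin n → Carrier) → det (λ i j → a * A i j) ≈ a ^ n * det A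
  det-scale {zero}  a A = sym (*-identityʳ 1#)
  det-scale {suc n} a A = begin
    det (λ i j → a * A i j)
      ≈⟨ det-laplace (λ i j → a * A i j) ⟩
    ∑ (λ j → sgn (toℕ j) * (a * A zero j) * det (λ i k → a * minor A j i k))
      ≈⟨ ∑-cong (λ j → trans (*-congˡ (det-scale a (minor A j))) (rearrange (sgn (toℕ j)) a (A zero j) (a ^ n) (det (minor A j)))) ⟩
    ∑ (λ j → a ^ suc n * (sgn (toℕ j) * A zero j * det (minor A j)))
      ≈⟨ ∑-*ˡ (a ^ suc n) _ ⟩
    a ^ suc n * ∑ (λ j → sgn (toℕ j) * A zero j * det (minor A j))
      ≈⟨ *-congˡ (det-laplace A) ⟨
    a ^ suc n * det A ∎
    where
    open Solver
    rearrange : ∀ s a x b d → s * (a * x) * (b * d) ≈ a * b * (s * x * d)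
    rearrange = solve 5 (λ s a x b d → s :* (a :* x) :* (b :* d) := a :* b :* (s :* x :* d)) refl

  -- The diagonal is a sequence on ℕ, so that passing to the minor of a triangular matrix is the
  -- shift `d ∘ suc`.
  prod : (ℕ → Carrier) → ℕ → Carrier
  prod d zero    = 1#
  prod d (suc n) = d 0 * prod (d ∘ suc) n

  private
    zero-entry : ∀ s {x} y → x ≈ 0# → s * x * y ≈ 0#
    zero-entry s y x≈0 = trans (*-congʳ (trans (*-congˡ x≈0) (zeroʳ s))) (zeroˡ y)

    first-term : ∀ s x d → s ≈ 0# → 1# * x * d + s ≈ x * d
    first-term s x d s≈0 = trans (+-cong (*-congʳ (*-identityˡ x)) s≈0) (+-identityʳ _)

  det-lower : ∀ {n} (A : Fin n → Fin n → Carrier) (d : ℕ → Carrier) →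
              (∀ i j → i Fin.< j → A i j ≈ 0#) → (∀ i → A i i ≈ d (toℕ i)) →
              det A ≈ prod d n
  det-lower {zero}  A d A≈0 A≈d = refl
  det-lower {suc n} A d A≈0 A≈d = trans (det-laplace A) (trans (∑-suc _) (trans
    (first-term _ (A zero zero) (det (minor A zero))
      (∑-zero λ j → zero-entry (sgn (suc (toℕ j))) (det (minor A (suc j))) (A≈0 zero (suc j) (s≤s z≤n))))
    (*-cong (A≈d zero) (det-lower (minor A zero) (d ∘ suc) (λ i j i<j → A≈0 (suc i) (suc j) (s≤s i<j))
      (λ i → A≈d (suc i))))))

  -- In the expansion along the first row, the first term has a zero entry and every other minor
  -- inherits the zero column.
  det-zeroColumn : ∀ {n} (A : Fin (suc n) → Fin (suc n) → Carrier) →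
                   (∀ i → A i zero ≈ 0#) → det A ≈ 0#
  det-zeroColumn {n} A A≈0 = trans (det-laplace A) (∑-zero (term n A A≈0))
    where
    term : ∀ n (A : Fin (suc n) → Fin (suc n) → Carrier) → (∀ i → A i zero ≈ 0#) →
           ∀ j → sgn (toℕ j) * A zero j * det (minor A j) ≈ 0#
    term n       A A≈0 zero    = zero-entry 1# (det (minor A zero)) (A≈0 zero)
    term (suc n) A A≈0 (suc j) =
      trans (*-congˡ (det-zeroColumn (minor A (suc j)) (λ i → A≈0 (suc i)))) (zeroʳ _)

  -- For j > 0 the minor retains the first column, which vanishes below the diagonal, so only the
  -- first term of the expansion survives.
  det-upper : ∀ {n} (A : Fin n → Fin n → Carrier) (d : ℕ → Carrier) →
              (∀ i j → j Fin.< i → A i j ≈ 0#) → (∀ i → A i i ≈ d (toℕ i)) →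
              det A ≈ prod d n
  det-upper {zero}  A d A≈0 A≈d = refl
  det-upper {suc n} A d A≈0 A≈d = trans (det-laplace A) (trans (∑-suc _) (trans
    (first-term _ (A zero zero) (det (minor A zero)) (∑-zero (term n A A≈0)))
    (*-cong (A≈d zero) (det-upper (minor A zero) (d ∘ suc) (λ i j i<j → A≈0 (suc i) (suc j) (s≤s i<j))
      (λ i → A≈d (suc i))))))
    where
    term : ∀ n (A : Fin (suc n) → Fin (suc n) → Carrier) → (∀ i j → j Fin.< i → A i j ≈ 0#) →
           ∀ (j : Fin n) → sgn (suc (toℕ j)) * A zero (suc j) * det (minor A (suc j)) ≈ 0#
    term (suc n) A A≈0 j = trans
      (*-congˡ (det-zeroColumn (minor A (suc j)) (λ i → A≈0 (suc i) zero (s≤s z≤n)))) (zeroʳ _)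

  module _ {m : ℕ} where
    private
      V : Set c
      V = Fin m → Carrier

      infixl 6 _⊕_
      infixl 7 _⊙_

      _⊕_ : V → V → V
      (x ⊕ y) k = x k + y k

      _⊙_ : Carrier → V → V
      (a ⊙ x) k = a * x k

      infix 4 _≋_
      _≋_ : V → V → Set ℓ
      x ≋ y = ∀ k → x k ≈ y k

    Extensional : ∀ {n} → (Vector V n → Carrier) → Set (c ⊔ ℓ)
    Extensional F = ∀ {v w} → (∀ i → v i ≋ w i) → F v ≈ F w

    Linear₀ : ∀ {n} → (Vector V (suc n) → Carrier) → Set (c ⊔ ℓ)
    Linear₀ F = ∀ a x y v → F ((x ⊕ a ⊙ y) ∷ v) ≈ F (x ∷ v) + a * F (y ∷ v)

    Alternating₀ : ∀ {n} → (Vector V (suc n) → Carrier) → Set (c ⊔ ℓ)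
    Alternating₀ {zero}  F = ⊤
    Alternating₀ {suc n} F = ∀ x v → F (x ∷ x ∷ v) ≈ 0#

    -- Recursion on the number of arguments, with only adjacent arguments
    -- compared, avoids updates at arbitrary positions.
    IsAlternating : ∀ n → (Vector V n → Carrier) → Set (c ⊔ ℓ)
    IsAlternating zero    F = Extensional F
    IsAlternating (suc n) F = Extensional F × Linear₀ F × Alternating₀ F ×
      (∀ x → IsAlternating n (λ v → F (x ∷ v)))

    ∷-≋ : ∀ {n} {x y : V} {v w : Vector V n} → x ≋ y → (∀ i → v i ≋ w i) →
          ∀ i → (x ∷ v) i ≋ (y ∷ w) i
    ∷-≋ x≋y v≋w zero    = x≋y
    ∷-≋ x≋y v≋w (suc i) = v≋w i

    -- Expand `F` with x + y in both of the first two arguments: the left side and the two terms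
    -- with a repeated argument vanish, so the two mixed terms add up to zero.
    swap : ∀ {n F} → IsAlternating (suc (suc n)) F →
           ∀ x y v → F (x ∷ y ∷ v) ≈ - F (y ∷ x ∷ v)
    swap {n} {F} (ext , lin , alt , rest) x y v = begin
      F (x ∷ y ∷ v)
        ≈⟨ solve 2 (λ a b → a := (con ℤ.0ℤ :+ a :+ con ℤ.1ℤ :* (b :+ con ℤ.1ℤ :* con ℤ.0ℤ)) :- b)
             refl _ _ ⟩
      (0# + Fxy + 1# * (Fyx + 1# * 0#)) - Fyx
        ≈⟨ +-congʳ (+-cong (+-congʳ (sym (alt x v)))
            (*-congˡ (+-congˡ (*-congˡ (sym (alt y v)))))) ⟩
      (F (x ∷ x ∷ v) + Fxy + 1# * (Fyx + 1# * F (y ∷ y ∷ v))) - Fyx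
        ≈⟨ +-congʳ (+-cong (+-congˡ (solve 1 (λ a → a := con ℤ.1ℤ :* a) refl _)) refl) ⟩
      (F (x ∷ x ∷ v) + 1# * Fxy + 1# * (Fyx + 1# * F (y ∷ y ∷ v))) - Fyx
        ≈⟨ +-congʳ (+-cong (sym (lin₁ x)) (*-congˡ (sym (lin₁ y)))) ⟩
      (F (x ∷ z ∷ v) + 1# * F (y ∷ z ∷ v)) - Fyx
        ≈⟨ +-congʳ (sym (lin 1# x y (z ∷ v))) ⟩
      F (z ∷ z ∷ v) - Fyx
        ≈⟨ trans (+-congʳ (alt z v)) (+-identityˡ _) ⟩
      - Fyx ∎
      where
      open Solver
      z = x ⊕ 1# ⊙ y
      Fxy = F (x ∷ y ∷ v)
      Fyx = F (y ∷ x ∷ v)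
      lin₁ : ∀ u → F (u ∷ z ∷ v) ≈ F (u ∷ x ∷ v) + 1# * F (u ∷ y ∷ v)
      lin₁ u = proj₁ (proj₂ (rest u)) 1# x y v

    -- In the second argument the multiple of x dies by alternation. Swapping x past that argument
    -- lets the induction treat the remaining ones, and a second swap restores order and sign.
    absorb : ∀ {n F} → IsAlternating (suc n) F → ∀ x (a : Vector Carrier n) {v w : Vector V n} →
             (∀ i → v i ≋ w i ⊕ a i ⊙ x) → F (x ∷ v) ≈ F (x ∷ w)
    absorb {zero}  alt x a v≋w = proj₁ alt (∷-≋ (λ _ → refl) (λ ()))
    absorb {suc n} {F} alt@(ext , lin , alt₀ , rest) x a {v} {w} v≋w = begin
      F (x ∷ v)
        ≈⟨ ext (∷-≋ (λ _ → refl) λ { zero → v≋w zero ; (suc i) k → refl }) ⟩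
      F (x ∷ (w zero ⊕ a zero ⊙ x) ∷ tail v)
        ≈⟨ proj₁ (proj₂ (rest x)) (a zero) (w zero) x (tail v) ⟩
      F (x ∷ w zero ∷ tail v) + a zero * F (x ∷ x ∷ tail v)
        ≈⟨ +-congˡ (trans (*-congˡ (alt₀ x (tail v))) (zeroʳ _)) ⟩
      F (x ∷ w zero ∷ tail v) + 0#
        ≈⟨ trans (+-identityʳ _) (swap alt x (w zero) (tail v)) ⟩
      - F (w zero ∷ x ∷ tail v)
        ≈⟨ -‿cong (absorb (rest (w zero)) x (tail a) (λ i → v≋w (suc i))) ⟩
      - F (w zero ∷ x ∷ tail w)
        ≈⟨ swap alt x (w zero) (tail w) ⟨
      F (x ∷ w zero ∷ tail w)
        ≈⟨ ext (∷-≋ (λ _ → refl) λ { zero k → refl ; (suc i) k → refl }) ⟩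
      F (x ∷ w) ∎

    combination : ∀ {r} → Vector Carrier r → Vector V r → V
    combination a w k = ∑ λ j → a j * w j k

    linear : ∀ {n r F} → IsAlternating (suc n) F → ∀ (a : Vector Carrier r) w v →
             F (combination a w ∷ v) ≈ ∑ λ j → a j * F (w j ∷ v)
    linear {r = zero} {F} (ext , lin , _) a w v = begin
      -- The empty combination z is the zero vector, so z = z + (-1) z, and linearity turns the
      -- value into a difference of equal terms.
      F (z ∷ v)                         ≈⟨ ext (∷-≋ (λ k → minus (z k) (∑-empty _)) λ _ _ → refl) ⟩
      F ((z ⊕ (- 1#) ⊙ z) ∷ v)          ≈⟨ lin (- 1#) z z v ⟩
      F (z ∷ v) + (- 1#) * F (z ∷ v)    ≈⟨ solve 1 (λ a → a :+ con ℤ.-1ℤ :* a := con ℤ.0ℤ) refl _ ⟩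
      0#                                ≈⟨ ∑-empty _ ⟨
      ∑ (λ j → a j * F (w j ∷ v))       ∎
      where
      open Solver
      z = combination a w
      minus : ∀ x → x ≈ 0# → x ≈ x + - 1# * x
      minus x x≈0 = trans x≈0 (solve 1 (λ x → con ℤ.0ℤ := x :+ con ℤ.-1ℤ :* x) refl x)
    linear {r = suc r} {F} alt@(ext , lin , _) a w v = begin
      F (combination a w ∷ v)
        ≈⟨ ext (∷-≋ (λ k → trans (∑-suc _) (+-comm _ _)) λ _ _ → refl) ⟩
      F ((combination (tail a) (tail w) ⊕ a zero ⊙ w zero) ∷ v)
        ≈⟨ lin (a zero) _ (w zero) v ⟩
      F (combination (tail a) (tail w) ∷ v) + a zero * F (w zero ∷ v)
        ≈⟨ trans (+-congʳ (linear alt (tail a) (tail w) v)) (+-comm _ _) ⟩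
      a zero * F (w zero ∷ v) + ∑ (λ j → a (suc j) * F (w (suc j) ∷ v))
        ≈⟨ ∑-suc _ ⟨
      ∑ (λ j → a j * F (w j ∷ v)) ∎

    -- Argument j travels to the front by j adjacent swaps, each contributing one sign.
    moveToFront : ∀ {n F} → IsAlternating (suc n) F → ∀ w (j : Fin (suc n)) →
                  F (w j ∷ w ∘ punchIn j) ≈ sgn (toℕ j) * F w
    moveToFront {n} {F} (ext , _) w zero =
      trans (ext λ { zero k → refl ; (suc i) k → refl }) (sym (*-identityˡ _))
    moveToFront {suc n} {F} alt@(ext , lin , alt₀ , rest) w (suc j) = begin
      F (w (suc j) ∷ w ∘ punchIn (suc j))
        ≈⟨ ext (∷-≋ (λ _ → refl) λ { zero k → refl ; (suc i) k → refl }) ⟩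
      F (w (suc j) ∷ w zero ∷ tail w ∘ punchIn j)
        ≈⟨ swap alt _ _ _ ⟩
      - F (w zero ∷ tail w j ∷ tail w ∘ punchIn j)
        ≈⟨ -‿cong (moveToFront (rest (w zero)) (tail w) j) ⟩
      - (sgn (toℕ j) * F (w zero ∷ tail w))
        ≈⟨ trans (-‿distribˡ-* _ _) (*-congˡ (ext λ { zero k → refl ; (suc i) k → refl })) ⟩
      sgn (suc (toℕ j)) * F w ∎

    -- Expanding the first argument puts some `w j` in front. Its multiples in the later arguments
    -- are absorbed, so these become combinations of the other `w` with a minor of A as coefficient
    -- matrix; the recursion on minors is the Laplace expansion.
    alternating-det : ∀ {n F} → IsAlternating n F → ∀ (A : Fin n → Fin n → Carrier) w {v} →
                      (∀ i → v i ≋ combination (A i) w) → F v ≈ det A * F w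
    alternating-det {zero}  alt A w v≋ = trans (alt λ ()) (sym (*-identityˡ _))
    alternating-det {suc n} {F} alt@(ext , lin , alt₀ , rest) A w {v} v≋ = begin
      F v
        ≈⟨ ext (λ { zero → v≋ zero ; (suc i) k → refl }) ⟩
      F (combination (A zero) w ∷ tail v)
        ≈⟨ linear alt (A zero) w (tail v) ⟩
      ∑ (λ j → A zero j * F (w j ∷ tail v))
        ≈⟨ ∑-cong step ⟩
      ∑ (λ j → sgn (toℕ j) * A zero j * det (minor A j) * F w)
        ≈⟨ ∑-*ʳ _ (F w) ⟩
      ∑ (λ j → sgn (toℕ j) * A zero j * det (minor A j)) * F w
        ≈⟨ *-congʳ (det-laplace A) ⟨
      det A * F w ∎
      where
      step : ∀ j → A zero j * F (w j ∷ tail v) ≈ sgn (toℕ j) * A zero j * det (minor A j) * F w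
      step j = begin
        A zero j * F (w j ∷ tail v)
          ≈⟨ *-congˡ (absorb alt (w j) (λ i → A (suc i) j) λ i k →
               trans (v≋ (suc i) k) (trans (∑-remove j _) (+-comm _ _))) ⟩
        A zero j * F (w j ∷ λ i → combination (minor A j i) (w ∘ punchIn j))
          ≈⟨ *-congˡ (alternating-det (rest (w j)) (minor A j) (w ∘ punchIn j) λ _ _ → refl) ⟩
        A zero j * (det (minor A j) * F (w j ∷ w ∘ punchIn j))
          ≈⟨ *-congˡ (*-congˡ (moveToFront alt w j)) ⟩
        A zero j * (det (minor A j) * (sgn (toℕ j) * F w))
          ≈⟨ solve 4 (λ a d s f → a :* (d :* (s :* f)) := s :* a :* d :* f) refl _ _ _ _ ⟩
        sgn (toℕ j) * A zero j * det (minor A j) * F w ∎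
        where open Solver

    alternating-resp : ∀ {n} {F G : Vector V n → Carrier} → (∀ v → F v ≈ G v) →
                       IsAlternating n F → IsAlternating n G
    alternating-resp {zero} F≈G ext = λ v≋w → trans (sym (F≈G _)) (trans (ext v≋w) (F≈G _))
    alternating-resp {suc n} F≈G (ext , lin , alt , rest) =
      (λ v≋w → trans (sym (F≈G _)) (trans (ext v≋w) (F≈G _))) ,
      (λ a x y v → trans (sym (F≈G _)) (trans (lin a x y v) (+-cong (F≈G _) (*-congˡ (F≈G _))))) ,
      alt′ n F≈G alt ,
      λ x → alternating-resp (λ v → F≈G (x ∷ v)) (rest x)
      where
      alt′ : ∀ n {F G : Vector V (suc n) → Carrier} → (∀ v → F v ≈ G v) →
             Alternating₀ F → Alternating₀ G
      alt′ zero    F≈G _   = tt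
      alt′ (suc n) F≈G alt = λ x v → trans (sym (F≈G _)) (alt x v)

    private
      linear-rearrange : ∀ {r} (b : Vector Carrier r) a (f g : Vector Carrier r) →
        ∑ (λ j → b j * (f j + a * g j)) ≈ ∑ (λ j → b j * f j) + a * ∑ (λ j → b j * g j)
      linear-rearrange b a f g = begin
        ∑ (λ j → b j * (f j + a * g j))
          ≈⟨ ∑-cong (λ j → distribute (b j) (f j) a (g j)) ⟩
        ∑ (λ j → b j * f j + a * (b j * g j))
          ≈⟨ ∑-+ _ _ ⟩
        ∑ (λ j → b j * f j) + ∑ (λ j → a * (b j * g j))
          ≈⟨ +-congˡ (∑-*ˡ a _) ⟩
        ∑ (λ j → b j * f j) + a * ∑ (λ j → b j * g j) ∎
        where
        open Solver
        distribute : ∀ b f a g → b * (f + a * g) ≈ b * f + a * (b * g)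
        distribute = solve 4 (λ b f a g → b :* (f :+ a :* g) := b :* f :+ a :* (b :* g)) refl

    alternating-combination : ∀ {n r} (b : Vector Carrier r) {G : Fin r → Vector V n → Carrier} →
      (∀ j → IsAlternating n (G j)) → IsAlternating n (λ v → ∑ λ j → b j * G j v)
    alternating-combination {zero} b alt = λ v≋w → ∑-cong λ j → *-congˡ (alt j v≋w)
    alternating-combination {suc n} b {G} alt =
      (λ v≋w → ∑-cong λ j → *-congˡ (proj₁ (alt j) v≋w)) ,
      (λ a x y v → trans (∑-cong λ j → *-congˡ (proj₁ (proj₂ (alt j)) a x y v))
                         (linear-rearrange b a (λ j → G j (x ∷ v)) (λ j → G j (y ∷ v)))) ,
      alt′ n (λ j → proj₁ (proj₂ (proj₂ (alt j)))) ,
      λ x → alternating-combination b (λ j → proj₂ (proj₂ (proj₂ (alt j))) x)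
      where
      alt′ : ∀ n {G : Fin _ → Vector V (suc n) → Carrier} → (∀ j → Alternating₀ (G j)) →
             Alternating₀ (λ v → ∑ λ j → b j * G j v)
      alt′ zero    _   = tt
      alt′ (suc n) alt = λ x v → ∑-zero λ j → trans (*-congˡ (alt j x v)) (zeroʳ _)

  -- The terms (0, k) and (suc k, 0) cancel; the remaining ones form a sum
  -- of the same shape with one column fewer.
  antisymmetric-sum : ∀ n (y : Fin (suc (suc n)) → Carrier)
    (M : (Fin n → Fin (suc (suc n))) → Carrier) → (∀ {f g} → (∀ i → f i ≡ g i) → M f ≈ M g) →
    ∑ (λ j → ∑ λ k → sgn (toℕ j) * sgn (toℕ k) * (y j * y (punchIn j k)) *
      M (λ l → punchIn j (punchIn k l))) ≈ 0#
  antisymmetric-sum n y M M-cong = begin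
    ∑ (λ j → ∑ (T j))
      ≈⟨ ∑-suc _ ⟩
    ∑ (T zero) + ∑ (λ j → ∑ (T (suc j)))
      ≈⟨ +-congˡ (∑-cong λ j → ∑-suc _) ⟩
    ∑ (T zero) + ∑ (λ j → T (suc j) zero + ∑ (λ k → T (suc j) (suc k)))
      ≈⟨ +-congˡ (∑-+ (λ j → T (suc j) zero) _) ⟩
    ∑ (T zero) + (∑ (λ j → T (suc j) zero) + rest)
      ≈⟨ +-assoc _ _ _ ⟨
    (∑ (T zero) + ∑ (λ j → T (suc j) zero)) + rest
      ≈⟨ +-congʳ (∑-+ (T zero) _) ⟨
    ∑ (λ k → T zero k + T (suc k) zero) + rest
      ≈⟨ +-cong (∑-zero cancel) (rest≈0 n y M M-cong) ⟩
    0# + 0#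
      ≈⟨ +-identityˡ 0# ⟩
    0# ∎
    where
    open Solver
    T : Fin (suc (suc n)) → Fin (suc n) → Carrier
    T j k = sgn (toℕ j) * sgn (toℕ k) * (y j * y (punchIn j k)) *
      M (λ l → punchIn j (punchIn k l))

    rest = ∑ (λ j → ∑ λ k → T (suc j) (suc k))

    cancel : ∀ k → T zero k + T (suc k) zero ≈ 0#
    cancel k = solve 4 (λ s a b m → con ℤ.1ℤ :* s :* (a :* b) :* m :+
        :- s :* con ℤ.1ℤ :* (b :* a) :* m := con ℤ.0ℤ) refl (sgn (toℕ k)) (y zero) (y (suc k)) (M _)

    rest≈0 : ∀ n (y : Fin (suc (suc n)) → Carrier)
      (M : (Fin n → Fin (suc (suc n))) → Carrier) → (∀ {f g} → (∀ i → f i ≡ g i) → M f ≈ M g) →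
      ∑ (λ j → ∑ λ k → - sgn (toℕ j) * - sgn (toℕ k) * (y (suc j) * y (suc (punchIn j k))) *
        M (λ l → punchIn (suc j) (punchIn (suc k) l))) ≈ 0#
    rest≈0 zero    y M M-cong = ∑-zero λ j → ∑-empty _
    rest≈0 (suc n) y M M-cong = trans
      (∑-cong λ j → ∑-cong λ k → *-cong
        (*-congʳ (solve 2 (λ a b → :- a :* :- b := a :* b) refl (sgn (toℕ j)) (sgn (toℕ k))))
        (M-cong λ { zero → ≡.refl ; (suc l) → ≡.refl }))
      (antisymmetric-sum n (y ∘ suc) (λ f → M (zero ∷ suc ∘ f))
        (λ f≗g → M-cong λ { zero → ≡.refl ; (suc l) → ≡.cong suc (f≗g l) }))

  -- The column selection `e` makes the induction close: the minors of the matrix selected by `e`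
  -- are selected by `e ∘ punchIn j`.
  det-alternating : ∀ {m} n (e : Fin n → Fin m) →
                    IsAlternating n (λ (v : Vector (Fin m → Carrier) n) → det (λ i k → v i (e k)))
  det-alternating zero    e = λ _ → refl
  det-alternating {m} (suc n) e =
    (λ {v} {w} v≋w → det-cong (λ i k → v i (e k)) (λ i k → w i (e k)) λ i k → v≋w i (e k)) ,
    linear₀ , alternating₀ n e ,
    λ x → alternating-resp
      (λ v → sym (det-laplace (λ i k → (x ∷ v) i (e k))))
      (alternating-combination (λ j → sgn (toℕ j) * x (e j)) λ j → det-alternating n (e ∘ punchIn j))
    where
    open Solver
    linear₀ : Linear₀ {m} (λ v → det (λ i k → v i (e k)))
    linear₀ a x y v = begin
      det (λ i k → ((λ k → x k + a * y k) ∷ v) i (e k))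
        ≈⟨ det-laplace (λ i k → ((λ k → x k + a * y k) ∷ v) i (e k)) ⟩
      ∑ (λ j → sgn (toℕ j) * (x (e j) + a * y (e j)) * d j)
        ≈⟨ ∑-cong (λ j → distribute (sgn (toℕ j)) (x (e j)) a (y (e j)) (d j)) ⟩
      ∑ (λ j → sgn (toℕ j) * x (e j) * d j + a * (sgn (toℕ j) * y (e j) * d j))
        ≈⟨ trans (∑-+ _ _) (+-congˡ (∑-*ˡ a _)) ⟩
      ∑ (λ j → sgn (toℕ j) * x (e j) * d j) + a * ∑ (λ j → sgn (toℕ j) * y (e j) * d j)
        ≈⟨ +-cong (det-laplace (λ i k → (x ∷ v) i (e k))) (*-congˡ (det-laplace (λ i k → (y ∷ v) i (e k)))) ⟨
      det (λ i k → (x ∷ v) i (e k)) + a * det (λ i k → (y ∷ v) i (e k)) ∎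
      where
      d : Fin (suc n) → Carrier
      d j = det (λ i k → v i (e (punchIn j k)))
      distribute : ∀ s x a y d → s * (x + a * y) * d ≈ s * x * d + a * (s * y * d)
      distribute = solve 5 (λ s x a y d → s :* (x :+ a :* y) :* d := s :* x :* d :+ a :* (s :* y :* d)) refl

    alternating₀ : ∀ n (e : Fin (suc n) → Fin m) →
      Alternating₀ (λ (v : Vector (Fin m → Carrier) (suc n)) → det (λ i k → v i (e k)))
    alternating₀ zero    e = tt
    alternating₀ (suc n) e x v = begin
      -- Expanding along both copies of x gives a sum over ordered pairs of distinct columns,
      -- antisymmetric in the pair.
      det (λ i k → (x ∷ x ∷ v) i (e k))
        ≈⟨ det-laplace (λ i k → (x ∷ x ∷ v) i (e k)) ⟩
      ∑ (λ j → sgn (toℕ j) * x (e j) * det (λ i k → (x ∷ v) i (e (punchIn j k))))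
        ≈⟨ ∑-cong (λ j → trans (*-congˡ (det-laplace (λ i k → (x ∷ v) i (e (punchIn j k))))) (sym (∑-*ˡ _ _))) ⟩
      ∑ (λ j → ∑ λ k → sgn (toℕ j) * x (e j) * (sgn (toℕ k) * x (e (punchIn j k)) * d j k))
        ≈⟨ ∑-cong (λ j → ∑-cong λ k → rearrange (sgn (toℕ j)) (x (e j)) (sgn (toℕ k)) _ (d j k)) ⟩
      ∑ (λ j → ∑ λ k → sgn (toℕ j) * sgn (toℕ k) * (x (e j) * x (e (punchIn j k))) * d j k)
        ≈⟨ antisymmetric-sum n (x ∘ e) (λ f → det (λ i l → v i (e (f l))))
             (λ {f} {g} f≗g → det-cong (λ i l → v i (e (f l))) (λ i l → v i (e (g l))) λ i l → reflexive (≡.cong (v i ∘ e) (f≗g l))) ⟩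
      0# ∎
      where
      d : Fin (suc (suc n)) → Fin (suc n) → Carrier
      d j k = det (λ i l → v i (e (punchIn j (punchIn k l))))
      rearrange : ∀ s a t b d → s * a * (t * b * d) ≈ s * t * (a * b) * d
      rearrange = solve 5 (λ s a t b d → s :* a :* (t :* b :* d) := s :* t :* (a :* b) :* d) refl

  -- The rows of the product are combinations of the rows of B with coefficient matrix A, so
  -- `alternating-det` applies to the determinant itself.
  det-* : ∀ {n} (A B : Fin n → Fin n → Carrier) →
          det (λ i k → ∑ λ j → A i j * B j k) ≈ det A * det B
  det-* {n} A B = alternating-det (det-alternating n (λ k → k)) A B λ _ _ → refl

module DeterminantHomomorphism {c ℓ} (R : CommutativeRing c ℓ) where
  open RingTools R
  open Determinant R
  private
    module ℤᴿ = RingTools ℤ.+-*-commutativeRing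
    module ℤᴰ = Determinant ℤ.+-*-commutativeRing

  ∑-homo : ∀ {n} (f : Fin n → ℤ) → ⟦ ℤᴿ.∑ f ⟧ ≈ ∑ (λ i → ⟦ f i ⟧)
  ∑-homo {zero}  f = trans (⟦⟧-cong (ℤᴿ.∑-empty f)) (sym (∑-empty _))
  ∑-homo {suc n} f = trans (⟦⟧-cong (ℤᴿ.∑-suc f)) (trans (⟦⟧-homo-+ (f zero) _)
    (trans (+-congˡ (∑-homo (f ∘ suc))) (sym (∑-suc _))))

  sgn-homo : ∀ n → ⟦ ℤᴰ.sgn n ⟧ ≈ sgn n
  sgn-homo zero    = ⟦⟧-homo-1
  sgn-homo (suc n) = trans (⟦⟧-homo-- (ℤᴰ.sgn n)) (-‿cong (sgn-homo n))

  det-homo : ∀ {n} (A : Fin n → Fin n → ℤ) → ⟦ ℤᴿ.det A ⟧ ≈ det (λ i j → ⟦ A i j ⟧)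
  det-homo {zero}  A = ⟦⟧-homo-1
  det-homo {suc n} A = trans (⟦⟧-cong (ℤᴰ.det-laplace A)) (trans (∑-homo _) (trans
    (∑-cong λ j → trans (⟦⟧-homo-* (ℤᴰ.sgn (toℕ j) ℤ.* A zero j) _)
      (*-cong (trans (⟦⟧-homo-* (ℤᴰ.sgn (toℕ j)) (A zero j)) (*-congʳ (sgn-homo (toℕ j))))
        (det-homo (ℤᴰ.minor A j))))
    (sym (det-laplace (λ i j → ⟦ A i j ⟧)))))

-- If j were missed, punching it out of the codomain would inject `Fin (suc n)` into `Fin n`.
injective⇒surjective : ∀ {n} (f : Fin n → Fin n) → Injective _≡_ _≡_ f → ∀ j → ∃[ i ] f i ≡ j
injective⇒surjective {suc n} f inj j with Fin.any? (λ i → f i Fin.≟ j)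
... | yes found = found
... | no  none  = contradiction
  (λ {x} {y} eq → inj (Fin.punchOut-injective (j≢f x) (j≢f y) eq))
  (Fin.<⇒notInjective (ℕ.n<1+n n))
  where
  j≢f : ∀ i → j ≢ f i
  j≢f i j≡fi = none (i , ≡.sym j≡fi)

injective⇒permutation : ∀ {n} (f : Fin n → Fin n) → Injective _≡_ _≡_ f →
                        ∃[ π ] ∀ i → π ⟨$⟩ʳ i ≡ f i
injective⇒permutation {n} f inj = permutation f f⁻¹
  (λ j → proj₂ (injective⇒surjective f inj j))
  (λ i → inj (proj₂ (injective⇒surjective f inj (f i)))) , λ _ → ≡.refl
  where
  f⁻¹ : Fin n → Fin n
  f⁻¹ j = proj₁ (injective⇒surjective f inj j)

extend : ∀ {a} {A : Set a} {n} → A → (Fin n → A) → ℕ → A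
extend {n = n} z f k with k ℕ.<? n
... | yes k<n = f (fromℕ< k<n)
... | no  _   = z

extend-toℕ : ∀ {a} {A : Set a} {n} (z : A) (f : Fin n → A) i → extend z f (toℕ i) ≡ f i
extend-toℕ {n = n} z f i with toℕ i ℕ.<? n
... | yes i<n = ≡.cong f (Fin.fromℕ<-toℕ i i<n)
... | no  i≮n = contradiction (Fin.toℕ<n i) i≮n

-- Sums over initial segments of ℕ; polynomials with given roots

module RangeSums {c ℓ} (R : CommutativeRing c ℓ) where
  open RingTools R
  open ≈-Reasoning

  opaque
    unfolding ∑

    Σ< : ℕ → (ℕ → Carrier) → Carrier
    Σ< n f = ∑ {n} (f ∘ toℕ)

    Σ<≈∑ : ∀ n f → Σ< n f ≈ ∑ {n} (f ∘ toℕ)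
    Σ<≈∑ n f = refl

    Σ<-0 : ∀ f → Σ< 0 f ≈ 0#
    Σ<-0 f = refl

    Σ<-suc : ∀ n f → Σ< (suc n) f ≈ f 0 + Σ< n (f ∘ suc)
    Σ<-suc n f = refl

  Σ<-cong : ∀ n {f g} → (∀ i → i ℕ.< n → f i ≈ g i) → Σ< n f ≈ Σ< n g
  Σ<-cong n f≈g = trans (Σ<≈∑ n _) (trans (∑-cong λ i → f≈g (toℕ i) (Fin.toℕ<n i)) (sym (Σ<≈∑ n _)))

  Σ<-zero : ∀ n {f} → (∀ i → i ℕ.< n → f i ≈ 0#) → Σ< n f ≈ 0#
  Σ<-zero n f≈0 = trans (Σ<≈∑ n _) (∑-zero λ i → f≈0 (toℕ i) (Fin.toℕ<n i))

  Σ<-+ : ∀ n f g → Σ< n (λ i → f i + g i) ≈ Σ< n f + Σ< n g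
  Σ<-+ n f g = trans (Σ<≈∑ n _) (trans (∑-+ _ _) (sym (+-cong (Σ<≈∑ n f) (Σ<≈∑ n g))))

  Σ<-*ˡ : ∀ n a f → Σ< n (λ i → a * f i) ≈ a * Σ< n f
  Σ<-*ˡ n a f = trans (Σ<≈∑ n _) (trans (∑-*ˡ a _) (*-congˡ (sym (Σ<≈∑ n f))))

  Σ<-*ʳ : ∀ n f a → Σ< n (λ i → f i * a) ≈ Σ< n f * a
  Σ<-*ʳ n f a = trans (Σ<≈∑ n _) (trans (∑-*ʳ _ a) (*-congʳ (sym (Σ<≈∑ n f))))

  Σ<-swap : ∀ m n (f : ℕ → ℕ → Carrier) →
            Σ< m (λ i → Σ< n (f i)) ≈ Σ< n (λ j → Σ< m λ i → f i j)
  Σ<-swap m n f = begin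
    Σ< m (λ i → Σ< n (f i))                             ≈⟨ Σ<≈∑ m _ ⟩
    ∑ {m} (λ i → Σ< n (f (toℕ i)))                      ≈⟨ ∑-cong (λ i → Σ<≈∑ n _) ⟩
    ∑ {m} (λ i → ∑ {n} λ j → f (toℕ i) (toℕ j))         ≈⟨ ∑-swap _ ⟩
    ∑ {n} (λ j → ∑ {m} λ i → f (toℕ i) (toℕ j))         ≈⟨ ∑-cong (λ j → Σ<≈∑ m _) ⟨
    ∑ {n} (λ j → Σ< m λ i → f i (toℕ j))                ≈⟨ Σ<≈∑ n _ ⟨
    Σ< n (λ j → Σ< m λ i → f i j)                       ∎

  Σ<-const : ∀ n x → Σ< n (λ _ → x) ≈ n ·ℕ 1# * x
  Σ<-const n x = trans (Σ<≈∑ n _) (∑-const n x)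

  Σ<-split : ∀ m n f → Σ< (m ℕ.+ n) f ≈ Σ< m f + Σ< n (λ i → f (m ℕ.+ i))
  Σ<-split zero    n f = sym (trans (+-congʳ (Σ<-0 f)) (+-identityˡ _))
  Σ<-split (suc m) n f = begin
    Σ< (suc (m ℕ.+ n)) f                          ≈⟨ Σ<-suc (m ℕ.+ n) f ⟩
    f 0 + Σ< (m ℕ.+ n) (f ∘ suc)                  ≈⟨ +-congˡ (Σ<-split m n (f ∘ suc)) ⟩
    f 0 + (Σ< m (f ∘ suc) + Σ< n (λ i → f (suc m ℕ.+ i))) ≈⟨ +-assoc _ _ _ ⟨
    f 0 + Σ< m (f ∘ suc) + Σ< n (λ i → f (suc m ℕ.+ i))   ≈⟨ +-congʳ (Σ<-suc m f) ⟨
    Σ< (suc m) f + Σ< n (λ i → f (suc m ℕ.+ i))   ∎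

  Σ<-1 : ∀ f → Σ< 1 f ≈ f 0
  Σ<-1 f = trans (Σ<-suc 0 f) (trans (+-congˡ (Σ<-0 _)) (+-identityʳ _))

  Σ<-last : ∀ n f → Σ< (suc n) f ≈ Σ< n f + f n
  Σ<-last n f = begin
    Σ< (suc n) f                      ≡⟨ ≡.cong (λ k → Σ< k f) (ℕ.+-comm 1 n) ⟩
    Σ< (n ℕ.+ 1) f                    ≈⟨ Σ<-split n 1 f ⟩
    Σ< n f + Σ< 1 (λ i → f (n ℕ.+ i)) ≈⟨ +-congˡ (Σ<-1 _) ⟩
    Σ< n f + f (n ℕ.+ 0)              ≡⟨ ≡.cong (λ k → Σ< n f + f k) (ℕ.+-identityʳ n) ⟩
    Σ< n f + f n                      ∎

  Σ<-blocks : ∀ m s f → Σ< (m ℕ.* s) f ≈ Σ< s λ i → Σ< m λ j → f (i ℕ.+ j ℕ.* s)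
  Σ<-blocks zero    s f = trans (Σ<-0 f) (sym (Σ<-zero s λ i _ → Σ<-0 _))
  Σ<-blocks (suc m) s f = begin
    Σ< (s ℕ.+ m ℕ.* s) f
      ≈⟨ Σ<-split s (m ℕ.* s) f ⟩
    Σ< s f + Σ< (m ℕ.* s) (λ i → f (s ℕ.+ i))
      ≈⟨ +-congˡ (Σ<-blocks m s (λ i → f (s ℕ.+ i))) ⟩
    Σ< s f + Σ< s (λ i → Σ< m λ j → f (s ℕ.+ (i ℕ.+ j ℕ.* s)))
      ≈⟨ Σ<-+ s f _ ⟨
    Σ< s (λ i → f i + Σ< m λ j → f (s ℕ.+ (i ℕ.+ j ℕ.* s)))
      ≈⟨ Σ<-cong s (λ i _ → trans (+-cong (f-cong (≡.sym (ℕ.+-identityʳ i)))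
           (Σ<-cong m λ j _ → f-cong (shift i (j ℕ.* s)))) (sym (Σ<-suc m _))) ⟩
    Σ< s (λ i → Σ< (suc m) λ j → f (i ℕ.+ j ℕ.* s)) ∎
    where
    f-cong : ∀ {i j} → i ≡ j → f i ≈ f j
    f-cong i≡j = reflexive (≡.cong f i≡j)
    shift : ∀ i k → s ℕ.+ (i ℕ.+ k) ≡ i ℕ.+ (s ℕ.+ k)
    shift i k = ≡.trans (≡.sym (ℕ.+-assoc s i k)) (≡.trans (≡.cong (ℕ._+ k) (ℕ.+-comm s i)) (ℕ.+-assoc i s k))

  Σ<-single : ∀ n f k → k ℕ.< n → (∀ i → i ℕ.< n → i ≢ k → f i ≈ 0#) → Σ< n f ≈ f k
  Σ<-single (suc n) f zero k<n f≈0 = trans (Σ<-suc n f)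
    (trans (+-congˡ (Σ<-zero n λ i i<n → f≈0 (suc i) (s≤s i<n) λ ())) (+-identityʳ _))
  Σ<-single (suc n) f (suc k) (s≤s k<n) f≈0 = trans (Σ<-suc n f)
    (trans (+-congʳ (f≈0 0 (s≤s z≤n) λ ()))
      (trans (+-identityˡ _) (Σ<-single n (f ∘ suc) k k<n λ i i<n i≢k →
        f≈0 (suc i) (s≤s i<n) (i≢k ∘ ℕ.suc-injective))))

  -- Moving the window of n summands one step drops its first term and gains the one n places later,
  -- which equals it.
  Σ<-cyclic : ∀ n f → (∀ i → f (n ℕ.+ i) ≈ f i) → ∀ k → Σ< n (λ i → f (k ℕ.+ i)) ≈ Σ< n f
  Σ<-cyclic n f periodic zero = refl
  Σ<-cyclic n f periodic (suc k) = begin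
    Σ< n (λ i → f (suc k ℕ.+ i))
      ≈⟨ cancel ⟩
    Σ< n (λ i → f (k ℕ.+ i))
      ≈⟨ Σ<-cyclic n f periodic k ⟩
    Σ< n f ∎
    where
    open Solver
    g : ℕ → Carrier
    g i = f (k ℕ.+ i)
    g-end : g n ≈ g 0
    g-end = trans (reflexive (≡.cong f (ℕ.+-comm k n)))
      (trans (periodic k) (reflexive (≡.cong f (≡.sym (ℕ.+-identityʳ k)))))
    cancel : Σ< n (λ i → f (suc k ℕ.+ i)) ≈ Σ< n g
    cancel = begin
      Σ< n (λ i → f (suc k ℕ.+ i))
        ≈⟨ Σ<-cong n (λ i _ → reflexive (≡.cong f (≡.sym (ℕ.+-suc k i)))) ⟩
      Σ< n (g ∘ suc)
        ≈⟨ solve 2 (λ a b → b := (a :+ b) :- a) refl (g 0) _ ⟩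
      (g 0 + Σ< n (g ∘ suc)) - g 0
        ≈⟨ +-congʳ (trans (sym (Σ<-suc n g)) (Σ<-last n g)) ⟩
      (Σ< n g + g n) - g 0
        ≈⟨ +-congʳ (+-congˡ g-end) ⟩
      (Σ< n g + g 0) - g 0
        ≈⟨ solve 2 (λ a b → (b :+ a) :- a := b) refl (g 0) _ ⟩
      Σ< n g ∎

  Σ<-permute : ∀ n (e : ℕ → ℕ) → (∀ i → i ℕ.< n → e i ℕ.< n) →
               (∀ i j → i ℕ.< n → j ℕ.< n → e i ≡ e j → i ≡ j) →
               ∀ f → Σ< n (f ∘ e) ≈ Σ< n f
  Σ<-permute n e e<n e-inj f = begin
    Σ< n (f ∘ e)                ≈⟨ Σ<≈∑ n _ ⟩
    ∑ {n} (f ∘ e ∘ toℕ)         ≈⟨ ∑-cong (λ i → reflexive (≡.cong f (≡.sym (Fin.toℕ-fromℕ< (e<n (toℕ i) (Fin.toℕ<n i)))))) ⟩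
    ∑ {n} (f ∘ toℕ ∘ e′)        ≈⟨ ∑-cong (λ i → reflexive (≡.cong (f ∘ toℕ) (≡.sym (π≡ i)))) ⟩
    ∑ (λ i → f (toℕ (π ⟨$⟩ʳ i))) ≈⟨ ∑-permutation _ π ⟨
    ∑ {n} (f ∘ toℕ)             ≈⟨ Σ<≈∑ n f ⟨
    Σ< n f                      ∎
    where
    e′ : Fin n → Fin n
    e′ i = fromℕ< (e<n (toℕ i) (Fin.toℕ<n i))
    e′-inj : Injective _≡_ _≡_ e′
    e′-inj {i} {j} eq = Fin.toℕ-injective (e-inj _ _ (Fin.toℕ<n i) (Fin.toℕ<n j)
      (Fin.fromℕ<-injective _ _ (e<n _ (Fin.toℕ<n i)) (e<n _ (Fin.toℕ<n j)) eq))
    bijection = injective⇒permutation e′ e′-inj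
    π = proj₁ bijection
    π≡ = proj₂ bijection

  geometric : ∀ x n → (x - 1#) * Σ< n (x ^_) ≈ x ^ n - 1#
  geometric x zero = trans (*-congˡ (Σ<-0 _)) (solve 1 (λ x → (x :- con ℤ.1ℤ) :* con ℤ.0ℤ := con ℤ.1ℤ :- con ℤ.1ℤ) refl x)
    where
    open Solver

  geometric x (suc n) = begin
    (x - 1#) * Σ< (suc n) (x ^_)         ≈⟨ *-congˡ (Σ<-last n _) ⟩
    (x - 1#) * (Σ< n (x ^_) + x ^ n)     ≈⟨ distribˡ _ _ _ ⟩
    (x - 1#) * Σ< n (x ^_) + (x - 1#) * x ^ n ≈⟨ +-congʳ (geometric x n) ⟩
    (x ^ n - 1#) + (x - 1#) * x ^ n      ≈⟨ solve 2 (λ x y → (y :- con ℤ.1ℤ) :+ (x :- con ℤ.1ℤ) :* y := x :* y :- con ℤ.1ℤ) refl x (x ^ n) ⟩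
    x ^ suc n - 1#                       ∎
    where
    open Solver


  -- Polynomials are given by their coefficient sequences.

  mulLinear : Carrier → (ℕ → Carrier) → ℕ → Carrier
  mulLinear r a zero    = - (r * a 0)
  mulLinear r a (suc i) = a i - r * a (suc i)

  fromRoots : (ℕ → Carrier) → ℕ → ℕ → Carrier
  fromRoots r zero    zero    = 1#
  fromRoots r zero    (suc i) = 0#
  fromRoots r (suc n) i       = mulLinear (r n) (fromRoots r n) i

  mulLinear-cong : ∀ {r s a b} → r ≈ s → (∀ i → a i ≈ b i) → ∀ i → mulLinear r a i ≈ mulLinear s b i
  mulLinear-cong r≈s a≈b zero    = -‿cong (*-cong r≈s (a≈b 0))
  mulLinear-cong r≈s a≈b (suc i) = +-cong (a≈b i) (-‿cong (*-cong r≈s (a≈b (suc i))))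

  mulLinear-comm : ∀ r s a i → mulLinear r (mulLinear s a) i ≈ mulLinear s (mulLinear r a) i
  mulLinear-comm r s a zero = solve 3 (λ r s a → :- (r :* :- (s :* a)) := :- (s :* :- (r :* a))) refl r s (a 0)
    where open Solver
  mulLinear-comm r s a (suc zero) =
    solve 4 (λ r s a b → :- (s :* a) :- r :* (a :- s :* b) := :- (r :* a) :- s :* (a :- r :* b)) refl
      r s (a 0) (a 1)
    where open Solver
  mulLinear-comm r s a (suc (suc i)) =
    solve 5 (λ r s a b c → (a :- s :* b) :- r :* (b :- s :* c) := (a :- r :* b) :- s :* (b :- r :* c)) refl
      r s (a i) (a (suc i)) (a (suc (suc i)))
    where open Solver

  fromRoots-first : ∀ r n i → fromRoots r (suc n) i ≈ mulLinear (r 0) (fromRoots (r ∘ suc) n) i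
  fromRoots-first r zero    i = mulLinear-cong refl (λ { zero → refl ; (suc i) → refl }) i
  fromRoots-first r (suc n) i = begin
    mulLinear (r (suc n)) (fromRoots r (suc n)) i
      ≈⟨ mulLinear-cong refl (fromRoots-first r n) i ⟩
    mulLinear (r (suc n)) (mulLinear (r 0) (fromRoots (r ∘ suc) n)) i
      ≈⟨ mulLinear-comm (r (suc n)) (r 0) _ i ⟩
    mulLinear (r 0) (mulLinear (r (suc n)) (fromRoots (r ∘ suc) n)) i ∎

  -- Linear factors commute, so the factor at `r n` may be exchanged for the equal one at `r 0`. For
  -- `r k` = σᵏ x this will say that σ fixes the characteristic polynomial of x.
  fromRoots-cyclic : ∀ r n → r n ≈ r 0 → ∀ i → fromRoots (r ∘ suc) n i ≈ fromRoots r n i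
  fromRoots-cyclic r zero    _     zero    = refl
  fromRoots-cyclic r zero    _     (suc i) = refl
  fromRoots-cyclic r (suc n) rₙ≈r₀ i =
    trans (mulLinear-cong rₙ≈r₀ (λ _ → refl) i) (sym (fromRoots-first r n i))

  fromRoots-degree : ∀ r n i → n ℕ.< i → fromRoots r n i ≈ 0#
  fromRoots-degree r zero    (suc i) _         = refl
  fromRoots-degree r (suc n) (suc i) (s≤s n<i) = trans
    (+-cong (fromRoots-degree r n i n<i) (-‿cong (*-congˡ (fromRoots-degree r n (suc i) (ℕ.m<n⇒m<1+n n<i)))))
    (solve 1 (λ r → con (ℤ.+ 0) :- r :* con (ℤ.+ 0) := con (ℤ.+ 0)) refl (r n))
    where
    open Solver


  fromRoots-monic : ∀ r n → fromRoots r n n ≈ 1#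
  fromRoots-monic r zero    = refl
  fromRoots-monic r (suc n) = trans
    (+-cong (fromRoots-monic r n) (-‿cong (*-congˡ (fromRoots-degree r n (suc n) (ℕ.n<1+n n)))))
    (solve 1 (λ r → con (ℤ.+ 1) :- r :* con (ℤ.+ 0) := con (ℤ.+ 1)) refl (r n))
    where
    open Solver


  -- The terms from `a i` carry one more factor x; those from - r `a (suc i)` run up to index m,
  -- where the coefficient is zero. So m may be any bound beyond the degree.
  mulLinear-eval : ∀ m r a x → a m ≈ 0# →
    Σ< (suc m) (λ i → mulLinear r a i * x ^ i) ≈ (x - r) * Σ< m (λ i → a i * x ^ i)
  mulLinear-eval m r a x aₘ≈0 = begin
    Σ< (suc m) (λ i → mulLinear r a i * x ^ i)
      ≈⟨ Σ<-suc m _ ⟩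
    - (r * a 0) * 1# + Σ< m (λ i → (a i - r * a (suc i)) * x ^ suc i)
      ≈⟨ +-congˡ (Σ<-cong m λ i _ → expand (a i) r (a (suc i)) x (x ^ i)) ⟩
    - (r * a 0) * 1# + Σ< m (λ i → x * (a i * x ^ i) + - r * (a (suc i) * x ^ suc i))
      ≈⟨ +-congˡ (trans (Σ<-+ m _ _) (+-cong (Σ<-*ˡ m x _) (Σ<-*ˡ m (- r) _))) ⟩
    - (r * a 0) * 1# + (x * S + - r * S′)
      ≈⟨ solve 5 (λ r a x s t → :- (r :* a) :* con (ℤ.+ 1) :+ (x :* s :+ :- r :* t) :=
           x :* s :- r :* (a :* con (ℤ.+ 1) :+ t)) refl r (a 0) x S S′ ⟩
    x * S - r * (a 0 * 1# + S′)
      ≈⟨ +-congˡ (-‿cong (*-congˡ (sym (Σ<-suc m _)))) ⟩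
    x * S - r * Σ< (suc m) (λ i → a i * x ^ i)
      ≈⟨ +-congˡ (-‿cong (*-congˡ (trans (Σ<-last m _) (trans (+-congˡ (trans (*-congʳ aₘ≈0) (zeroˡ _))) (+-identityʳ _))))) ⟩
    x * S - r * S
      ≈⟨ solve 3 (λ x r s → x :* s :- r :* s := (x :- r) :* s) refl x r S ⟩
    (x - r) * S ∎
    where
    open Solver

    S = Σ< m (λ i → a i * x ^ i)
    S′ = Σ< m (λ i → a (suc i) * x ^ suc i)
    expand : ∀ a r b x y → (a - r * b) * (x * y) ≈ x * (a * y) + - r * (b * (x * y))
    expand = solve 5 (λ a r b x y → (a :- r :* b) :* (x :* y) := x :* (a :* y) :+ :- r :* (b :* (x :* y))) refl

  fromRoots-root : ∀ r n m → n ℕ.< m → ∀ k → k ℕ.< n → ∀ x → x ≈ r k →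
                   Σ< m (λ i → fromRoots r n i * x ^ i) ≈ 0#
  fromRoots-root r (suc n) (suc m) (s≤s n<m) k k<1+n x x≈rₖ with k ℕ.≟ n
  ... | yes ≡.refl = trans (mulLinear-eval m (r n) (fromRoots r n) x (fromRoots-degree r n m n<m))
      (trans (*-congʳ (trans (+-congʳ x≈rₖ) (-‿inverseʳ _))) (zeroˡ _))
  ... | no k≢n = trans (mulLinear-eval m (r n) (fromRoots r n) x (fromRoots-degree r n m n<m))
      (trans (*-congˡ (fromRoots-root r n m n<m k (ℕ.≤∧≢⇒< (ℕ.s≤s⁻¹ k<1+n) k≢n) x x≈rₖ)) (zeroʳ _))

-- Linear algebra over discrete fields, homomorphisms, rationals

module LinearDependence {c ℓ} (R : CommutativeRing c ℓ) where
  open RingTools R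
  open ≈-Reasoning

  -- The alternative between zero and invertible is data, because elimination has to search for a
  -- pivot.
  IsDiscreteField : Set (c ⊔ ℓ)
  IsDiscreteField = ¬ (1# ≈ 0#) × (∀ x → x ≈ 0# ⊎ ∃[ y ] x * y ≈ 1#)

  -- Gaussian elimination. If all first coordinates are zero, one vector gets coefficient 0 and the
  -- others are treated in one dimension less; otherwise multiples of a pivot vector are subtracted
  -- to clear the first coordinates.
  dependent : IsDiscreteField → ∀ n (v : Fin (suc n) → Fin n → Carrier) →
              Σ (Fin (suc n) → Carrier) λ a →
              (∃[ i ] ¬ (a i ≈ 0#)) × (∀ k → ∑ (λ i → a i * v i k) ≈ 0#)
  dependent (1≉0 , inv) zero    v = (λ _ → 1#) , (zero , 1≉0) , λ ()
  dependent field′@(1≉0 , inv) (suc n) v with allZero (suc (suc n)) (λ i → v i zero)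
    where
    allZero : ∀ m (w : Fin m → Carrier) → (∀ i → w i ≈ 0#) ⊎ ∃[ i ] ∃[ y ] w i * y ≈ 1#
    allZero zero    w = inj₁ λ ()
    allZero (suc m) w with inv (w zero) | allZero m (w ∘ suc)
    ... | inj₂ (y , eq) | _                = inj₂ (zero , y , eq)
    ... | inj₁ _        | inj₂ (i , found) = inj₂ (suc i , found)
    ... | inj₁ w₀≈0     | inj₁ w≈0         = inj₁ λ { zero → w₀≈0 ; (suc i) → w≈0 i }
  ... | inj₁ v≈0 = a′ , (suc (proj₁ (proj₁ (proj₂ ih))) , proj₂ (proj₁ (proj₂ ih))) , vanish
    where
    ih = dependent field′ n (λ i k → v (suc i) (suc k))
    a′ : Fin (suc (suc n)) → Carrier
    a′ = 0# ∷ proj₁ ih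
    vanish : ∀ k → ∑ (λ i → a′ i * v i k) ≈ 0#
    vanish zero    = ∑-zero λ i → trans (*-congˡ (v≈0 i)) (zeroʳ _)
    vanish (suc k) = trans (∑-suc _) (trans (+-cong (zeroˡ _) (proj₂ (proj₂ ih) k)) (+-identityˡ _))
  ... | inj₂ (p , y , vy≈1) = a′ , (punchIn p (proj₁ (proj₁ (proj₂ ih))) , nonzero) , vanish
    where
    open Solver
    w : Fin (suc n) → Fin (suc n) → Carrier
    w i k = v (punchIn p i) k - v (punchIn p i) zero * y * v p k
    ih = dependent field′ n (λ i k → w i (suc k))
    b = proj₁ ih
    -- Undoing the elimination in the relation for `w` collects this multiple of the pivot vector,
    -- whence the coefficient `- t` at p.
    t = ∑ (λ i → b i * (v (punchIn p i) zero * y))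
    a′ : Fin (suc (suc n)) → Carrier
    a′ = insertAt b p (- t)
    nonzero : ¬ (a′ (punchIn p (proj₁ (proj₁ (proj₂ ih)))) ≈ 0#)
    nonzero a≈0 = proj₂ (proj₁ (proj₂ ih)) (trans (reflexive (≡.sym (insertAt-punchIn b p (- t) _))) a≈0)
    expand : ∀ b x z u → b * x ≈ b * (x - z * u) + b * z * u
    expand = solve 4 (λ b x z u → b :* x := b :* (x :- z :* u) :+ b :* z :* u) refl
    combine : ∀ k → ∑ (λ i → a′ i * v i k) ≈ ∑ (λ i → b i * w i k)
    combine k = begin
      ∑ (λ i → a′ i * v i k)
        ≈⟨ ∑-remove p _ ⟩
      a′ p * v p k + ∑ (λ i → a′ (punchIn p i) * v (punchIn p i) k)
        ≈⟨ +-cong (*-congʳ (reflexive (insertAt-lookup b p (- t))))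
             (∑-cong λ i → trans (*-congʳ (reflexive (insertAt-punchIn b p (- t) i)))
               (expand (b i) (v (punchIn p i) k) (v (punchIn p i) zero * y) (v p k))) ⟩
      - t * v p k + ∑ (λ i → b i * w i k + b i * (v (punchIn p i) zero * y) * v p k)
        ≈⟨ +-congˡ (trans (∑-+ _ _) (+-congˡ (∑-*ʳ _ (v p k)))) ⟩
      - t * v p k + (∑ (λ i → b i * w i k) + t * v p k)
        ≈⟨ solve 3 (λ t u s → :- t :* u :+ (s :+ t :* u) := s) refl t (v p k) _ ⟩
      ∑ (λ i → b i * w i k) ∎
    w-pivot : ∀ i → w i zero ≈ 0#
    w-pivot i = begin
      x - x * y * v p zero     ≈⟨ solve 3 (λ x y u → x :- x :* y :* u := x :- x :* (u :* y)) refl x y (v p zero) ⟩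
      x - x * (v p zero * y)   ≈⟨ +-congˡ (-‿cong (trans (*-congˡ vy≈1) (*-identityʳ x))) ⟩
      x - x                    ≈⟨ -‿inverseʳ x ⟩
      0#                       ∎
      where x = v (punchIn p i) zero
    vanish : ∀ k → ∑ (λ i → a′ i * v i k) ≈ 0#
    vanish zero    = trans (combine zero) (∑-zero λ i → trans (*-congˡ (w-pivot i)) (zeroʳ _))
    vanish (suc k) = trans (combine (suc k)) (proj₂ (proj₂ ih) k)

module Homomorphism {c₁ ℓ₁ c₂ ℓ₂} (R : CommutativeRing c₁ ℓ₁) (S : CommutativeRing c₂ ℓ₂) where
  private
    module R where
      open RingTools R public
      open RangeSums R public
    module S where
      open RingTools S public
      open RangeSums S public
  open RingMorphisms R.rawRing S.rawRing using (IsRingHomomorphism)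

  module _ {h : R.Carrier → S.Carrier} (isHom : IsRingHomomorphism h) where
    open IsRingHomomorphism isHom

    ∑-hom : ∀ {n} (f : Fin n → R.Carrier) → h (R.∑ f) S.≈ S.∑ (h ∘ f)
    ∑-hom {zero}  f = S.trans (⟦⟧-cong (R.∑-empty f)) (S.trans 0#-homo (S.sym (S.∑-empty _)))
    ∑-hom {suc n} f = S.trans (⟦⟧-cong (R.∑-suc f)) (S.trans (+-homo _ _)
      (S.trans (S.+-congˡ (∑-hom (f ∘ suc))) (S.sym (S.∑-suc _))))

    Σ<-hom : ∀ n f → h (R.Σ< n f) S.≈ S.Σ< n (h ∘ f)
    Σ<-hom n f = S.trans (⟦⟧-cong (R.Σ<≈∑ n f)) (S.trans (∑-hom _) (S.sym (S.Σ<≈∑ n _)))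

    ^-hom : ∀ x n → h (x R.^ n) S.≈ h x S.^ n
    ^-hom x zero    = 1#-homo
    ^-hom x (suc n) = S.trans (*-homo x _) (S.*-congˡ (^-hom x n))

    ·ℕ-hom : ∀ n x → h (n R.·ℕ x) S.≈ n S.·ℕ h x
    ·ℕ-hom zero    x = 0#-homo
    ·ℕ-hom (suc n) x = S.trans (+-homo x _) (S.+-congˡ (·ℕ-hom n x))

    ·ℤ-hom : ∀ a x → h (a R.·ℤ x) S.≈ a S.·ℤ h x
    ·ℤ-hom (+ n)    x = ·ℕ-hom n x
    ·ℤ-hom -[1+ n ] x = S.trans (-‿homo _) (S.-‿cong (·ℕ-hom (suc n) x))

    ⟦⟧-hom : ∀ a → h R.⟦ a ⟧ S.≈ S.⟦ a ⟧
    ⟦⟧-hom a = S.trans (·ℤ-hom a R.1#) (·ℤ-cong a 1#-homo)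
      where
      ·ℤ-cong : ∀ a {x y} → x S.≈ y → a S.·ℤ x S.≈ a S.·ℤ y
      ·ℤ-cong (+ n)    x≈y = S.×-congʳ n x≈y
      ·ℤ-cong -[1+ n ] x≈y = S.-‿cong (S.×-congʳ (suc n) x≈y)

module _ where
  private module ℚᴿ = RingTools ℚ.+-*-commutativeRing

  toℚᵘ-ℕ : ∀ n → toℚᵘ (n ℚᴿ.·ℕ 1ℚ) ℚᵘ.≃ ℚᵘ.mkℚᵘ (+ n) 0
  toℚᵘ-ℕ zero    = ℚᵘ.≃-refl
  toℚᵘ-ℕ (suc n) = ℚᵘ.≃-trans (ℚ.toℚᵘ-homo-+ 1ℚ (n ℚᴿ.·ℕ 1ℚ))
    (ℚᵘ.≃-trans (ℚᵘ.+-congʳ (toℚᵘ 1ℚ) (toℚᵘ-ℕ n))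
      (ℚᵘ.*≡* (≡.cong (ℤ._* + 1) (≡.cong (λ k → + 1 ℤ.+ k) (ℤ.*-identityʳ (+ n))))))

  toℚᵘ-ℤ : ∀ a → toℚᵘ ℚᴿ.⟦ a ⟧ ℚᵘ.≃ ℚᵘ.mkℚᵘ a 0
  toℚᵘ-ℤ (+ n)    = toℚᵘ-ℕ n
  toℚᵘ-ℤ -[1+ n ] = ℚᵘ.≃-trans (ℚ.toℚᵘ-homo‿- (suc n ℚᴿ.·ℕ 1ℚ)) (ℚᵘ.-‿cong (toℚᵘ-ℕ (suc n)))

  -- Checked in unnormalised rationals, where products are formed without cancelling common factors.
  clearDenominator : ∀ q → q ℚ.* ℚᴿ.⟦ ℚ.↧ q ⟧ ≡ ℚᴿ.⟦ ℚ.↥ q ⟧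
  clearDenominator q = ℚ.toℚᵘ-injective (ℚᵘ.≃-trans (ℚ.toℚᵘ-homo-* q _)
    (ℚᵘ.≃-trans (ℚᵘ.*-congˡ {toℚᵘ q} (toℚᵘ-ℤ (ℚ.↧ q)))
      (ℚᵘ.≃-trans (ℚᵘ.*≡* (same q)) (ℚᵘ.≃-sym (toℚᵘ-ℤ (ℚ.↥ q))))))
    where
    same : ∀ q → ℚᵘ.↥ (toℚᵘ q ℚᵘ.* ℚᵘ.mkℚᵘ (ℚ.↧ q) 0) ℤ.* + 1 ≡
                 ℚ.↥ q ℤ.* ℚᵘ.↧ (toℚᵘ q ℚᵘ.* ℚᵘ.mkℚᵘ (ℚ.↧ q) 0)
    same (mkℚ a d _) = ≡.trans (ℤ.*-identityʳ _)
      (≡.cong (λ k → a ℤ.* + k) (≡.sym (ℕ.*-identityʳ (suc d))))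

  ⟦⟧≢0 : ∀ n → ℚᴿ.⟦ + suc n ⟧ ≢ 0ℚ
  ⟦⟧≢0 n eq with ℚᵘ.≃-trans (ℚᵘ.≃-sym (toℚᵘ-ℤ (+ suc n))) (ℚᵘ.≃-reflexive (≡.cong toℚᵘ eq))
  ... | ℚᵘ.*≡* ()

  ℚ-isDiscreteField : LinearDependence.IsDiscreteField ℚ.+-*-commutativeRing
  ℚ-isDiscreteField = (λ ()) , inverse
    where
    inverse : ∀ q → q ≡ 0ℚ ⊎ ∃[ r ] q ℚ.* r ≡ 1ℚ
    inverse q with q ℚ.≟ 0ℚ
    ... | yes q≡0 = inj₁ q≡0
    ... | no  q≢0 = inj₂ (ℚ.1/ q , ℚ.*-inverseʳ q)
      where instance _ = ℚ.≢-nonZero q≢0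

module HeytingTools {c ℓ₁ ℓ₂} (F : HeytingField c ℓ₁ ℓ₂) where
  open HeytingField F
  private
    commutativeRing : CommutativeRing c ℓ₁
    commutativeRing = record { isCommutativeRing = isCommutativeRing }
    module T = RingTools commutativeRing

  ¬#⇒≈ : ∀ {x y} → ¬ (x # y) → x ≈ y
  ¬#⇒≈ {x} {y} = proj₁ (tight x y)

  ≈⇒¬# : ∀ {x y} → x ≈ y → ¬ (x # y)
  ≈⇒¬# {x} {y} = proj₂ (tight x y)

  -- Tightness makes equality the negation of apartness, so proofs of equations may argue by
  -- contradiction.
  ≈-stable : ∀ {x y} → ¬ ¬ (x ≈ y) → x ≈ y
  ≈-stable ¬¬eq = ¬#⇒≈ λ x#y → ¬¬eq λ eq → ≈⇒¬# eq x#y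

  open T using (-0#≈0#; -‿involutive; module Solver)

  private
    x-0 : ∀ x → x - 0# ≈ x
    x-0 = solve 1 (λ x → x :- con (+ 0) := x) refl
      where open Solver

  inverse : ∀ {x} → x # 0# → ∃[ y ] x * y ≈ 1#
  inverse {x} x#0 with #⇒invertible x#0
  ... | y , _ , eq = y , trans (*-congʳ (sym (x-0 x))) eq

  unit⇒# : ∀ {x y} → x * y ≈ 1# → x # 0#
  unit⇒# {x} {y} eq = invertible⇒# (y , trans (*-congˡ (x-0 x)) (trans (*-comm y x) eq) ,
    trans (*-congʳ (x-0 x)) eq)

  1#0 : 1# # 0#
  1#0 = unit⇒# (*-identityˡ 1#)

  1≉0 : ¬ (1# ≈ 0#)
  1≉0 eq = ≈⇒¬# eq 1#0

  cancel-unit : ∀ {x y z} → x * y ≈ 1# → x * z ≈ 0# → z ≈ 0#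
  cancel-unit {x} {y} {z} xy≈1 xz≈0 = trans (sym (*-identityˡ z)) (trans (*-congʳ (sym xy≈1))
    (trans (rearrange x y z) (trans (*-congˡ xz≈0) (T.zeroʳ y))))
    where
    open Solver
    rearrange : ∀ x y z → x * y * z ≈ y * (x * z)
    rearrange = solve 3 (λ x y z → x :* y :* z := y :* (x :* z)) refl

  noZeroDivisors : ∀ {x y} → x * y ≈ 0# → ¬ (x ≈ 0#) → y ≈ 0#
  noZeroDivisors xy≈0 x≉0 = ≈-stable λ y≉0 → x≉0 (¬#⇒≈ λ x#0 →
    y≉0 (cancel-unit (proj₂ (inverse x#0)) xy≈0))

module ExtensionTools {c ℓ₁ ℓ₂} (L : Extensionℚ c ℓ₁ ℓ₂) where
  open Extensionℚ L using (heytingField; ι; ι-isHomomorphism) public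
  open RingTools (Extensionℚ.commutativeRing L)
  open HeytingTools heytingField
  open RingMorphisms using (IsRingHomomorphism)
  private
    module ℚᴿ = RingTools ℚ.+-*-commutativeRing
    module ι = IsRingHomomorphism ι-isHomomorphism
    module ιᴴ = Homomorphism ℚ.+-*-commutativeRing (Extensionℚ.commutativeRing L)

  ι-unit : ∀ {q} → q ≢ 0ℚ → ∃[ r ] ι q * ι r ≈ 1#
  ι-unit {q} q≢0 with proj₂ ℚ-isDiscreteField q
  ... | inj₁ q≡0 = contradiction q≡0 q≢0
  ... | inj₂ (r , qr≡1) = r , trans (sym (ι.*-homo q r)) (trans (ι.⟦⟧-cong qr≡1) ι.1#-homo)

  ι-injective : ∀ {q} → ι q ≈ 0# → q ≡ 0ℚ
  ι-injective {q} ιq≈0 with q ℚ.≟ 0ℚ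
  ... | yes q≡0 = q≡0
  ... | no  q≢0 = contradiction
    (trans (sym (proj₂ (ι-unit q≢0))) (trans (*-congʳ ιq≈0) (zeroˡ _))) 1≉0

  ι-⟦⟧ : ∀ a → ι ℚᴿ.⟦ a ⟧ ≈ ⟦ a ⟧
  ι-⟦⟧ a = ιᴴ.⟦⟧-hom ι-isHomomorphism a

  cancel-ℕ : ∀ n {x} → ⟦ + suc n ⟧ * x ≈ 0# → x ≈ 0#
  cancel-ℕ n {x} eq = cancel-unit (proj₂ (ι-unit (⟦⟧≢0 n))) (trans (*-congʳ (ι-⟦⟧ (+ suc n))) eq)

  ⟦⟧≉0 : ∀ n → ¬ (⟦ + suc n ⟧ ≈ 0#)
  ⟦⟧≉0 n eq = 1≉0 (cancel-ℕ n (trans (*-congʳ eq) (zeroˡ _)))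

  ι-denominator : ∀ q → ι q * ⟦ ℚ.↧ q ⟧ ≈ ⟦ ℚ.↥ q ⟧
  ι-denominator q = trans (*-congˡ (sym (ι-⟦⟧ (ℚ.↧ q)))) (trans (sym (ι.*-homo q _))
    (trans (ι.⟦⟧-cong (clearDenominator q)) (ι-⟦⟧ (ℚ.↥ q))))

  -- `h` fixes integers, and multiplying by the denominator reduces the claim to the numerator. The
  -- denominator cancels, since the image of ℚ has characteristic zero.
  hom-ι : ∀ {h} → IsRingHomomorphism rawRing rawRing h → ∀ q → h (ι q) ≈ ι q
  hom-ι {h} isHom q = x∙y⁻¹≈ε⇒x≈y _ _ (cancel-ℕ (ℚ.ℚ.denominator-1 q) (begin
    d * (h (ι q) - ι q)
      ≈⟨ solve 3 (λ d x y → d :* (x :- y) := x :* d :- y :* d) refl d (h (ι q)) (ι q) ⟩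
    h (ι q) * d - ι q * d
      ≈⟨ +-cong (*-congˡ (sym (hᴴ.⟦⟧-hom isHom (ℚ.↧ q)))) (-‿cong (ι-denominator q)) ⟩
    h (ι q) * h d - n
      ≈⟨ +-congʳ (trans (sym (h.*-homo _ _)) (trans (h.⟦⟧-cong (ι-denominator q)) (hᴴ.⟦⟧-hom isHom (ℚ.↥ q)))) ⟩
    n - n
      ≈⟨ -‿inverseʳ n ⟩
    0# ∎))
    where
    open ≈-Reasoning
    open Solver
    module h = IsRingHomomorphism isHom
    module hᴴ = Homomorphism (Extensionℚ.commutativeRing L) (Extensionℚ.commutativeRing L)
    d = ⟦ ℚ.↧ q ⟧
    n = ⟦ ℚ.↥ q ⟧

least-positive : ∀ {ℓ} {P : ℕ → Set ℓ} → (∀ k → Dec (P k)) → ∀ n →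
  (∃[ d ] 0 ℕ.< d × d ℕ.≤ n × P d × (∀ k → 0 ℕ.< k → k ℕ.< d → ¬ P k)) ⊎
  (∀ k → 0 ℕ.< k → k ℕ.≤ n → ¬ P k)
least-positive P? zero = inj₂ λ k 0<k k≤0 → contradiction k≤0 (ℕ.<⇒≱ 0<k)
least-positive {P = P} P? (suc n) with least-positive P? n
... | inj₁ (d , 0<d , d≤n , rest) = inj₁ (d , 0<d , ℕ.m≤n⇒m≤1+n d≤n , rest)
... | inj₂ none with P? (suc n)
...   | yes holds = inj₁ (suc n , s≤s z≤n , ℕ.≤-refl , holds , λ k 0<k k<1+n → none k 0<k (ℕ.s≤s⁻¹ k<1+n))
...   | no ¬holds = inj₂ none′
  where
  none′ : ∀ k → 0 ℕ.< k → k ℕ.≤ suc n → ¬ P k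
  none′ k 0<k k≤1+n with k ℕ.≟ suc n
  ... | yes ≡.refl = ¬holds
  ... | no k≢1+n   = none k 0<k (ℕ.s≤s⁻¹ (ℕ.≤∧≢⇒< k≤1+n k≢1+n))

-- Congruences modulo n and cyclic orbits

module Congruence (n : ℕ) where
  infix 4 _≡ₙ_
  -- A record rather than a synonym, so that a and b can be inferred.
  record _≡ₙ_ (a b : ℤ) : Set where
    constructor mod
    field difference : (+ n) ℤ∣.∣ (a ℤ.- b)

  private
    open RingTools ℤ.+-*-commutativeRing using (module Solver)
    open Solver

    mod′ : ∀ {a b c} → c ≡ a ℤ.- b → (+ n) ℤ∣.∣ c → a ≡ₙ b
    mod′ c≡ p = mod (≡.subst ((+ n) ℤ∣.∣_) c≡ p)

  ≡⇒≡ₙ : ∀ {a b} → a ≡ b → a ≡ₙ b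
  ≡⇒≡ₙ {a} ≡.refl = mod (divides ℤ.0ℤ (ℤ.+-inverseʳ a))

  private
    sym′ : ∀ {a b} → a ≡ₙ b → b ≡ₙ a
    sym′ {a} {b} (mod p) = mod′ (solve 2 (λ a b → :- (a :- b) := b :- a) ≡.refl a b) (ℤ∣.∣m⇒∣-m p)

    trans′ : ∀ {a b c} → a ≡ₙ b → b ≡ₙ c → a ≡ₙ c
    trans′ {a} {b} {c} (mod p) (mod q) = mod′
      (solve 3 (λ a b c → (a :- b) :+ (b :- c) := a :- c) ≡.refl a b c) (ℤ∣.∣m∣n⇒∣m+n p q)

    +-cong′ : ∀ {a b c d} → a ≡ₙ b → c ≡ₙ d → a ℤ.+ c ≡ₙ b ℤ.+ d
    +-cong′ {a} {b} {c} {d} (mod p) (mod q) = mod′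
      (solve 4 (λ a b c d → (a :- b) :+ (c :- d) := (a :+ c) :- (b :+ d)) ≡.refl a b c d)
      (ℤ∣.∣m∣n⇒∣m+n p q)

    *-cong′ : ∀ {a b c d} → a ≡ₙ b → c ≡ₙ d → a ℤ.* c ≡ₙ b ℤ.* d
    *-cong′ {a} {b} {c} {d} (mod p) (mod q) = mod′
      (solve 4 (λ a b c d → (a :- b) :* c :+ b :* (c :- d) := a :* c :- b :* d) ≡.refl a b c d)
      (ℤ∣.∣m∣n⇒∣m+n (ℤ∣.∣m⇒∣m*n c p) (ℤ∣.∣n⇒∣m*n b q))

    -‿cong′ : ∀ {a b} → a ≡ₙ b → ℤ.- a ≡ₙ ℤ.- b
    -‿cong′ {a} {b} (mod p) = mod′
      (solve 2 (λ a b → :- (a :- b) := :- a :- :- b) ≡.refl a b) (ℤ∣.∣m⇒∣-m p)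

  -- ℤ with congruence as its equality plays the part of ℤ / n, so that sums, powers and Parseval
  -- apply to integers without passing to residues.
  modRing : CommutativeRing 0ℓ 0ℓ
  modRing = record
    { Carrier = ℤ ; _≈_ = _≡ₙ_ ; _+_ = ℤ._+_ ; _*_ = ℤ._*_ ; -_ = ℤ.-_ ; 0# = ℤ.0ℤ ; 1# = ℤ.1ℤ
    ; isCommutativeRing = record
      { isRing = record
        { +-isAbelianGroup = record
          { isGroup = record
            { isMonoid = record
              { isSemigroup = record
                { isMagma = record
                  { isEquivalence = record { refl = ≡⇒≡ₙ ≡.refl ; sym = sym′ ; trans = trans′ }
                  ; ∙-cong = +-cong′ }
                ; assoc = λ a b c → ≡⇒≡ₙ (ℤ.+-assoc a b c) }
              ; identity = (λ a → ≡⇒≡ₙ (ℤ.+-identityˡ a)) , (λ a → ≡⇒≡ₙ (ℤ.+-identityʳ a)) }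
            ; inverse = (λ a → ≡⇒≡ₙ (ℤ.+-inverseˡ a)) , (λ a → ≡⇒≡ₙ (ℤ.+-inverseʳ a))
            ; ⁻¹-cong = -‿cong′ }
          ; comm = λ a b → ≡⇒≡ₙ (ℤ.+-comm a b) }
        ; *-cong = *-cong′
        ; *-assoc = λ a b c → ≡⇒≡ₙ (ℤ.*-assoc a b c)
        ; *-identity = (λ a → ≡⇒≡ₙ (ℤ.*-identityˡ a)) , (λ a → ≡⇒≡ₙ (ℤ.*-identityʳ a))
        ; distrib = (λ a b c → ≡⇒≡ₙ (ℤ.*-distribˡ-+ a b c)) , (λ a b c → ≡⇒≡ₙ (ℤ.*-distribʳ-+ a b c)) }
      ; *-comm = λ a b → ≡⇒≡ₙ (ℤ.*-comm a b) } }

  ∣⇒≡ₙ0 : ∀ {a} → (+ n) ℤ∣.∣ a → a ≡ₙ ℤ.0ℤ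
  ∣⇒≡ₙ0 = mod′ (≡.sym (ℤ.+-identityʳ _))

  ≡ₙ0⇒∣ : ∀ {a} → a ≡ₙ ℤ.0ℤ → (+ n) ℤ∣.∣ a
  ≡ₙ0⇒∣ (mod p) = ≡.subst ((+ n) ℤ∣.∣_) (ℤ.+-identityʳ _) p

  ≡ₙ-noZeroDivisors : Prime n → ∀ {a b} → a ℤ.* b ≡ₙ ℤ.0ℤ → ¬ (a ≡ₙ ℤ.0ℤ) → b ≡ₙ ℤ.0ℤ
  ≡ₙ-noZeroDivisors n-prime {a} {b} ab≡0 a≢0
    with euclidsLemma ℤ.∣ a ∣ ℤ.∣ b ∣ n-prime (≡.subst (n ℕ.∣_) (ℤ.abs-* a b) (ℤ∣.∣⇒∣ᵤ {+ n} {a ℤ.* b} (≡ₙ0⇒∣ ab≡0)))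
  ... | inj₁ n∣a = contradiction (∣⇒≡ₙ0 (ℤ∣.∣ᵤ⇒∣ n∣a)) a≢0
  ... | inj₂ n∣b = ∣⇒≡ₙ0 (ℤ∣.∣ᵤ⇒∣ n∣b)

-- A surjective sequence e : ℕ → Fin n generated by an injective step is periodic with
-- period exactly n: a shorter period d would embed Fin n into Fin d.
module Orbit {n : ℕ} (e : ℕ → Fin n)
             (step : ∀ {i j} → e i ≡ e j → e (suc i) ≡ e (suc j))
             (unstep : ∀ {i j} → e (suc i) ≡ e (suc j) → e i ≡ e j)
             (onto : ∀ a → ∃[ k ] e k ≡ a) where

  unshift : ∀ i {j} → e i ≡ e (i ℕ.+ j) → e 0 ≡ e j
  unshift zero    eq = eq
  unshift (suc i) eq = unshift i (unstep eq)

  periodic : ∀ {d} → e d ≡ e 0 → ∀ i → e (d ℕ.+ i) ≡ e i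
  periodic {d} eq zero    = ≡.trans (≡.cong e (ℕ.+-identityʳ d)) eq
  periodic {d} eq (suc i) = ≡.trans (≡.cong e (ℕ.+-suc d i)) (step (periodic eq i))

  periodic-* : ∀ {d} → e d ≡ e 0 → ∀ k i → e (i ℕ.+ k ℕ.* d) ≡ e i
  periodic-* eq zero    i = ≡.cong e (ℕ.+-identityʳ i)
  periodic-* {d} eq (suc k) i = ≡.trans
    (≡.cong e (≡.trans (≡.sym (ℕ.+-assoc i d _)) (≡.trans (≡.cong (ℕ._+ k ℕ.* d) (ℕ.+-comm i d)) (ℕ.+-assoc d i _))))
    (≡.trans (periodic eq (i ℕ.+ k ℕ.* d)) (periodic-* eq k i))

  n≤period : ∀ {d} → 0 ℕ.< d → e d ≡ e 0 → n ℕ.≤ d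
  n≤period {suc d-1} _ eq = Fin.injective⇒≤ {f = f} f-injective
    where
    d = suc d-1
    f : Fin n → Fin d
    f a = fromℕ< (m%n<n (proj₁ (onto a)) d)
    e-f : ∀ a → e (toℕ (f a)) ≡ a
    e-f a = ≡.trans (≡.cong e (Fin.toℕ-fromℕ< _)) (≡.trans
      (≡.sym (periodic-* eq (k / d) (k % d)))
      (≡.trans (≡.cong e (≡.sym (m≡m%n+[m/n]*n k d))) (proj₂ (onto a))))
      where k = proj₁ (onto a)
    f-injective : Injective _≡_ _≡_ f
    f-injective {a} {b} eq = ≡.trans (≡.sym (e-f a)) (≡.trans (≡.cong (e ∘ toℕ) eq) (e-f b))

  private
    difference : ∀ {i j} → i ℕ.< j → e i ≡ e j → 0 ℕ.< j ℕ.∸ i × e (j ℕ.∸ i) ≡ e 0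
    difference {i} {j} i<j eq = ℕ.m<n⇒0<n∸m i<j , ≡.sym (unshift i
      (≡.trans eq (≡.cong e (≡.sym (ℕ.m+[n∸m]≡n (ℕ.<⇒≤ i<j))))))

  -- Among the first n + 1 terms two agree, at a distance d with 0 < d ≤ n; this d is a period, and
  -- `n≤period` forces d = n.
  period-n : e n ≡ e 0
  period-n with Fin.pigeonhole (ℕ.n<1+n n) (e ∘ toℕ)
  ... | i , j , i<j , eq with difference i<j eq
  ... | 0<d , ed≡e0 = ≡.subst (λ k → e k ≡ e 0)
    (ℕ.≤-antisym (ℕ.≤-trans (ℕ.m∸n≤m (toℕ j) (toℕ i)) (ℕ.s≤s⁻¹ (Fin.toℕ<n j))) (n≤period 0<d ed≡e0)) ed≡e0

  injective : ∀ {i j} → i ℕ.< n → j ℕ.< n → e i ≡ e j → i ≡ j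
  injective {i} {j} i<n j<n eq with ℕ.<-cmp i j
  ... | tri≈ _ i≡j _ = i≡j
  ... | tri< i<j _ _ = contradiction (ℕ.≤-<-trans (ℕ.m∸n≤m j i) j<n)
    (ℕ.≤⇒≯ (n≤period (proj₁ (difference i<j eq)) (proj₂ (difference i<j eq))))
  ... | tri> _ _ j<i = contradiction (ℕ.≤-<-trans (ℕ.m∸n≤m i j) i<n)
    (ℕ.≤⇒≯ (n≤period (proj₁ (difference j<i (≡.sym eq))) (proj₂ (difference j<i (≡.sym eq)))))

pos-^ : ∀ m n → + (m ℕ.^ n) ≡ (+ m) ℤ.^ n
pos-^ m zero    = ≡.refl
pos-^ m (suc n) = ≡.trans (ℤ.pos-* m (m ℕ.^ n)) (≡.cong (+ m ℤ.*_) (pos-^ m n))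

module Iterate {c ℓ} (R : CommutativeRing c ℓ) where
  open RingTools R
  open RingMorphisms rawRing rawRing using (IsRingHomomorphism)

  iterate-+ : ∀ (σ : Carrier → Carrier) x j k → fold x σ (j ℕ.+ k) ≡ fold (fold x σ k) σ j
  iterate-+ σ x zero    k = ≡.refl
  iterate-+ σ x (suc j) k = ≡.cong σ (iterate-+ σ x j k)

  iterate-isHom : ∀ {σ} → IsRingHomomorphism σ → ∀ k → IsRingHomomorphism (λ x → fold x σ k)
  iterate-isHom σ-isHom zero    = Identity.isRingHomomorphism rawRing refl
  iterate-isHom σ-isHom (suc k) = Composition.isRingHomomorphism trans (iterate-isHom σ-isHom k) σ-isHom

  iterate-injective : ∀ {σ : Carrier → Carrier} → (∀ {x y} → σ x ≈ σ y → x ≈ y) →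
                      ∀ k {x y} → fold x σ k ≈ fold y σ k → x ≈ y
  iterate-injective σ-inj zero    eq = eq
  iterate-injective σ-inj (suc k) eq = iterate-injective σ-inj k (σ-inj eq)

-- Powers of a primitive root of unity

module RootOfUnity {c ℓ₁ ℓ₂} (L : Extensionℚ c ℓ₁ ℓ₂) (N : ℕ) (ζ : Extensionℚ.Carrier L)
                   (ζ-primitive : FieldTheory.IsPrimitiveRootOfUnity L (suc N) ζ) where
  open RingTools (Extensionℚ.commutativeRing L)
  open RangeSums (Extensionℚ.commutativeRing L)
  open ExtensionTools L
  open HeytingTools heytingField
  open FieldTheory L
  open Congruence (suc N) using (_≡ₙ_; mod)

  private
    p = suc N

  ζ^-cong : ∀ {m n} → m ≡ n → ζ ^ m ≈ ζ ^ n
  ζ^-cong m≡n = reflexive (≡.cong (ζ ^_) m≡n)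

  ζ^-multiple : ∀ k → ζ ^ (p ℕ.* k) ≈ 1#
  ζ^-multiple k = trans (sym (^-assocʳ ζ p k)) (trans (^-congˡ k (proj₁ ζ-primitive)) (1^ k))
    where
    1^ : ∀ k → 1# ^ k ≈ 1#
    1^ zero    = refl
    1^ (suc k) = trans (*-identityˡ _) (1^ k)

  ζ^-periodic : ∀ a k → ζ ^ (a ℕ.+ k ℕ.* p) ≈ ζ ^ a
  ζ^-periodic a k = trans (^-homo-* ζ a _) (trans (*-congˡ
    (trans (ζ^-cong (ℕ.*-comm k p)) (ζ^-multiple k))) (*-identityʳ _))

  ζ^-mod : ∀ a b → + a ≡ₙ + b → ζ ^ a ≈ ζ ^ b
  ζ^-mod a b (mod (divides (+ k) eq)) = trans (ζ^-cong a≡) (ζ^-periodic b k)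
    where
    a≡ : a ≡ b ℕ.+ k ℕ.* p
    a≡ = ℤ.+-injective (≡.trans
      (≡.trans (≡.sym (ℤ.+-identityʳ (+ a))) (≡.trans (≡.cong (λ z → + a ℤ.+ z) (≡.sym (ℤ.+-inverseˡ (+ b))))
        (≡.trans (≡.sym (ℤ.+-assoc (+ a) (ℤ.- (+ b)) (+ b))) (≡.cong (ℤ._+ + b) eq))))
      (≡.trans (≡.cong (ℤ._+ + b) (≡.sym (ℤ.pos-* k p))) (≡.cong +_ (ℕ.+-comm (k ℕ.* p) b))))
  ζ^-mod a b (mod (divides -[1+ k ] eq)) = sym (trans (ζ^-cong b≡) (ζ^-periodic a (suc k)))
    where
    open RingTools.Solver ℤ.+-*-commutativeRing
    b≡ : b ≡ a ℕ.+ suc k ℕ.* p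
    b≡ = ℤ.+-injective (≡.trans
      (solve 2 (λ a b → b := a :- (a :- b)) ≡.refl (+ a) (+ b))
      (≡.trans (≡.cong (λ z → + a ℤ.- z) eq)
        (≡.cong (λ z → + a ℤ.+ z) (≡.trans (ℤ.neg-distribˡ-* -[1+ k ] (+ p)) (≡.sym (ℤ.pos-* (suc k) p))))))

  ζ^-% : ∀ a → ζ ^ a ≈ ζ ^ (a % p)
  ζ^-% a = trans (ζ^-cong (m≡m%n+[m/n]*n a p)) (ζ^-periodic (a % p) (a / p))

  ζ-order : ∀ n → ζ ^ n ≈ 1# → p ℕ.∣ n
  ζ-order n ζⁿ≈1 with n % p in eq
  ... | zero  = ℕ.m%n≡0⇒n∣m n p eq
  ... | suc r = contradiction (trans (sym (trans (ζ^-% n) (ζ^-cong eq))) ζⁿ≈1)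
    (proj₂ ζ-primitive (suc r) (s≤s z≤n) (≡.subst (ℕ._< p) eq (m%n<n n p)))

  ζ^-∣ : ∀ {n} → p ℕ.∣ n → ζ ^ n ≈ 1#
  ζ^-∣ {n} (ℕ.divides k eq) = trans (ζ^-cong (≡.trans eq (ℕ.*-comm k p))) (ζ^-multiple k)

  -- n + N n = p n: multiplying the exponent by N = p - 1 plays the role of negation, and exponents
  -- stay natural.
  ζ^-inverse : ∀ n → ζ ^ n * ζ ^ (N ℕ.* n) ≈ 1#
  ζ^-inverse n = trans (sym (^-homo-* ζ n _)) (ζ^-multiple n)

  ζ^-distinct : ∀ {a b} → a ℕ.< b → b ℕ.< p → ¬ (ζ ^ a ≈ ζ ^ b)
  ζ^-distinct {a} {b} a<b b<p eq = proj₂ ζ-primitive (b ℕ.∸ a) (ℕ.m<n⇒0<n∸m a<b)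
    (ℕ.≤-<-trans (ℕ.m∸n≤m b a) b<p)
    (x∙y⁻¹≈ε⇒x≈y _ _ (cancel-unit (ζ^-inverse a) (begin
      ζ ^ a * (ζ ^ (b ℕ.∸ a) - 1#)
        ≈⟨ solve 2 (λ x y → x :* (y :- con (+ 1)) := x :* y :- x) refl _ _ ⟩
      ζ ^ a * ζ ^ (b ℕ.∸ a) - ζ ^ a
        ≈⟨ +-congʳ (trans (sym (^-homo-* ζ a _)) (ζ^-cong (ℕ.m+[n∸m]≡n (ℕ.<⇒≤ a<b)))) ⟩
      ζ ^ b - ζ ^ a
        ≈⟨ trans (+-congˡ (-‿cong eq)) (-‿inverseʳ _) ⟩
      0# ∎)))
    where
    open ≈-Reasoning
    open Solver

  ζ^-injective : ∀ {a b} → a ℕ.< p → b ℕ.< p → ζ ^ a ≈ ζ ^ b → a ≡ b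
  ζ^-injective {a} {b} a<p b<p eq with ℕ.<-cmp a b
  ... | tri≈ _ a≡b _ = a≡b
  ... | tri< a<b _ _ = contradiction eq (ζ^-distinct a<b b<p)
  ... | tri> _ _ b<a = contradiction (sym eq) (ζ^-distinct b<a a<p)

  geometric-zero : ∀ {y} → y ^ p ≈ 1# → ¬ (y ≈ 1#) → Σ< p (y ^_) ≈ 0#
  geometric-zero {y} yᵖ≈1 y≉1 = noZeroDivisors
    (trans (geometric y p) (trans (+-congʳ yᵖ≈1) (-‿inverseʳ 1#)))
    (λ eq → y≉1 (x∙y⁻¹≈ε⇒x≈y _ _ eq))

-- Order and estimates in the real numbers

module RealTools {c ℓ₁ ℓ₂} (ℝ : Reals c ℓ₁ ℓ₂) where
  open Reals ℝ using (heytingField; commutativeRing; _<_; _≤_; #⇒<∨>; +-monoˡ-<; *-positive;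
    IsSqrt; IsQuotient) public
  open RingTools commutativeRing public
  open HeytingTools heytingField public
  open IsStrictPartialOrder (Reals.isStrictPartialOrder ℝ) public
    using () renaming (irrefl to <-irrefl; trans to <-trans; <-resp-≈ to <-resp)

  <-respʳ : ∀ {x y z} → y ≈ z → x < y → x < z
  <-respʳ = proj₁ <-resp

  <-respˡ : ∀ {x y z} → y ≈ z → y < x → z < x
  <-respˡ = proj₂ <-resp

  -- All inequalities x ≤ y below are negations, so they may be proved by trichotomy.
  trichotomy : ∀ x y → ¬ ¬ (x < y ⊎ x ≈ y ⊎ y < x)
  trichotomy x y none = none (inj₂ (inj₁ (¬#⇒≈ λ x#y → decide (#⇒<∨> x#y))))
    where
    decide : x < y ⊎ y < x → ⊥
    decide (inj₁ x<y) = none (inj₁ x<y)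
    decide (inj₂ y<x) = none (inj₂ (inj₂ y<x))

  <-asym : ∀ {x y} → x < y → ¬ (y < x)
  <-asym x<y y<x = <-irrefl refl (<-trans x<y y<x)

  <⇒≤ : ∀ {x y} → x < y → x ≤ y
  <⇒≤ = <-asym

  ≈⇒≤ : ∀ {x y} → x ≈ y → x ≤ y
  ≈⇒≤ x≈y y<x = <-irrefl (sym x≈y) y<x

  ≤-cases : ∀ {x y} → x ≤ y → ¬ ¬ (x < y ⊎ x ≈ y)
  ≤-cases {x} {y} x≤y none = trichotomy x y λ where
    (inj₁ x<y)        → none (inj₁ x<y)
    (inj₂ (inj₁ x≈y)) → none (inj₂ x≈y)
    (inj₂ (inj₂ y<x)) → x≤y y<x

  -- `x ≤ y` splits into cases only under double negation, and `x < z` does not absorb it. This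
  -- suffices where a contradiction is sought.
  ≤-<-trans-¬¬ : ∀ {x y z} → x ≤ y → y < z → ¬ ¬ (x < z)
  ≤-<-trans-¬¬ x≤y y<z x≮z = ≤-cases x≤y λ where
    (inj₁ x<y) → x≮z (<-trans x<y y<z)
    (inj₂ x≈y) → x≮z (<-respˡ (sym x≈y) y<z)

  ≤-trans : ∀ {x y z} → x ≤ y → y ≤ z → x ≤ z
  ≤-trans x≤y y≤z z<x = ≤-cases x≤y λ where
    (inj₁ x<y) → y≤z (<-trans z<x x<y)
    (inj₂ x≈y) → y≤z (<-respʳ x≈y z<x)

  ≤-resp : ∀ {x y z w} → x ≈ z → y ≈ w → x ≤ y → z ≤ w
  ≤-resp x≈z y≈w x≤y w<z = x≤y (<-respˡ (sym y≈w) (<-respʳ (sym x≈z) w<z))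

  +-monoʳ-< : ∀ z {x y} → x < y → z + x < z + y
  +-monoʳ-< z x<y = <-respˡ (+-comm _ _) (<-respʳ (+-comm _ _) (+-monoˡ-< z x<y))

  private
    open Solver

    shift : ∀ x y → (y - x) + x ≈ y
    shift = solve 2 (λ x y → (y :- x) :+ x := y) refl

  0<y-x : ∀ {x y} → x < y → 0# < y - x
  0<y-x {x} {y} x<y = <-respˡ (-‿inverseʳ x) (+-monoˡ-< (- x) x<y)

  0<y-x⇒x<y : ∀ {x y} → 0# < y - x → x < y
  0<y-x⇒x<y {x} {y} 0<d = <-respˡ (+-identityˡ x) (<-respʳ (shift x y) (+-monoˡ-< x 0<d))

  *-monoˡ-< : ∀ {z x y} → 0# < z → x < y → z * x < z * y
  *-monoˡ-< {z} {x} {y} 0<z x<y = 0<y-x⇒x<y (<-respʳ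
    (solve 3 (λ z x y → z :* (y :- x) := z :* y :- z :* x) refl z x y) (*-positive 0<z (0<y-x x<y)))

  *-monoˡ-≤ : ∀ {z x y} → 0# ≤ z → x ≤ y → z * x ≤ z * y
  *-monoˡ-≤ {z} {x} {y} 0≤z x≤y zy<zx = ≤-cases 0≤z λ where
    (inj₁ 0<z) → ≤-cases x≤y λ where
      (inj₁ x<y) → <-asym zy<zx (*-monoˡ-< 0<z x<y)
      (inj₂ x≈y) → <-irrefl (*-congˡ (sym x≈y)) zy<zx
    (inj₂ 0≈z) → <-irrefl (trans (trans (*-congʳ (sym 0≈z)) (zeroˡ y))
      (sym (trans (*-congʳ (sym 0≈z)) (zeroˡ x)))) zy<zx

  *-nonneg : ∀ {x y} → 0# ≤ x → 0# ≤ y → 0# ≤ x * y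
  *-nonneg 0≤x 0≤y = ≤-resp (zeroʳ _) refl (*-monoˡ-≤ 0≤x 0≤y)

  *-mono-≤ : ∀ {x y z w} → 0# ≤ x → 0# ≤ w → x ≤ y → z ≤ w → x * z ≤ y * w
  *-mono-≤ {x} {y} {z} {w} 0≤x 0≤w x≤y z≤w = ≤-trans (*-monoˡ-≤ 0≤x z≤w)
    (≤-resp (*-comm w x) (*-comm w y) (*-monoˡ-≤ 0≤w x≤y))

  +-nonneg : ∀ {x y} → 0# ≤ x → 0# ≤ y → 0# ≤ x + y
  +-nonneg {x} {y} 0≤x 0≤y x+y<0 = ≤-cases 0≤x λ where
    (inj₁ 0<x) → 0≤y (<-trans (<-respˡ (+-identityˡ y) (+-monoˡ-< y 0<x)) x+y<0)
    (inj₂ 0≈x) → 0≤y (<-respˡ (trans (+-congʳ (sym 0≈x)) (+-identityˡ y)) x+y<0)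

  square-nonneg : ∀ x → 0# ≤ x * x
  square-nonneg x x²<0 = trichotomy 0# x λ where
    (inj₁ 0<x)        → <-asym x²<0 (*-positive 0<x 0<x)
    (inj₂ (inj₁ 0≈x)) → <-irrefl (trans (*-congʳ (sym 0≈x)) (zeroˡ x)) x²<0
    (inj₂ (inj₂ x<0)) → <-asym x²<0 (<-respʳ
      (solve 1 (λ x → (con (+ 0) :- x) :* (con (+ 0) :- x) := x :* x) refl x)
      (*-positive (0<y-x x<0) (0<y-x x<0)))

  0≤1 : 0# ≤ 1#
  0≤1 = ≤-resp refl (*-identityˡ 1#) (square-nonneg 1#)

  apart-positive : ∀ {x} → 0# ≤ x → Reals._#_ ℝ x 0# → 0# < x
  apart-positive {x} 0≤x x#0 = decide (#⇒<∨> x#0)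
    where
    decide : x < 0# ⊎ 0# < x → 0# < x
    decide (inj₁ x<0) = contradiction x<0 0≤x
    decide (inj₂ 0<x) = 0<x

  0<1 : 0# < 1#
  0<1 = apart-positive 0≤1 1#0

  0≤⟦⟧ : ∀ n → 0# ≤ ⟦ + n ⟧
  0≤⟦⟧ zero    = ≈⇒≤ refl
  0≤⟦⟧ (suc n) = +-nonneg 0≤1 (0≤⟦⟧ n)

  0<⟦⟧ : ∀ n → 0# < ⟦ + suc n ⟧
  0<⟦⟧ zero    = <-respʳ (sym ⟦⟧-homo-1) 0<1
  0<⟦⟧ (suc n) = <-trans 0<1 (<-respˡ (+-identityʳ 1#) (+-monoʳ-< 1# (0<⟦⟧ n)))

  ⟦⟧-mono-≤ : ∀ {a b} → a ℤ.≤ b → ⟦ a ⟧ ≤ ⟦ b ⟧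
  ⟦⟧-mono-≤ {a} {b} a≤b = ≤-resp (+-identityʳ _) sum≈ (+-monoʳ-≤ ⟦ a ⟧ (0≤⟦⟧ ℤ.∣ b ℤ.- a ∣))
    where
    +-monoʳ-≤ : ∀ z {x y} → x ≤ y → z + x ≤ z + y
    +-monoʳ-≤ z {x} {y} x≤y zy<zx = x≤y (<-respˡ (cancel z y) (<-respʳ (cancel z x) (+-monoʳ-< (- z) zy<zx)))
      where
      cancel : ∀ z x → - z + (z + x) ≈ x
      cancel = solve 2 (λ z x → :- z :+ (z :+ x) := x) refl
    sum≈ : ⟦ a ⟧ + ⟦ + ℤ.∣ b ℤ.- a ∣ ⟧ ≈ ⟦ b ⟧
    sum≈ = trans (sym (⟦⟧-homo-+ a _)) (⟦⟧-cong (≡.trans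
      (≡.cong (λ z → a ℤ.+ z) (ℤ.0≤i⇒+∣i∣≡i (ℤ.i≤j⇒0≤j-i a≤b)))
      (≡.trans (ℤ.+-comm a _) (≡.trans (ℤ.+-assoc b _ a) (≡.trans (≡.cong (λ z → b ℤ.+ z) (ℤ.+-inverseˡ a)) (ℤ.+-identityʳ b))))))

  ⟦⟧-injective-0 : ∀ a → ⟦ a ⟧ ≈ 0# → a ≡ + 0
  ⟦⟧-injective-0 (+ zero)  eq = ≡.refl
  ⟦⟧-injective-0 (+ suc n) eq = contradiction (0<⟦⟧ n) (<-irrefl (sym eq))
  ⟦⟧-injective-0 -[1+ n ]  eq = contradiction (0<⟦⟧ n)
    (<-irrefl (trans (sym -0#≈0#) (trans (-‿cong (sym eq)) (-‿involutive _))))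

  ^-nonneg : ∀ {x} → 0# ≤ x → ∀ n → 0# ≤ x ^ n
  ^-nonneg 0≤x zero    = 0≤1
  ^-nonneg 0≤x (suc n) = *-nonneg 0≤x (^-nonneg 0≤x n)

  ^-mono-≤ : ∀ {x y} → 0# ≤ x → x ≤ y → ∀ n → x ^ n ≤ y ^ n
  ^-mono-≤ 0≤x x≤y zero    = ≈⇒≤ refl
  ^-mono-≤ 0≤x x≤y (suc n) = *-mono-≤ 0≤x (^-nonneg (≤-trans 0≤x x≤y) n) x≤y (^-mono-≤ 0≤x x≤y n)

  ^-positive : ∀ {x} → 0# < x → ∀ n → 0# < x ^ n
  ^-positive 0<x zero    = 0<1
  ^-positive 0<x (suc n) = *-positive 0<x (^-positive 0<x n)

  ⟦⟧-^ : ∀ m n → ⟦ + (m ℕ.^ n) ⟧ ≈ ⟦ + m ⟧ ^ n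
  ⟦⟧-^ m zero    = ⟦⟧-homo-1
  ⟦⟧-^ m (suc n) = trans (⟦⟧-cong (ℤ.pos-* m (m ℕ.^ n))) (trans (⟦⟧-homo-* (+ m) _) (*-congˡ (⟦⟧-^ m n)))

  -- Squaring ρⁿ / vol < 1 / (2ⁿ √p) contradicts the two hypotheses on ρ and vol.
  density-bound : ∀ n p k {ρ vol δ √p b} →
    0# ≤ ρ + ρ → ⟦ + p ⟧ * ⟦ + p ⟧ ≤ ⟦ + suc k ⟧ * ((ρ + ρ) * (ρ + ρ)) →
    0# ≤ vol → ⟦ + suc k ⟧ ^ n * (vol * vol) ≤ (⟦ + p ⟧ * ⟦ + p ⟧) ^ n * ⟦ + p ⟧ →
    IsQuotient (ρ ^ n) vol δ → IsSqrt (p ·ℕ 1#) √p → IsQuotient 1# ((2 ·ℕ 1#) ^ n * √p) b → b ≤ δ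
  density-bound n p k {ρ} {vol} {δ} {√p} {b} 0≤X pp≤kXX 0≤vol kvol≤ (vol#0 , δvol≈) (0≤√p , √p²≈p) (c#0 , bc≈1) δ<b =
    Y²<vol²-¬¬ λ Y²<vol² → ≤-trans kvol≤ lower (*-monoˡ-< (^-positive (0<⟦⟧ k) n) Y²<vol²)
    where
    open ≈-Reasoning
    X = ρ + ρ
    C = (2 ·ℕ 1#) ^ n * √p
    Y = X ^ n * √p
    K = ⟦ + suc k ⟧
    P = ⟦ + p ⟧
    0<vol : 0# < vol
    0<vol = apart-positive 0≤vol vol#0
    0<C : 0# < C
    0<C = apart-positive (*-nonneg (^-nonneg (0≤⟦⟧ 2) n) 0≤√p) c#0
    0≤Y : 0# ≤ Y
    0≤Y = *-nonneg (^-nonneg 0≤X n) 0≤√p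
    X^n : X ^ n ≈ (2 ·ℕ 1#) ^ n * ρ ^ n
    X^n = trans (^-congˡ n (solve 1 (λ r → r :+ r := con (+ 2) :* r) refl ρ)) (^-distrib-* _ ρ n)
    -- `δ < b` is multiplied by vol C: on the left δ vol = ρⁿ and 2ⁿ ρⁿ = Xⁿ, on the right b C = 1.
    Y<vol : Y < vol
    Y<vol = <-respˡ (begin
        vol * C * δ             ≈⟨ solve 4 (λ v c q d → v :* (c :* q) :* d := c :* (d :* v) :* q) refl vol ((2 ·ℕ 1#) ^ n) √p δ ⟩
        (2 ·ℕ 1#) ^ n * (δ * vol) * √p ≈⟨ *-congʳ (trans (*-congˡ δvol≈) (sym X^n)) ⟩
        Y                       ∎)
      (<-respʳ (begin
        vol * C * b             ≈⟨ solve 3 (λ v c b → v :* c :* b := (b :* c) :* v) refl vol C b ⟩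
        b * C * vol             ≈⟨ trans (*-congʳ bc≈1) (*-identityˡ vol) ⟩
        vol                     ∎)
      (*-monoˡ-< (*-positive 0<vol 0<C) δ<b))
    Y²<vol²-¬¬ : ¬ ¬ (Y * Y < vol * vol)
    Y²<vol²-¬¬ Y²≮ = ≤-<-trans-¬¬ (*-monoˡ-≤ 0≤Y (<⇒≤ Y<vol))
      (<-respˡ (*-comm vol Y) (*-monoˡ-< 0<vol Y<vol)) Y²≮
    lower : (P * P) ^ n * P ≤ K ^ n * (Y * Y)
    lower = ≤-resp refl (begin
        (K * (X * X)) ^ n * P           ≈⟨ *-cong (trans (^-distrib-* K _ n) (*-congˡ (^-distrib-* X X n))) (sym √p²≈p) ⟩
        K ^ n * (X ^ n * X ^ n) * (√p * √p) ≈⟨ solve 3 (λ k x q → k :* (x :* x) :* (q :* q) := k :* ((x :* q) :* (x :* q))) refl (K ^ n) (X ^ n) √p ⟩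
        K ^ n * (Y * Y)                 ∎)
      (*-mono-≤ (^-nonneg (*-nonneg (0≤⟦⟧ p) (0≤⟦⟧ p)) n) (0≤⟦⟧ p)
        (^-mono-≤ (*-nonneg (0≤⟦⟧ p) (0≤⟦⟧ p)) pp≤kXX n) (≈⇒≤ refl))

-- The finite Fourier transform

module Parseval {c ℓ} (R : CommutativeRing c ℓ) where
  open RingTools R
  open RangeSums R
  open ≈-Reasoning

  transform : ∀ {s} → (Fin s → Carrier) → Carrier → Carrier
  transform a x = ∑ λ j → a j * x ^ toℕ j

  -- Interchanging the sums leaves for each pair (j, l) the geometric sum of x = αʲ βˡ with s terms.
  -- As xˢ = 1, it vanishes unless x = 1, which means j = l, and then it is s.
  parseval : ∀ {s} (a : Fin s → Carrier) {α β} → α * β ≈ 1# → α ^ s ≈ 1# →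
    (∀ {i j} → i ℕ.< s → j ℕ.< s → α ^ i ≈ α ^ j → i ≡ j) →
    (∀ {x y} → x * y ≈ 0# → ¬ (x ≈ 0#) → y ≈ 0#) →
    Σ< s (λ i → transform a (α ^ i) * transform a (β ^ i)) ≈ ⟦ + s ⟧ * ∑ λ j → a j * a j
  parseval {s} a {α} {β} αβ≈1 αˢ≈1 distinct noZeroDivisors = begin
    Σ< s (λ i → transform a (α ^ i) * transform a (β ^ i))
      ≈⟨ Σ<-cong s (λ i _ → trans (sym (∑-*ʳ _ _)) (∑-cong λ j → trans (sym (∑-*ˡ _ _)) (∑-cong λ l → term i j l))) ⟩
    Σ< s (λ i → ∑ λ j → ∑ λ l → a j * a l * x j l ^ i)
      ≈⟨ trans (Σ<≈∑ s _) (trans (∑-swap _) (∑-cong λ j → ∑-swap _)) ⟩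
    ∑ (λ j → ∑ λ l → ∑ {s} λ i → a j * a l * x j l ^ toℕ i)
      ≈⟨ ∑-cong (λ j → ∑-cong λ l → trans (∑-*ˡ _ _) (*-congˡ (sym (Σ<≈∑ s (x j l ^_))))) ⟩
    ∑ (λ j → ∑ λ l → a j * a l * Σ< s (x j l ^_))
      ≈⟨ ∑-cong row ⟩
    ∑ (λ j → ⟦ + s ⟧ * (a j * a j))
      ≈⟨ ∑-*ˡ _ _ ⟩
    ⟦ + s ⟧ * ∑ (λ j → a j * a j) ∎
    where
    open Solver
    x : Fin s → Fin s → Carrier
    x j l = α ^ toℕ j * β ^ toℕ l

    1^ : ∀ n → 1# ^ n ≈ 1#
    1^ zero    = refl
    1^ (suc n) = trans (*-identityˡ _) (1^ n)

    αβ^ : ∀ n → α ^ n * β ^ n ≈ 1#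
    αβ^ n = trans (sym (^-distrib-* α β n)) (trans (^-congˡ n αβ≈1) (1^ n))

    βˢ≈1 : β ^ s ≈ 1#
    βˢ≈1 = trans (sym (*-identityˡ _)) (trans (*-congʳ (sym αˢ≈1)) (αβ^ s))

    exchange : ∀ x i j → (x ^ i) ^ j ≈ (x ^ j) ^ i
    exchange x i j = trans (^-assocʳ x i j) (trans (reflexive (≡.cong (x ^_) (ℕ.*-comm i j))) (sym (^-assocʳ x j i)))

    term : ∀ i j l → a j * (α ^ i) ^ toℕ j * (a l * (β ^ i) ^ toℕ l) ≈ a j * a l * x j l ^ i
    term i j l = trans (solve 4 (λ a u b v → a :* u :* (b :* v) := a :* b :* (u :* v)) refl (a j) _ (a l) _)
      (*-congˡ (trans (*-cong (exchange α i (toℕ j)) (exchange β i (toℕ l))) (sym (^-distrib-* _ _ i))))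

    xˢ≈1 : ∀ j l → x j l ^ s ≈ 1#
    xˢ≈1 j l = trans (^-distrib-* _ _ s) (trans (*-cong (exchange α (toℕ j) s) (exchange β (toℕ l) s))
      (trans (*-cong (trans (^-congˡ (toℕ j) αˢ≈1) (1^ (toℕ j))) (trans (^-congˡ (toℕ l) βˢ≈1) (1^ (toℕ l))))
        (*-identityˡ 1#)))

    x≈1⇒≡ : ∀ j l → x j l ≈ 1# → toℕ j ≡ toℕ l
    x≈1⇒≡ j l x≈1 = distinct (Fin.toℕ<n j) (Fin.toℕ<n l) (begin
      α ^ toℕ j                                  ≈⟨ *-identityʳ _ ⟨
      α ^ toℕ j * 1#                             ≈⟨ *-congˡ (αβ^ (toℕ l)) ⟨
      α ^ toℕ j * (α ^ toℕ l * β ^ toℕ l)        ≈⟨ solve 3 (λ a b c → a :* (b :* c) := b :* (a :* c)) refl _ _ _ ⟩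
      α ^ toℕ l * x j l                          ≈⟨ trans (*-congˡ x≈1) (*-identityʳ _) ⟩
      α ^ toℕ l                                  ∎)

    sum-distinct : ∀ j l → j ≢ l → Σ< s (x j l ^_) ≈ 0#
    sum-distinct j l j≢l = noZeroDivisors
      (trans (geometric (x j l) s) (trans (+-congʳ (xˢ≈1 j l)) (-‿inverseʳ 1#)))
      (λ eq → j≢l (Fin.toℕ-injective (x≈1⇒≡ j l (x∙y⁻¹≈ε⇒x≈y _ _ eq))))

    sum-equal : ∀ j → Σ< s (x j j ^_) ≈ ⟦ + s ⟧
    sum-equal j = trans (Σ<-cong s λ i _ → trans (^-congˡ i (αβ^ (toℕ j))) (1^ i))
      (trans (Σ<-const s 1#) (*-identityʳ _))

    ∑-single : ∀ {n} (f : Fin n → Carrier) j → (∀ l → j ≢ l → f l ≈ 0#) → ∑ f ≈ f j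
    ∑-single {suc n} f j f≈0 = trans (∑-remove j f)
      (trans (+-congˡ (∑-zero λ k → f≈0 _ λ eq → Fin.punchInᵢ≢i j k (≡.sym eq))) (+-identityʳ _))

    row : ∀ j → ∑ (λ l → a j * a l * Σ< s (x j l ^_)) ≈ ⟦ + s ⟧ * (a j * a j)
    row j = trans (∑-single _ j λ l j≢l → trans (*-congˡ (sum-distinct j l j≢l)) (zeroʳ _))
      (trans (*-congˡ (sum-equal j)) (*-comm _ _))

-- The trace form and the code over ℤ

module IntegerCodes where
  module ℤᴿ = RingTools ℤ.+-*-commutativeRing
  module ℤᴰ = Determinant ℤ.+-*-commutativeRing
  open ℤᴿ using (∑)

  δ : ∀ {n} → Fin n → Fin n → ℤ
  δ i j with i Fin.≟ j
  ... | yes _ = + 1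
  ... | no  _ = + 0

  δ-refl : ∀ {n} (i : Fin n) → δ i i ≡ + 1
  δ-refl i with i Fin.≟ i
  ... | yes _  = ≡.refl
  ... | no i≢i = contradiction ≡.refl i≢i

  δ-≢ : ∀ {n} {i j : Fin n} → i ≢ j → δ i j ≡ + 0
  δ-≢ {i = i} {j} i≢j with i Fin.≟ j
  ... | yes i≡j = contradiction i≡j i≢j
  ... | no _    = ≡.refl

  ∑-δʳ : ∀ {n} (f : Fin n → ℤ) j → ∑ (λ i → f i ℤ.* δ i j) ≡ f j
  ∑-δʳ {suc n} f j = ≡.trans (ℤᴿ.∑-remove j _) (≡.trans (≡.cong₂ ℤ._+_
    (≡.trans (≡.cong (f j ℤ.*_) (δ-refl j)) (ℤ.*-identityʳ (f j)))
    (ℤᴿ.∑-zero λ k → ≡.trans (≡.cong (f (Fin.punchIn j k) ℤ.*_) (δ-≢ (Fin.punchInᵢ≢i j k))) (ℤ.*-zeroʳ (f (Fin.punchIn j k)))))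
    (ℤ.+-identityʳ (f j)))

  ∑-δˡ : ∀ {n} (f : Fin n → ℤ) i → ∑ (λ j → δ i j ℤ.* f j) ≡ f i
  ∑-δˡ {suc n} f i = ≡.trans (ℤᴿ.∑-remove i _) (≡.trans (≡.cong₂ ℤ._+_
    (≡.trans (≡.cong (ℤ._* f i) (δ-refl i)) (ℤ.*-identityˡ (f i)))
    (ℤᴿ.∑-zero λ k → ≡.cong (ℤ._* f (Fin.punchIn i k)) (δ-≢ λ eq → Fin.punchInᵢ≢i i k (≡.sym eq))))
    (ℤ.+-identityʳ (f i)))

  square-nonneg : ∀ a → ℤ.0ℤ ℤ.≤ a ℤ.* a
  square-nonneg (+ n)    = ≡.subst (ℤ.0ℤ ℤ.≤_) (ℤ.pos-* n n) (ℤ.+≤+ z≤n)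
  square-nonneg -[1+ n ] = ℤ.+≤+ z≤n

  ∑-nonneg : ∀ {n} {f : Fin n → ℤ} → (∀ i → ℤ.0ℤ ℤ.≤ f i) → ℤ.0ℤ ℤ.≤ ∑ f
  ∑-nonneg {zero}  f≥0 = ℤ.≤-reflexive (≡.sym (ℤᴿ.∑-empty _))
  ∑-nonneg {suc n} f≥0 = ≡.subst (ℤ.0ℤ ℤ.≤_) (≡.sym (ℤᴿ.∑-suc _))
    (ℤ.+-mono-≤ (f≥0 zero) (∑-nonneg (f≥0 ∘ suc)))

  ∑-nonneg-zero : ∀ {n} {f : Fin n → ℤ} → (∀ i → ℤ.0ℤ ℤ.≤ f i) → ∑ f ≡ ℤ.0ℤ → ∀ i → f i ≡ ℤ.0ℤ
  ∑-nonneg-zero {suc n} {f} f≥0 eq i = ℤ.≤-antisym (≡.subst (f i ℤ.≤_)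
    (≡.trans (≡.sym (ℤᴿ.∑-remove i f)) eq)
    (≡.subst (ℤ._≤ f i ℤ.+ rest) (ℤ.+-identityʳ (f i)) (ℤ.+-monoʳ-≤ (f i) (∑-nonneg λ k → f≥0 (Fin.punchIn i k)))))
    (f≥0 i)
    where rest = ∑ (λ k → f (Fin.punchIn i k))

  -- n Σ aᵢ² - (Σ aᵢ)² is the sum of the squares (aᵢ - aⱼ)² over i < j.
  cauchy : ∀ {n} (a : Fin n → ℤ) →
           ℤ.0ℤ ℤ.≤ + n ℤ.* ∑ (λ i → a i ℤ.* a i) ℤ.- ∑ a ℤ.* ∑ a
  cauchy {zero}  a = ℤ.≤-reflexive (≡.cong (λ z → ℤ.0ℤ ℤ.* ∑ (λ i → a i ℤ.* a i) ℤ.- z ℤ.* z) (≡.sym (ℤᴿ.∑-empty a)))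
  cauchy {suc n} a = ≡.subst (ℤ.0ℤ ℤ.≤_) (≡.sym expand)
    (ℤ.+-mono-≤ (cauchy (a ∘ suc)) (∑-nonneg λ j → square-nonneg (a zero ℤ.- a (suc j))))
    where
    open ≡-Reasoning
    open ℤᴿ.Solver
    x = a zero
    S = ∑ (a ∘ suc)
    T = ∑ (λ i → a (suc i) ℤ.* a (suc i))
    squares : ∑ (λ j → (x ℤ.- a (suc j)) ℤ.* (x ℤ.- a (suc j))) ≡ + n ℤ.* (x ℤ.* x) ℤ.+ (ℤ.- (x ℤ.+ x) ℤ.* S ℤ.+ T)
    squares = begin
      ∑ (λ j → (x ℤ.- a (suc j)) ℤ.* (x ℤ.- a (suc j)))
        ≡⟨ ℤᴿ.∑-cong (λ j → solve 2 (λ x y → (x :- y) :* (x :- y) := x :* x :+ (:- (x :+ x) :* y :+ y :* y)) ≡.refl x (a (suc j))) ⟩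
      ∑ (λ j → x ℤ.* x ℤ.+ (ℤ.- (x ℤ.+ x) ℤ.* a (suc j) ℤ.+ a (suc j) ℤ.* a (suc j)))
        ≡⟨ ≡.trans (ℤᴿ.∑-+ _ _) (≡.cong₂ ℤ._+_ (ℤᴿ.∑-const n (x ℤ.* x))
             (≡.trans (ℤᴿ.∑-+ _ _) (≡.cong (ℤ._+ T) (ℤᴿ.∑-*ˡ (ℤ.- (x ℤ.+ x)) _)))) ⟩
      ℤᴿ.⟦ + n ⟧ ℤ.* (x ℤ.* x) ℤ.+ (ℤ.- (x ℤ.+ x) ℤ.* S ℤ.+ T)
        ≡⟨ ≡.cong (λ k → k ℤ.* (x ℤ.* x) ℤ.+ (ℤ.- (x ℤ.+ x) ℤ.* S ℤ.+ T)) (⟦⟧-ℤ n) ⟩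
      + n ℤ.* (x ℤ.* x) ℤ.+ (ℤ.- (x ℤ.+ x) ℤ.* S ℤ.+ T) ∎
      where
      ⟦⟧-ℤ : ∀ n → ℤᴿ.⟦ + n ⟧ ≡ + n
      ⟦⟧-ℤ zero    = ≡.refl
      ⟦⟧-ℤ (suc n) = ≡.cong (λ k → + 1 ℤ.+ k) (⟦⟧-ℤ n)
    expand : + suc n ℤ.* ∑ (λ i → a i ℤ.* a i) ℤ.- ∑ a ℤ.* ∑ a ≡
             (+ n ℤ.* T ℤ.- S ℤ.* S) ℤ.+ ∑ (λ j → (x ℤ.- a (suc j)) ℤ.* (x ℤ.- a (suc j)))
    expand = begin
      + suc n ℤ.* ∑ (λ i → a i ℤ.* a i) ℤ.- ∑ a ℤ.* ∑ a
        ≡⟨ ≡.cong₂ (λ u v → + suc n ℤ.* u ℤ.- v ℤ.* v) (ℤᴿ.∑-suc _) (ℤᴿ.∑-suc a) ⟩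
      + suc n ℤ.* (x ℤ.* x ℤ.+ T) ℤ.- (x ℤ.+ S) ℤ.* (x ℤ.+ S)
        ≡⟨ solve 4 (λ n x s t → (con (+ 1) :+ n) :* (x :* x :+ t) :- (x :+ s) :* (x :+ s) :=
             (n :* t :- s :* s) :+ (n :* (x :* x) :+ (:- (x :+ x) :* s :+ t))) ≡.refl (+ n) x S T ⟩
      (+ n ℤ.* T ℤ.- S ℤ.* S) ℤ.+ (+ n ℤ.* (x ℤ.* x) ℤ.+ (ℤ.- (x ℤ.+ x) ℤ.* S ℤ.+ T))
        ≡⟨ ≡.cong (λ z → (+ n ℤ.* T ℤ.- S ℤ.* S) ℤ.+ z) squares ⟨
      (+ n ℤ.* T ℤ.- S ℤ.* S) ℤ.+ ∑ (λ j → (x ℤ.- a (suc j)) ℤ.* (x ℤ.- a (suc j))) ∎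

  -- y divides the positive n. With determinants as factors this bounds one of them without
  -- computing the other.
  factor-bound : ∀ {x y} n .{{_ : NonZero n}} → x ℤ.* y ≡ + n → ℤ.∣ y ∣ ℕ.≤ n
  factor-bound {x} {y} n eq = ℕ.∣⇒≤ (ℕ.divides ℤ.∣ x ∣ (≡.trans (≡.cong ℤ.∣_∣ (≡.sym eq)) (ℤ.abs-* x y)))

  module TraceForm (s m : ℕ) where
    private
      p : ℕ
      p = suc (m ℕ.* s)

    -- The trace form of x y̅ in the coordinates given by the Gaussian periods.
    Q : (Fin s → ℤ) → (Fin s → ℤ) → ℤ
    Q a b = + p ℤ.* ∑ (λ i → a i ℤ.* b i) ℤ.- + m ℤ.* (∑ a ℤ.* ∑ b)

    private
      open ℤᴿ.Solver

      -- p = 1 + m s splits the form into a sum of squares and m times the Cauchy defect s Σ aᵢ² -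
      -- (Σ aᵢ)². Both are nonnegative and the first is definite.
      Q-square : ∀ (a : Fin s → ℤ) → Q a a ≡ ∑ (λ i → a i ℤ.* a i) ℤ.+ + m ℤ.* (+ s ℤ.* ∑ (λ i → a i ℤ.* a i) ℤ.- ∑ a ℤ.* ∑ a)
      Q-square a = ≡.trans (≡.cong (λ k → (+ 1 ℤ.+ k) ℤ.* T ℤ.- + m ℤ.* (S ℤ.* S)) (ℤ.pos-* m s))
        (solve 4 (λ m s t u → (con (+ 1) :+ m :* s) :* t :- m :* (u :* u) := t :+ m :* (s :* t :- u :* u)) ≡.refl (+ m) (+ s) T S)
        where
        T = ∑ (λ i → a i ℤ.* a i)
        S = ∑ a

      correction-nonneg : ∀ (a : Fin s → ℤ) → ℤ.0ℤ ℤ.≤ + m ℤ.* (+ s ℤ.* ∑ (λ i → a i ℤ.* a i) ℤ.- ∑ a ℤ.* ∑ a)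
      correction-nonneg a = ≡.subst (ℤ._≤ + m ℤ.* (+ s ℤ.* ∑ (λ i → a i ℤ.* a i) ℤ.- ∑ a ℤ.* ∑ a))
        (ℤ.*-zeroʳ (+ m)) (ℤ.*-monoˡ-≤-nonNeg (+ m) (cauchy a))

    Q-nonneg : ∀ a → ℤ.0ℤ ℤ.≤ Q a a
    Q-nonneg a = ≡.subst (ℤ.0ℤ ℤ.≤_) (≡.sym (Q-square a))
      (ℤ.+-mono-≤ (∑-nonneg λ i → square-nonneg (a i)) (correction-nonneg a))

    Q-definite : ∀ a → Q a a ≡ ℤ.0ℤ → ∀ i → a i ≡ ℤ.0ℤ
    Q-definite a Q≡0 i = square-zero (a i) (∑-nonneg-zero (λ i → square-nonneg (a i))
      (ℤ.≤-antisym (≡.subst₂ ℤ._≤_ (ℤ.+-identityʳ _) (≡.trans (≡.sym (Q-square a)) Q≡0)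
        (ℤ.+-monoʳ-≤ (∑ λ i → a i ℤ.* a i) (correction-nonneg a))) (∑-nonneg λ i → square-nonneg (a i))) i)
      where
      square-zero : ∀ x → x ℤ.* x ≡ ℤ.0ℤ → x ≡ ℤ.0ℤ
      square-zero x eq = same (ℤ.i*j≡0⇒i≡0∨j≡0 x eq)
        where
        same : x ≡ ℤ.0ℤ ⊎ x ≡ ℤ.0ℤ → x ≡ ℤ.0ℤ
        same (inj₁ eq) = eq
        same (inj₂ eq) = eq

    -- Each bracket compares a and b against one second argument, so it vanishes once a and b pair
    -- equally with every vector.
    Q-difference : ∀ a b → Q (λ i → a i ℤ.- b i) (λ i → a i ℤ.- b i) ≡ (Q a a ℤ.- Q b a) ℤ.- (Q a b ℤ.- Q b b)
    Q-difference a b = ≡.trans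
      (≡.cong₂ (λ u v → + p ℤ.* u ℤ.- + m ℤ.* (v ℤ.* v))
        (≡.trans (ℤᴿ.∑-cong λ i → solve 2 (λ x y → (x :- y) :* (x :- y) := (x :* x :- y :* x) :- (x :* y :- y :* y)) ≡.refl (a i) (b i))
          (≡.trans (difference _ _) (≡.cong₂ ℤ._-_ (difference _ _) (difference _ _))))
        (difference a b))
      (solve 8 (λ p m aa ba ab bb a b → p :* ((aa :- ba) :- (ab :- bb)) :- m :* ((a :- b) :* (a :- b)) :=
        ((p :* aa :- m :* (a :* a)) :- (p :* ba :- m :* (b :* a))) :-
        ((p :* ab :- m :* (a :* b)) :- (p :* bb :- m :* (b :* b)))) ≡.refl
        (+ p) (+ m) (∑ λ i → a i ℤ.* a i) (∑ λ i → b i ℤ.* a i) (∑ λ i → a i ℤ.* b i) (∑ λ i → b i ℤ.* b i) (∑ a) (∑ b))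
      where
      difference : ∀ {n} (f g : Fin n → ℤ) → ∑ (λ i → f i ℤ.- g i) ≡ ∑ f ℤ.- ∑ g
      difference f g = ≡.trans (ℤᴿ.∑-+ f _) (≡.cong (λ z → ∑ f ℤ.+ z) (ℤᴿ.∑-neg g))

    -- The Gram matrix p I - m J of the periods, with J the all-ones matrix.
    G : Fin s → Fin s → ℤ
    G i j = + p ℤ.* δ i j ℤ.- + m

    G-product : ∀ (b : Fin s → ℤ) l → ∑ (λ k → G l k ℤ.* b k) ≡ + p ℤ.* b l ℤ.- + m ℤ.* ∑ b
    G-product b l = begin
      ∑ (λ k → (+ p ℤ.* δ l k ℤ.- + m) ℤ.* b k)
        ≡⟨ ℤᴿ.∑-cong (λ k → solve 4 (λ p d m b → (p :* d :- m) :* b := p :* (d :* b) :+ :- m :* b) ≡.refl (+ p) (δ l k) (+ m) (b k)) ⟩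
      ∑ (λ k → + p ℤ.* (δ l k ℤ.* b k) ℤ.+ ℤ.- + m ℤ.* b k)
        ≡⟨ ≡.trans (ℤᴿ.∑-+ _ _) (≡.cong₂ ℤ._+_ (≡.trans (ℤᴿ.∑-*ˡ (+ p) _) (≡.cong (+ p ℤ.*_) (∑-δˡ b l))) (ℤᴿ.∑-*ˡ (ℤ.- + m) b)) ⟩
      + p ℤ.* b l ℤ.+ ℤ.- + m ℤ.* ∑ b
        ≡⟨ ≡.cong (λ z → + p ℤ.* b l ℤ.+ z) (≡.sym (ℤ.neg-distribˡ-* (+ m) (∑ b))) ⟩
      + p ℤ.* b l ℤ.- + m ℤ.* ∑ b ∎
      where open ≡-Reasoning

    Q-matrix : ∀ a b → Q a b ≡ ∑ λ l → a l ℤ.* ∑ λ k → G l k ℤ.* b k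
    Q-matrix a b = ≡.sym (begin
      ∑ (λ l → a l ℤ.* ∑ λ k → G l k ℤ.* b k)
        ≡⟨ ℤᴿ.∑-cong (λ l → ≡.trans (≡.cong (a l ℤ.*_) (G-product b l))
             (solve 5 (λ a p b m s → a :* (p :* b :- m :* s) := p :* (a :* b) :+ a :* (:- (m :* s))) ≡.refl (a l) (+ p) (b l) (+ m) (∑ b))) ⟩
      ∑ (λ l → + p ℤ.* (a l ℤ.* b l) ℤ.+ a l ℤ.* (ℤ.- (+ m ℤ.* ∑ b)))
        ≡⟨ ≡.trans (ℤᴿ.∑-+ _ _) (≡.cong₂ ℤ._+_ (ℤᴿ.∑-*ˡ (+ p) _) (ℤᴿ.∑-*ʳ a _)) ⟩
      + p ℤ.* ∑ (λ i → a i ℤ.* b i) ℤ.+ ∑ a ℤ.* (ℤ.- (+ m ℤ.* ∑ b))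
        ≡⟨ solve 4 (λ x m a b → x :+ a :* (:- (m :* b)) := x :- m :* (a :* b)) ≡.refl (+ p ℤ.* ∑ (λ i → a i ℤ.* b i)) (+ m) (∑ a) (∑ b) ⟩
      Q a b ∎)
      where open ≡-Reasoning

  module CodeLattice (s m : ℕ) .{{_ : NonZero s}} (p-prime : Prime (suc (m ℕ.* s))) (2∣s : 2 ℕ.∣ s)
                     (β : ℤ) (β-primitive : IsPrimitiveRootMod (suc (m ℕ.* s)) β) where
    open TraceForm s m
    private
      p : ℕ
      p = suc (m ℕ.* s)
    open Congruence p
    private
      module M where
        open RingTools modRing public
        open RangeSums modRing public
      module MP = Parseval modRing
      module ℤˢ = RangeSums ℤ.+-*-commutativeRing

    α : ℤ
    α = β ℤ.^ ((p ℕ.∸ 1) / s)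

    IsCodeword : (Fin s → ℤ) → Set
    IsCodeword a = ∀ i → i ℕ.≤ s / 2 → (+ p) ℤ.∣ dot a (μ s α i)

    private
      h : ℕ
      h = ℕ.quotient 2∣s

      s≡h*2 : s ≡ h ℕ.* 2
      s≡h*2 = ℕ._∣_.equality 2∣s

      s/2≡h : s / 2 ≡ h
      s/2≡h = ≡.trans (≡.cong (_/ 2) s≡h*2) (m*n/n≡m h 2)

      0<s : 0 ℕ.< s
      0<s = ℕ.>-nonZero⁻¹ s

      0<m : 0 ℕ.< m
      0<m = go m p-prime
        where
        go : ∀ m → Prime (suc (m ℕ.* s)) → 0 ℕ.< m
        go zero    1-prime = contradiction 1-prime ¬prime[1]
        go (suc m) _       = s≤s z≤n

      s<p : s ℕ.< p
      s<p = s≤s (ℕ.m≤n*m s m {{ℕ.>-nonZero 0<m}})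

      α≡β^m : α ≡ β ℤ.^ m
      α≡β^m = ≡.cong (β ℤ.^_) (m*n/n≡m m s)

      mod-^ : ∀ x n → x M.^ n ≡ x ℤ.^ n
      mod-^ x zero    = ≡.refl
      mod-^ x (suc n) = ≡.cong (x ℤ.*_) (mod-^ x n)

      α^≡β^ : ∀ k → α M.^ k ≡ₙ β ℤ.^ (m ℕ.* k)
      α^≡β^ k = ≡⇒≡ₙ (≡.trans (mod-^ α k) (≡.trans (≡.cong (ℤ._^ k) α≡β^m) (ℤ.^-*-assoc β m k)))

      αˢ≡1 : α M.^ s ≡ₙ ℤ.1ℤ
      αˢ≡1 = M.trans (α^≡β^ s) (mod (ℤ∣.∣ᵤ⇒∣ (proj₁ β-primitive)))

      -- α is βᵐ, and 0 < m k < m s = p - 1 lies below the order of β.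
      α^≢1 : ∀ k → 0 ℕ.< k → k ℕ.< s → ¬ (α M.^ k ≡ₙ ℤ.1ℤ)
      α^≢1 k 0<k k<s eq = proj₂ β-primitive (m ℕ.* k) (ℕ.*-mono-< 0<m 0<k)
        (ℕ.*-monoʳ-< m {{ℕ.>-nonZero 0<m}} k<s)
        (ℤ∣.∣⇒∣ᵤ {+ p} {β ℤ.^ (m ℕ.* k) ℤ.- ℤ.1ℤ} (_≡ₙ_.difference (M.trans (M.sym (α^≡β^ k)) eq)))

      complement : ∀ {i} → i ℕ.≤ s → α M.^ (s ℕ.∸ i) ℤ.* α M.^ i ≡ₙ ℤ.1ℤ
      complement {i} i≤s = M.trans (M.sym (M.^-homo-* α (s ℕ.∸ i) i))
        (M.trans (M.reflexive (≡.cong (α M.^_) (ℕ.m∸n+n≡m i≤s))) αˢ≡1)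

      α^-injective : ∀ {i j} → i ℕ.< s → j ℕ.< s → α M.^ i ≡ₙ α M.^ j → i ≡ j
      α^-injective {i} {j} i<s j<s eq = ordered (ℕ.<-cmp i j)
        where
        open import Relation.Binary.Definitions using (Tri; tri<; tri≈; tri>)
        distinct : ∀ {i j} → i ℕ.< j → j ℕ.< s → ¬ (α M.^ i ≡ₙ α M.^ j)
        distinct {i} {j} i<j j<s eq = α^≢1 (j ℕ.∸ i) (ℕ.m<n⇒0<n∸m i<j) (ℕ.≤-<-trans (ℕ.m∸n≤m j i) j<s) (begin
          α M.^ (j ℕ.∸ i)
            ≈⟨ M.sym (M.trans (M.*-congʳ (complement i≤s)) (M.*-identityˡ _)) ⟩
          α M.^ (s ℕ.∸ i) ℤ.* α M.^ i ℤ.* α M.^ (j ℕ.∸ i)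
            ≈⟨ M.trans (M.*-assoc (α M.^ (s ℕ.∸ i)) _ _) (M.*-congˡ {α M.^ (s ℕ.∸ i)} (M.trans (M.sym (M.^-homo-* α i (j ℕ.∸ i)))
                 (M.reflexive (≡.cong (α M.^_) (ℕ.m+[n∸m]≡n (ℕ.<⇒≤ i<j)))))) ⟩
          α M.^ (s ℕ.∸ i) ℤ.* α M.^ j
            ≈⟨ M.*-congˡ {α M.^ (s ℕ.∸ i)} (M.sym eq) ⟩
          α M.^ (s ℕ.∸ i) ℤ.* α M.^ i
            ≈⟨ complement i≤s ⟩
          ℤ.1ℤ ∎)
          where
          open M.≈-Reasoning
          i≤s : i ℕ.≤ s
          i≤s = ℕ.<⇒≤ (ℕ.<-trans i<j j<s)
        ordered : Tri (i ℕ.< j) (i ≡ j) (j ℕ.< i) → i ≡ j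
        ordered (tri≈ _ i≡j _) = i≡j
        ordered (tri< i<j _ _) = contradiction eq (distinct i<j j<s)
        ordered (tri> _ _ j<i) = contradiction (M.sym eq) (distinct j<i i<s)

      α⁻¹ : ℤ
      α⁻¹ = α M.^ (s ℕ.∸ 1)

      αα⁻¹≡1 : α ℤ.* α⁻¹ ≡ₙ ℤ.1ℤ
      αα⁻¹≡1 = M.trans (M.reflexive (≡.cong (α M.^_) (ℕ.m+[n∸m]≡n 0<s))) αˢ≡1

      1^ : ∀ n → ℤ.1ℤ M.^ n ≡ₙ ℤ.1ℤ
      1^ zero    = M.refl
      1^ (suc n) = M.trans (M.*-identityˡ _) (1^ n)

      α⁻¹^ : ∀ {i} → i ℕ.≤ s → α⁻¹ M.^ i ≡ₙ α M.^ (s ℕ.∸ i)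
      α⁻¹^ {i} i≤s = begin
        α⁻¹ M.^ i
          ≈⟨ M.sym (M.trans (M.*-congʳ (complement i≤s)) (M.*-identityˡ _)) ⟩
        α M.^ (s ℕ.∸ i) ℤ.* α M.^ i ℤ.* α⁻¹ M.^ i
          ≈⟨ M.trans (M.*-assoc (α M.^ (s ℕ.∸ i)) _ _) (M.*-congˡ {α M.^ (s ℕ.∸ i)}
               (M.trans (M.sym (M.^-distrib-* α α⁻¹ i)) (M.trans (M.^-congˡ i αα⁻¹≡1) (1^ i)))) ⟩
        α M.^ (s ℕ.∸ i) ℤ.* ℤ.1ℤ
          ≈⟨ M.*-identityʳ _ ⟩
        α M.^ (s ℕ.∸ i) ∎
        where open M.≈-Reasoning

      mod-∑ : ∀ {n} (f : Fin n → ℤ) → M.∑ f ≡ₙ ∑ f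
      mod-∑ f = M.trans (M.sym (M.sum≈∑ f)) (≡⇒≡ₙ (ℤᴿ.sum≈∑ f))

      transform-dot : ∀ a i → MP.transform a (α M.^ i) ≡ₙ dot a (μ s α i)
      transform-dot a i = M.trans (mod-∑ _) (≡⇒≡ₙ (≡.trans
        (ℤᴿ.∑-cong λ j → ≡.cong (a j ℤ.*_) (≡.trans (mod-^ _ (toℕ j)) (≡.trans (≡.cong (ℤ._^ toℕ j) (mod-^ α i))
          (≡.trans (ℤ.^-*-assoc α i (toℕ j)) (≡.cong (α ℤ.^_) (ℕ.*-comm i (toℕ j)))))))
        (≡.sym (ℤᴿ.sum≈∑ {s} _))))

      codeword-transform : ∀ (a : Fin s → ℤ) → IsCodeword a → ∀ i → i ℕ.≤ h → MP.transform a (α M.^ i) ≡ₙ ℤ.0ℤ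
      codeword-transform a a∈ i i≤h = M.trans (transform-dot a i)
        (∣⇒≡ₙ0 (ℤ∣.∣ᵤ⇒∣ (a∈ i (≡.subst (i ℕ.≤_) (≡.sym s/2≡h) i≤h))))

      transform-cong : ∀ (a : Fin s → ℤ) {x y} → x ≡ₙ y → MP.transform a x ≡ₙ MP.transform a y
      transform-cong a x≡y = M.∑-cong λ j → M.*-congˡ {a j} (M.^-congˡ (toℕ j) x≡y)

      -- s = 2 h, so i > h gives s - i ≤ h: at least one of the exponents i and - i modulo s is
      -- subject to a code condition.
      conjugate-index : ∀ {i} → i ℕ.< s → i ℕ.≰ h → s ℕ.∸ i ℕ.≤ h
      conjugate-index {i} i<s i≰h = ℕ.≤-trans (ℕ.∸-monoʳ-≤ s (ℕ.<⇒≤ (ℕ.≰⇒> i≰h)))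
        (ℕ.≤-reflexive (≡.trans (≡.cong (ℕ._∸ h) (≡.trans s≡h*2 (≡.trans (ℕ.*-comm h 2) (≡.cong (h ℕ.+_) (ℕ.+-identityʳ h)))))
          (ℕ.m+n∸n≡m h h)))

      p∣⟦⟧ : ∀ n → M.⟦ + n ⟧ ≡ₙ + n
      p∣⟦⟧ zero    = M.refl
      p∣⟦⟧ (suc n) = M.+-congˡ {+ 1} (p∣⟦⟧ n)

    -- The condition at i = 0 pairs a with the vector of ones.
    codeword-sum : ∀ (a : Fin s → ℤ) → IsCodeword a → (+ p) ℤ∣.∣ ∑ a
    codeword-sum a a∈ = ≡ₙ0⇒∣ (M.trans (M.sym (M.trans
        (M.∑-cong λ j → M.trans (M.*-congˡ {a j} (1^ (toℕ j))) (M.*-identityʳ (a j))) (mod-∑ a)))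
      (codeword-transform a a∈ 0 z≤n))

    -- The code is self-orthogonal: by Parseval s Σ aⱼ² = Σ â(αⁱ) â(α⁻ⁱ), and one of i and s - i is at most s / 2.
    codeword-norm : ∀ (a : Fin s → ℤ) → IsCodeword a → (+ p) ℤ∣.∣ ∑ (λ j → a j ℤ.* a j)
    codeword-norm a a∈ = ≡ₙ0⇒∣ (M.trans (M.sym (mod-∑ _)) (≡ₙ-noZeroDivisors p-prime
      (M.trans (M.sym (MP.parseval a αα⁻¹≡1 αˢ≡1 α^-injective (≡ₙ-noZeroDivisors p-prime)))
        (M.Σ<-zero s vanish))
      s≢0))
      where
      s≢0 : ¬ (M.⟦ + s ⟧ ≡ₙ ℤ.0ℤ)
      s≢0 eq = ℕ.>⇒∤ s<p (ℤ∣.∣⇒∣ᵤ (≡ₙ0⇒∣ (M.trans (M.sym (p∣⟦⟧ s)) eq)))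
      vanish : ∀ i → i ℕ.< s → MP.transform a (α M.^ i) ℤ.* MP.transform a (α⁻¹ M.^ i) ≡ₙ ℤ.0ℤ
      vanish i i<s = decide (i ℕ.≤? h)
        where
        decide : Dec (i ℕ.≤ h) → MP.transform a (α M.^ i) ℤ.* MP.transform a (α⁻¹ M.^ i) ≡ₙ ℤ.0ℤ
        decide (yes i≤h) = M.trans (M.*-congʳ (codeword-transform a a∈ i i≤h)) (M.zeroˡ (MP.transform a (α⁻¹ M.^ i)))
        decide (no i≰h)  = M.trans (M.*-congˡ {MP.transform a (α M.^ i)}
          (M.trans (transform-cong a (α⁻¹^ (ℕ.<⇒≤ i<s))) (codeword-transform a a∈ (s ℕ.∸ i) (conjugate-index i<s i≰h))))
          (M.zeroʳ (MP.transform a (α M.^ i)))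

    -- With Σ aⱼ = k p and Σ aⱼ² = n p the form is p² (n - m k²). The cofactor is an integer, and it
    -- is positive because the form is nonnegative and does not vanish at a.
    codeword-Q : ∀ (a : Fin s → ℤ) → IsCodeword a → Q a a ≢ ℤ.0ℤ → + p ℤ.* + p ℤ.≤ Q a a
    codeword-Q a a∈ Q≢0 = bound (codeword-sum a a∈) (codeword-norm a a∈)
      where
      bound : (+ p) ℤ∣.∣ ∑ a → (+ p) ℤ∣.∣ ∑ (λ j → a j ℤ.* a j) → + p ℤ.* + p ℤ.≤ Q a a
      bound (divides k S≡) (divides n T≡) = ≡.subst (+ p ℤ.* + p ℤ.≤_) (≡.sym Q≡)
        (≡.subst (ℤ._≤ (+ p ℤ.* + p) ℤ.* M) (ℤ.*-identityʳ (+ p ℤ.* + p)) (ℤ.*-monoˡ-≤-nonNeg (+ p ℤ.* + p) {{ℤ.nonNegative (square-nonneg (+ p))}} 1≤M))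
        where
        M : ℤ
        M = n ℤ.- + m ℤ.* (k ℤ.* k)
        Q≡ : Q a a ≡ (+ p ℤ.* + p) ℤ.* M
        Q≡ = ≡.trans (≡.cong₂ (λ u v → + p ℤ.* u ℤ.- + m ℤ.* (v ℤ.* v)) T≡ S≡)
          (solve 4 (λ p m n k → p :* (n :* p) :- m :* ((k :* p) :* (k :* p)) := (p :* p) :* (n :- m :* (k :* k))) ≡.refl (+ p) (+ m) n k)
          where open ℤᴿ.Solver
        1≤M : + 1 ℤ.≤ M
        1≤M = by-sign M Q≡
          where
          by-sign : ∀ M → Q a a ≡ (+ p ℤ.* + p) ℤ.* M → + 1 ℤ.≤ M
          by-sign (+ zero)  eq = contradiction (≡.trans eq (ℤ.*-zeroʳ (+ p ℤ.* + p))) Q≢0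
          by-sign (+ suc n) eq = ℤ.+≤+ (s≤s z≤n)
          by-sign -[1+ n ]  eq = contradiction (≡.subst (ℤ.0ℤ ℤ.≤_) eq (Q-nonneg a)) λ ()

    -- Multiples of p in the first D = s/2 + 1 coordinates, and the polynomials
    -- (X - 1)(X - α) ⋯ (X - αᵏ⁻¹) for D ≤ k < s, generate a sublattice of index p ^ D.
    private
      D : ℕ
      D = suc h

    generator : Fin s → Fin s → ℤ
    generator k j with toℕ k ℕ.<? D
    ... | yes _ = + p ℤ.* δ k j
    ... | no  _ = ℤˢ.fromRoots (α ℤ.^_) (toℕ k) (toℕ j)

    generator-lower : ∀ k j → k Fin.< j → generator k j ≡ ℤ.0ℤ
    generator-lower k j k<j with toℕ k ℕ.<? D
    ... | yes _ = ≡.trans (≡.cong (+ p ℤ.*_) (δ-≢ (Fin.<⇒≢ k<j))) (ℤ.*-zeroʳ (+ p))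
    ... | no  _ = ℤˢ.fromRoots-degree (α ℤ.^_) (toℕ k) (toℕ j) k<j

    private
      diagonal : ℕ → ℤ
      diagonal k with k ℕ.<? D
      ... | yes _ = + p
      ... | no  _ = + 1

    generator-diagonal : ∀ k → generator k k ≡ diagonal (toℕ k)
    generator-diagonal k with toℕ k ℕ.<? D
    ... | yes _ = ≡.trans (≡.cong (+ p ℤ.*_) (δ-refl k)) (ℤ.*-identityʳ (+ p))
    ... | no  _ = ℤˢ.fromRoots-monic (α ℤ.^_) (toℕ k)

    -- The rows of index below D are multiples of p. For k ≥ D the polynomial has αⁱ among its roots
    -- for every i ≤ h < k, so the dot product is zero already in ℤ.
    generator-codeword : ∀ k → IsCodeword (generator k)
    generator-codeword k i i≤s/2 with toℕ k ℕ.<? D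
    ... | yes _ = ℤ∣.∣⇒∣ᵤ {+ p} {dot (λ j → + p ℤ.* δ k j) (μ s α i)}
        (divides (∑ λ j → δ k j ℤ.* μ s α i j) (≡.trans (ℤᴿ.sum≈∑ {s} _)
          (≡.trans (ℤᴿ.∑-cong λ j → ℤ.*-assoc (+ p) (δ k j) (μ s α i j))
            (≡.trans (ℤᴿ.∑-*ˡ (+ p) _) (ℤ.*-comm (+ p) _)))))
    ... | no k≮D = ℤ∣.∣⇒∣ᵤ {+ p} {dot (λ j → ℤˢ.fromRoots (α ℤ.^_) (toℕ k) (toℕ j)) (μ s α i)}
        (≡.subst ((+ p) ℤ∣.∣_) (≡.sym dot≡0) (divides ℤ.0ℤ ≡.refl))
      where
      i<k : i ℕ.< toℕ k
      i<k = ℕ.≤-trans (s≤s (≡.subst (i ℕ.≤_) s/2≡h i≤s/2)) (ℕ.≮⇒≥ k≮D)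
      int-^ : ∀ x n → x ℤᴿ.^ n ≡ x ℤ.^ n
      int-^ x zero    = ≡.refl
      int-^ x (suc n) = ≡.cong (x ℤ.*_) (int-^ x n)
      dot≡0 : dot (λ j → ℤˢ.fromRoots (α ℤ.^_) (toℕ k) (toℕ j)) (μ s α i) ≡ ℤ.0ℤ
      dot≡0 = ≡.trans (ℤᴿ.sum≈∑ {s} _) (≡.trans
        (ℤᴿ.∑-cong λ j → ≡.cong (ℤˢ.fromRoots (α ℤ.^_) (toℕ k) (toℕ j) ℤ.*_)
          (≡.sym (≡.trans (int-^ _ (toℕ j)) (≡.trans (ℤ.^-*-assoc α i (toℕ j)) (≡.cong (α ℤ.^_) (ℕ.*-comm i (toℕ j)))))))
        (≡.trans (≡.sym (ℤˢ.Σ<≈∑ s _)) (ℤˢ.fromRoots-root (α ℤ.^_) (toℕ k) s (Fin.toℕ<n k) i i<k (α ℤ.^ i) ≡.refl)))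

    private
      prod-diagonal : ∀ (d : ℕ → ℤ) D n → D ℕ.≤ n → (∀ k → k ℕ.< D → d k ≡ + p) →
                      (∀ k → D ℕ.≤ k → d k ≡ + 1) → ℤᴰ.prod d n ≡ + (p ℕ.^ D)
      prod-diagonal d zero    zero    _         _  _  = ≡.refl
      prod-diagonal d zero    (suc n) _         d< d≥ = ≡.trans (≡.cong₂ ℤ._*_ (d≥ 0 z≤n)
        (prod-diagonal (d ∘ suc) zero n z≤n (λ _ ()) (λ k _ → d≥ (suc k) z≤n))) ≡.refl
      prod-diagonal d (suc D) (suc n) (s≤s D≤n) d< d≥ = ≡.trans (≡.cong₂ ℤ._*_ (d< 0 (s≤s z≤n))
        (prod-diagonal (d ∘ suc) D n D≤n (λ k k<D → d< (suc k) (s≤s k<D)) (λ k D≤k → d≥ (suc k) (s≤s D≤k))))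
        (≡.sym (ℤ.pos-* p (p ℕ.^ D)))

      diagonal-< : ∀ k → k ℕ.< D → diagonal k ≡ + p
      diagonal-< k k<D with k ℕ.<? D
      ... | yes _  = ≡.refl
      ... | no k≮D = contradiction k<D k≮D

      diagonal-≥ : ∀ k → D ℕ.≤ k → diagonal k ≡ + 1
      diagonal-≥ k D≤k with k ℕ.<? D
      ... | yes k<D = contradiction D≤k (ℕ.<⇒≱ k<D)
      ... | no _    = ≡.refl

      D≤s : D ℕ.≤ s
      D≤s = ≡.subst (D ℕ.≤_) (≡.sym s≡h*2) (positive h (≡.subst (0 ℕ.<_) s≡h*2 0<s))
        where
        positive : ∀ h → 0 ℕ.< h ℕ.* 2 → suc h ℕ.≤ h ℕ.* 2
        positive (suc h) _ = s≤s (s≤s (ℕ.m≤m*n h 2))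

      prod-generator : ℤᴰ.prod diagonal s ≡ + (p ℕ.^ D)
      prod-generator = prod-diagonal diagonal D s D≤s diagonal-< diagonal-≥

      p^-nonZero : ∀ n → NonZero (p ℕ.^ n)
      p^-nonZero n = ℕ.m^n≢0 p n

    -- det E det A is the determinant of the triangular `generator`, whose diagonal consists of D
    -- entries p followed by ones.
    det-basis-bound : ∀ (E A : Fin s → Fin s → ℤ) → (∀ k j → generator k j ≡ ∑ λ l → E k l ℤ.* A l j) →
                      ℤ.∣ ℤᴿ.det A ∣ ℕ.≤ p ℕ.^ D
    det-basis-bound E A C≡EA = factor-bound {ℤᴿ.det E} (p ℕ.^ D) {{p^-nonZero D}} (≡.trans (≡.sym (ℤᴰ.det-* E A))
      (≡.trans (ℤᴰ.det-cong _ generator λ k j → ≡.sym (C≡EA k j))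
        (≡.trans (ℤᴰ.det-lower generator diagonal generator-lower generator-diagonal) prod-generator)))

    -- The same factorisation read transposed, where `generator` becomes upper triangular. This
    -- takes the place of invariance of the determinant under transposition.
    det-basisᵀ-bound : ∀ (E A : Fin s → Fin s → ℤ) → (∀ k j → generator k j ≡ ∑ λ l → E k l ℤ.* A l j) →
                       ℤ.∣ ℤᴿ.det (λ i j → A j i) ∣ ℕ.≤ p ℕ.^ D
    det-basisᵀ-bound E A C≡EA = factor-bound {ℤᴿ.det (λ i j → E j i)} (p ℕ.^ D) {{p^-nonZero D}}
      (≡.trans (ℤ.*-comm (ℤᴿ.det (λ i j → E j i)) (ℤᴿ.det (λ i j → A j i)))
      (≡.trans (≡.sym (ℤᴰ.det-* (λ i j → A j i) (λ i j → E j i)))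
      (≡.trans (ℤᴰ.det-cong _ (λ i j → generator j i) λ k j → ≡.trans
          (ℤᴿ.∑-cong λ l → ℤ.*-comm (A l k) (E j l)) (≡.sym (C≡EA j k)))
        (≡.trans (ℤᴰ.det-upper (λ i j → generator j i) diagonal (λ i j j<i → generator-lower j i j<i) generator-diagonal)
          prod-generator))))

    private
      -- Row operations that triangularise `G`. The columns of `G` sum to p - s m = 1, so row 0 of
      -- the product consists of ones, and adding m times it to row i of `G` leaves p times a unit
      -- vector.
      V : Fin s → Fin s → ℤ
      V i j = row (toℕ i)
        where
        row : ℕ → ℤ
        row zero    = + 1
        row (suc _) = δ i j ℤ.+ + m

      T : Fin s → Fin s → ℤ
      T i j = row (toℕ i)
        where
        row : ℕ → ℤ
        row zero    = + 1
        row (suc _) = + p ℤ.* δ i j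

      column-sum : ∀ k → ∑ (λ j → G j k) ≡ + 1
      column-sum k = begin
        ∑ (λ j → + p ℤ.* δ j k ℤ.- + m)
          ≡⟨ ≡.trans (ℤᴿ.∑-+ _ _) (≡.cong₂ ℤ._+_ (∑-δʳ (λ _ → + p) k) (≡.trans (ℤᴿ.∑-const s (ℤ.- + m)) (≡.cong (ℤ._* ℤ.- + m) (⟦⟧-ℤ s)))) ⟩
        + p ℤ.+ + s ℤ.* (ℤ.- + m)
          ≡⟨ ≡.cong (λ q → (+ 1 ℤ.+ q) ℤ.+ + s ℤ.* (ℤ.- + m)) (ℤ.pos-* m s) ⟩
        (+ 1 ℤ.+ + m ℤ.* + s) ℤ.+ + s ℤ.* (ℤ.- + m)
          ≡⟨ solve 2 (λ m s → (con (+ 1) :+ m :* s) :+ s :* (:- m) := con (+ 1)) ≡.refl (+ m) (+ s) ⟩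
        + 1 ∎
        where
        open ≡-Reasoning
        open ℤᴿ.Solver
        ⟦⟧-ℤ : ∀ n → ℤᴿ.⟦ + n ⟧ ≡ + n
        ⟦⟧-ℤ zero    = ≡.refl
        ⟦⟧-ℤ (suc n) = ≡.cong (λ k → + 1 ℤ.+ k) (⟦⟧-ℤ n)

      VG≡T : ∀ i k → ∑ (λ j → V i j ℤ.* G j k) ≡ T i k
      VG≡T i k with toℕ i
      ... | zero  = ≡.trans (ℤᴿ.∑-cong λ j → ℤ.*-identityˡ (G j k)) (column-sum k)
      ... | suc _ = begin
        ∑ (λ j → (δ i j ℤ.+ + m) ℤ.* G j k)
          ≡⟨ ≡.trans (ℤᴿ.∑-cong λ j → ℤ.*-distribʳ-+ (G j k) (δ i j) (+ m)) (ℤᴿ.∑-+ _ _) ⟩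
        ∑ (λ j → δ i j ℤ.* G j k) ℤ.+ ∑ (λ j → + m ℤ.* G j k)
          ≡⟨ ≡.cong₂ ℤ._+_ (∑-δˡ (λ j → G j k) i) (≡.trans (ℤᴿ.∑-*ˡ (+ m) _) (≡.cong (+ m ℤ.*_) (column-sum k))) ⟩
        (+ p ℤ.* δ i k ℤ.- + m) ℤ.+ + m ℤ.* + 1
          ≡⟨ solve 2 (λ x m → (x :- m) :+ m :* con (+ 1) := x) ≡.refl (+ p ℤ.* δ i k) (+ m) ⟩
        + p ℤ.* δ i k ∎
        where
        open ≡-Reasoning
        open ℤᴿ.Solver

      T-upper : ∀ i j → j Fin.< i → T i j ≡ ℤ.0ℤ
      T-upper i j j<i with toℕ i | ℕ.≤-<-trans z≤n j<i
      ... | suc _ | _ = ≡.trans (≡.cong (+ p ℤ.*_) (δ-≢ λ i≡j → Fin.<⇒≢ j<i (≡.sym i≡j))) (ℤ.*-zeroʳ (+ p))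

      T-diagonal : ℕ → ℤ
      T-diagonal zero    = + 1
      T-diagonal (suc _) = + p

      T-diagonal≡ : ∀ i → T i i ≡ T-diagonal (toℕ i)
      T-diagonal≡ i with toℕ i
      ... | zero  = ≡.refl
      ... | suc _ = ≡.trans (≡.cong (+ p ℤ.*_) (δ-refl i)) (ℤ.*-identityʳ (+ p))

      prod-T : ∀ s → 0 ℕ.< s → ℤᴰ.prod T-diagonal s ≡ + (p ℕ.^ (s ℕ.∸ 1))
      prod-T (suc n) _ = ≡.trans (ℤ.*-identityˡ _) (prod-const n)
        where
        prod-const : ∀ n → ℤᴰ.prod (λ _ → + p) n ≡ + (p ℕ.^ n)
        prod-const zero    = ≡.refl
        prod-const (suc n) = ≡.trans (≡.cong (+ p ℤ.*_) (prod-const n)) (≡.sym (ℤ.pos-* p (p ℕ.^ n)))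

      det-G-bound : ℤ.∣ ℤᴿ.det G ∣ ℕ.≤ p ℕ.^ (s ℕ.∸ 1)
      det-G-bound = factor-bound {ℤᴿ.det V} (p ℕ.^ (s ℕ.∸ 1)) {{p^-nonZero (s ℕ.∸ 1)}}
        (≡.trans (≡.sym (ℤᴰ.det-* V G)) (≡.trans (ℤᴰ.det-cong _ T VG≡T)
          (≡.trans (ℤᴰ.det-upper T T-diagonal T-upper T-diagonal≡) (prod-T s 0<s))))

    -- The matrix of the form on the rows of A is A G Aᵀ. The three bounds multiply to the exponent
    -- D + (s - 1) + D, which is 2 s + 1 because 2 D = s + 2.
    det-form-bound : ∀ (E A : Fin s → Fin s → ℤ) → (∀ k j → generator k j ≡ ∑ λ l → E k l ℤ.* A l j) →
                     ℤᴿ.det (λ i j → Q (A i) (A j)) ℤ.≤ + ((p ℕ.* p) ℕ.^ s ℕ.* p)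
    det-form-bound E A C≡EA = ℤ.≤-trans (i≤∣i∣ _) (ℤ.+≤+ (ℕ.≤-trans (ℕ.≤-reflexive abs-det)
      (ℕ.≤-trans (ℕ.*-mono-≤ (det-basis-bound E A C≡EA) (ℕ.*-mono-≤ det-G-bound (det-basisᵀ-bound E A C≡EA)))
        (ℕ.≤-reflexive exponents))))
      where
      i≤∣i∣ : ∀ i → i ℤ.≤ + ℤ.∣ i ∣
      i≤∣i∣ (+ n)    = ℤ.≤-refl
      i≤∣i∣ -[1+ n ] = ℤ.-≤+
      abs-det : ℤ.∣ ℤᴿ.det (λ i j → Q (A i) (A j)) ∣ ≡
                ℤ.∣ ℤᴿ.det A ∣ ℕ.* (ℤ.∣ ℤᴿ.det G ∣ ℕ.* ℤ.∣ ℤᴿ.det (λ i j → A j i) ∣)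
      abs-det = begin
        ℤ.∣ ℤᴿ.det (λ i j → Q (A i) (A j)) ∣
          ≡⟨ ≡.cong ℤ.∣_∣ (≡.trans (ℤᴰ.det-cong _ _ λ i j → Q-matrix (A i) (A j)) (≡.trans
               (ℤᴰ.det-* A (λ l j → ∑ λ k → G l k ℤ.* A j k))
               (≡.cong (ℤᴿ.det A ℤ.*_) (ℤᴰ.det-* G (λ k j → A j k))))) ⟩
        ℤ.∣ ℤᴿ.det A ℤ.* (ℤᴿ.det G ℤ.* ℤᴿ.det (λ i j → A j i)) ∣
          ≡⟨ ≡.trans (ℤ.abs-* (ℤᴿ.det A) _) (≡.cong (ℤ.∣ ℤᴿ.det A ∣ ℕ.*_) (ℤ.abs-* (ℤᴿ.det G) _)) ⟩
        ℤ.∣ ℤᴿ.det A ∣ ℕ.* (ℤ.∣ ℤᴿ.det G ∣ ℕ.* ℤ.∣ ℤᴿ.det (λ i j → A j i) ∣) ∎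
        where open ≡-Reasoning
      exponents : p ℕ.^ D ℕ.* (p ℕ.^ (s ℕ.∸ 1) ℕ.* p ℕ.^ D) ≡ (p ℕ.* p) ℕ.^ s ℕ.* p
      exponents = begin
        p ℕ.^ D ℕ.* (p ℕ.^ (s ℕ.∸ 1) ℕ.* p ℕ.^ D)
          ≡⟨ ≡.cong (p ℕ.^ D ℕ.*_) (≡.sym (ℕ.^-distribˡ-+-* p (s ℕ.∸ 1) D)) ⟩
        p ℕ.^ D ℕ.* p ℕ.^ (s ℕ.∸ 1 ℕ.+ D)
          ≡⟨ ℕ.^-distribˡ-+-* p D (s ℕ.∸ 1 ℕ.+ D) ⟨
        p ℕ.^ (D ℕ.+ (s ℕ.∸ 1 ℕ.+ D))
          ≡⟨ ≡.cong (p ℕ.^_) exponent ⟩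
        p ℕ.^ (2 ℕ.* s ℕ.+ 1)
          ≡⟨ ℕ.^-distribˡ-+-* p (2 ℕ.* s) 1 ⟩
        p ℕ.^ (2 ℕ.* s) ℕ.* p ℕ.^ 1
          ≡⟨ ≡.cong₂ ℕ._*_ (≡.trans (≡.sym (ℕ.^-*-assoc p 2 s)) (≡.cong (ℕ._^ s) (≡.cong (p ℕ.*_) (ℕ.*-identityʳ p)))) (ℕ.*-identityʳ p) ⟩
        (p ℕ.* p) ℕ.^ s ℕ.* p ∎
        where
        open ≡-Reasoning
        exponent : D ℕ.+ (s ℕ.∸ 1 ℕ.+ D) ≡ 2 ℕ.* s ℕ.+ 1
        exponent = begin
          suc (h ℕ.+ (s ℕ.∸ 1 ℕ.+ suc h))   ≡⟨ ≡.cong (λ k → suc (h ℕ.+ k)) (≡.trans (ℕ.+-suc (s ℕ.∸ 1) h) (≡.cong (ℕ._+ h) (ℕ.m+[n∸m]≡n 0<s))) ⟩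
          suc (h ℕ.+ (s ℕ.+ h))             ≡⟨ ≡.cong suc (≡.trans (≡.cong (h ℕ.+_) (ℕ.+-comm s h)) (≡.sym (ℕ.+-assoc h h s))) ⟩
          suc (h ℕ.+ h ℕ.+ s)               ≡⟨ ≡.cong (λ k → suc (k ℕ.+ s)) h+h≡s ⟩
          suc (s ℕ.+ s)                     ≡⟨ ≡.trans (≡.cong suc (≡.cong (s ℕ.+_) (≡.sym (ℕ.+-identityʳ s)))) (ℕ.+-comm 1 _) ⟩
          2 ℕ.* s ℕ.+ 1                     ∎
          where
          h+h≡s : h ℕ.+ h ≡ s
          h+h≡s = ≡.trans (≡.cong (h ℕ.+_) (≡.sym (ℕ.+-identityʳ h))) (≡.trans (ℕ.*-comm 2 h) (≡.sym s≡h*2))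

open IntegerCodes using (module ℤᴿ; δ; δ-refl; δ-≢; module TraceForm; module CodeLattice)
open ℤᴿ using () renaming (∑ to ∑ℤ)

-- From the trace form to the center density

module CodeLatticeDensity {c ℓ₁ ℓ₂} (ℝ : Reals c ℓ₁ ℓ₂) (s m : ℕ) .{{_ : NonZero s}}
  (p-prime : Prime (suc (m ℕ.* s))) (2∣s : 2 ℕ.∣ s)
  (β : ℤ) (β-primitive : IsPrimitiveRootMod (suc (m ℕ.* s)) β) where
  open RealTools ℝ
  open TraceForm s m
  open CodeLattice s m p-prime 2∣s β β-primitive
  open Determinant commutativeRing using (det-cong; det-scale)
  open DeterminantHomomorphism commutativeRing using (det-homo)
  private
    p : ℕ
    p = suc (m ℕ.* s)

  -- The interface between arithmetic and geometry: `Φ` places coordinate vectors in space, and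
  -- `suc k` is 1 or 2 according to whether K is real. Injectivity of `Φ` follows from definiteness
  -- of `Q`.
  record IsCodeLattice {ℓ n} (Λ : Pred (Vector Carrier n) ℓ) (k : ℕ) (Φ : (Fin s → ℤ) → Vector Carrier n) :
                       Set (c ⊔ ℓ₁ ⊔ ℓ) where
    open Lattice ℝ {n}
    field
      form       : ∀ a b → ⟦ + suc k ⟧ * ⟨ Φ a , Φ b ⟩ ≈ ⟦ Q a b ⟧
      member     : ∀ v → v ∈ Λ → Σ (Fin s → ℤ) λ a → IsCodeword a × v ≋ Φ a
      codeword∈  : ∀ a → IsCodeword a → Φ a ∈ Λ
      Φ-cong     : ∀ {a b} → (∀ i → a i ≡ b i) → Φ a ≋ Φ b
      Φ-additive : ∀ {r} (d : Vector ℤ r) (A : Fin r → Fin s → ℤ) →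
                   ℤ-combination d (Φ ∘ A) ≋ Φ (λ i → ∑ℤ λ j → d j ℤ.* A j i)

  -- The minimal vector is a codeword, which bounds ρ; expanding the generators in the given basis
  -- supplies the integer matrix that bounds the volume. The ambient dimension r₁ + 2 r₂ equals s
  -- only propositionally, hence the separate n.
  density : ∀ {ℓ n} → n ≡ s → {Λ : Pred (Vector Carrier n) ℓ} (k : ℕ) {Φ : (Fin s → ℤ) → Vector Carrier n} →
    IsCodeLattice Λ k Φ → ∀ δ → Lattice.IsCenterDensity ℝ Λ δ →
    ∀ √p → IsSqrt (p ·ℕ 1#) √p → ∀ b → IsQuotient 1# ((2 ·ℕ 1#) ^ s * √p) b → b ≤ δ
  density ≡.refl {Λ} k {Φ} isCodeLattice δ
    (ρ , vol , ((v , v∈ , v≉0 , 0≤X , X²≈) , _) , (B , (B∈ , B-spans , _) , (0≤vol , vol²≈)) , quotient)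
    √p √p-sqrt b b-quotient =
    density-bound s p k 0≤X minimum 0≤vol determinant quotient √p-sqrt b-quotient
    where
    open IsCodeLattice isCodeLattice
    open Lattice ℝ {s}
    open ≈-Reasoning
    K P : Carrier
    K = ⟦ + suc k ⟧
    P = ⟦ + p ⟧

    ⟨⟩-cong : ∀ {v v′ w w′} → v ≋ v′ → w ≋ w′ → ⟨ v , w ⟩ ≈ ⟨ v′ , w′ ⟩
    ⟨⟩-cong {v} {v′} {w} {w′} v≋ w≋ = trans (sum≈∑ (λ i → v i * w i))
      (trans (∑-cong λ i → *-cong (v≋ i) (w≋ i)) (sym (sum≈∑ (λ i → v′ i * w′ i))))

    ⟦⟧-injective : ∀ {a b} → ⟦ a ⟧ ≈ ⟦ b ⟧ → a ≡ b
    ⟦⟧-injective {a} {b} eq = ℤ.i-j≡0⇒i≡j a b (⟦⟧-injective-0 (a ℤ.- b)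
      (trans (⟦⟧-homo-+ a (ℤ.- b)) (trans (+-cong eq (⟦⟧-homo-- b)) (-‿inverseʳ _))))

    -- Equal images pair equally with every vector, so the form vanishes at a - b. This pulls
    -- expansions in the basis back to coordinates.
    Φ-injective : ∀ {a b} → Φ a ≋ Φ b → ∀ i → a i ≡ b i
    Φ-injective {a} {b} Φa≋Φb i = ℤ.i-j≡0⇒i≡j (a i) (b i) (Q-definite (λ i → a i ℤ.- b i) Q≡0 i)
      where
      same : ∀ c → Q a c ≡ Q b c
      same c = ⟦⟧-injective (trans (sym (form a c)) (trans (*-congˡ (⟨⟩-cong Φa≋Φb λ _ → refl)) (form b c)))
      Q≡0 : Q (λ i → a i ℤ.- b i) (λ i → a i ℤ.- b i) ≡ ℤ.0ℤ
      Q≡0 = ≡.trans (Q-difference a b) (≡.cong₂ ℤ._-_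
        (≡.trans (≡.cong (ℤ._- Q b a) (same a)) (ℤ.+-inverseʳ (Q b a)))
        (≡.trans (≡.cong (ℤ._- Q b b) (same b)) (ℤ.+-inverseʳ (Q b b))))

    minimum : P * P ≤ K * ((ρ + ρ) * (ρ + ρ))
    minimum = bound (member v v∈)
      where
      bound : (Σ (Fin s → ℤ) λ a → IsCodeword a × v ≋ Φ a) → P * P ≤ K * ((ρ + ρ) * (ρ + ρ))
      bound (a , a∈ , v≋Φa) = ≤-resp (⟦⟧-homo-* (+ p) (+ p))
        (sym (trans (*-congˡ (trans X²≈ (⟨⟩-cong v≋Φa v≋Φa))) (form a a)))
        -- If the form vanished at a, then a would be zero; `Φ` of zero is an empty combination, so
        -- v would be zero.
        (⟦⟧-mono-≤ (codeword-Q a a∈ λ Q≡0 → v≉0 λ i → trans (v≋Φa i)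
          (trans (Φ-cong (λ i → ≡.trans (Q-definite a Q≡0 i) (≡.sym (ℤᴿ.∑-empty _))) i)
            (sym (Φ-additive {0} (λ ()) (λ ()) i)))))

    A : Fin s → Fin s → ℤ
    A j = proj₁ (member (B j) (B∈ j))

    B≋ΦA : ∀ j → B j ≋ Φ (A j)
    B≋ΦA j = proj₂ (proj₂ (member (B j) (B∈ j)))

    E : Fin s → Fin s → ℤ
    E k = proj₁ (B-spans _ (codeword∈ (generator k) (generator-codeword k)))

    generator≡EA : ∀ k j → generator k j ≡ ∑ℤ λ l → E k l ℤ.* A l j
    generator≡EA k = Φ-injective λ i → begin
      Φ (generator k) i                    ≈⟨ proj₂ (B-spans _ (codeword∈ (generator k) (generator-codeword k))) i ⟩
      ℤ-combination (E k) B i              ≈⟨ trans (sum≈∑ (λ j → E k j ·ℤ B j i)) (trans (∑-cong λ j →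
                                                trans (·ℤ-* (E k j) _) (trans (*-congˡ (B≋ΦA j i)) (sym (·ℤ-* (E k j) _))))
                                                (sym (sum≈∑ (λ j → E k j ·ℤ Φ (A j) i)))) ⟩
      ℤ-combination (E k) (Φ ∘ A) i        ≈⟨ Φ-additive (E k) A i ⟩
      Φ (λ i → ∑ℤ λ j → E k j ℤ.* A j i) i ∎

    determinant : K ^ s * (vol * vol) ≤ (P * P) ^ s * P
    determinant = ≤-resp (sym (begin
        K ^ s * (vol * vol)                       ≈⟨ *-congˡ vol²≈ ⟩
        K ^ s * det (gram B)                      ≈⟨ det-scale K (gram B) ⟨
        det (λ i j → K * gram B i j)              ≈⟨ det-cong (λ i j → K * gram B i j) (λ i j → ⟦ Q (A i) (A j) ⟧)
                                                       (λ i j → trans (*-congˡ (⟨⟩-cong (B≋ΦA i) (B≋ΦA j))) (form (A i) (A j))) ⟩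
        det (λ i j → ⟦ Q (A i) (A j) ⟧)           ≈⟨ det-homo (λ i j → Q (A i) (A j)) ⟨
        ⟦ ℤᴿ.det (λ i j → Q (A i) (A j)) ⟧        ∎))
      (begin
        ⟦ + ((p ℕ.* p) ℕ.^ s ℕ.* p) ⟧             ≈⟨ trans (⟦⟧-cong (ℤ.pos-* ((p ℕ.* p) ℕ.^ s) p)) (⟦⟧-homo-* (+ ((p ℕ.* p) ℕ.^ s)) (+ p)) ⟩
        ⟦ + ((p ℕ.* p) ℕ.^ s) ⟧ * P               ≈⟨ *-congʳ (trans (⟦⟧-^ (p ℕ.* p) s) (^-congˡ s (trans (⟦⟧-cong (ℤ.pos-* p p)) (⟦⟧-homo-* (+ p) (+ p))))) ⟩
        (P * P) ^ s * P                           ∎)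
      (⟦⟧-mono-≤ (det-form-bound E A generator≡EA))

injective⇒permutation′ : ∀ {m n} → n ℕ.≤ m → (f : Fin m → Fin n) → Injective _≡_ _≡_ f →
                         Σ (Permutation m n) λ π → ∀ i → π ⟨$⟩ʳ i ≡ f i
injective⇒permutation′ n≤m f inj = go (ℕ.≤-antisym (Fin.injective⇒≤ inj) n≤m) f inj
  where
  go : ∀ {m n} → m ≡ n → (f : Fin m → Fin n) → Injective _≡_ _≡_ f →
       Σ (Permutation m n) λ π → ∀ i → π ⟨$⟩ʳ i ≡ f i
  go ≡.refl = injective⇒permutation

-- Inner products of concatenated vectors

module CanonicalDot {c ℓ₁ ℓ₂} (ℝ : Reals c ℓ₁ ℓ₂) where
  open RealTools ℝ

  ∑-↑ : ∀ m n (f : Fin (m ℕ.+ n) → Carrier) → ∑ f ≈ ∑ (λ i → f (i ↑ˡ n)) + ∑ (λ j → f (m ↑ʳ j))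
  ∑-↑ zero    n f = sym (trans (+-congʳ (∑-empty _)) (+-identityˡ _))
  ∑-↑ (suc m) n f = trans (∑-suc f) (trans (+-congˡ (∑-↑ m n (f ∘ suc)))
    (trans (sym (+-assoc _ _ _)) (+-congʳ (sym (∑-suc _)))))

  ∑-++ : ∀ {a} {A : Set a} {m n} (g : A → A → Carrier) (v v′ : Vector A m) (w w′ : Vector A n) →
         ∑ (λ i → g ((v ++ w) i) ((v′ ++ w′) i)) ≈ ∑ (λ i → g (v i) (v′ i)) + ∑ (λ j → g (w j) (w′ j))
  ∑-++ {m = m} {n} g v v′ w w′ = trans (∑-↑ m n _) (+-cong
    (∑-cong λ i → reflexive (≡.cong (λ z → g ([ v , w ] z) ([ v′ , w′ ] z)) (Fin.splitAt-↑ˡ m i n)))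
    (∑-cong λ j → reflexive (≡.cong (λ z → g ([ v , w ] z) ([ v′ , w′ ] z)) (Fin.splitAt-↑ʳ m n j))))

  ∑-concat : ∀ {a} {A : Set a} m n (g : A → A → Carrier) (v v′ : Vector (Vector A m) n) →
             ∑ (λ i → g (concat v i) (concat v′ i)) ≈ ∑ λ j → ∑ λ k → g (v j k) (v′ j k)
  ∑-concat m zero    g v v′ = trans (∑-empty _) (sym (∑-empty _))
  ∑-concat m (suc n) g v v′ = trans (∑-↑ m (n ℕ.* m) _) (trans (+-cong
      (∑-cong λ i → reflexive (≡.cong (at ∘ index) (Fin.splitAt-↑ˡ m i (n ℕ.* m))))
      (trans (∑-cong λ j → reflexive (≡.cong (at ∘ index) (Fin.splitAt-↑ʳ m (n ℕ.* m) j)))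
        (∑-concat m n g (v ∘ suc) (v′ ∘ suc))))
    (sym (∑-suc _)))
    where
    at : Fin m × Fin (suc n) → Carrier
    at z = g (uncurry (flip v) z) (uncurry (flip v′) z)
    index : Fin m ⊎ Fin (n ℕ.* m) → Fin m × Fin (suc n)
    index = [ (λ i → i , zero) , (λ j → proj₁ (quotRem {n} m j) , suc (proj₂ (quotRem {n} m j))) ]

-- Bundling the data keeps the parameters of the definitions below, and so their types, small.
record CyclotomicData c ℓ₁ ℓ₂ : Set (lsuc (c ⊔ ℓ₁ ⊔ ℓ₂)) where
  field
    L               : Extensionℚ c ℓ₁ ℓ₂
    s m             : ℕ
    {{s-nonZero}}   : NonZero s
    p-prime         : Prime (suc (m ℕ.* s))
    ζ               : Extensionℚ.Carrier L
    ζ-primitive     : FieldTheory.IsPrimitiveRootOfUnity L (suc (m ℕ.* s)) ζ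
    ζ-generates     : ∀ x → FieldTheory.ℚ⟨_⟩ L ζ x
    u               : ℤ
    u-generates     : GeneratesUnits (suc (m ℕ.* s)) u
    σ               : Extensionℚ.Carrier L → Extensionℚ.Carrier L
    σ-automorphism  : FieldTheory.IsAutomorphism L σ
    σζ              : FieldTheory.IsPower L ζ u (σ ζ)

-- The cyclotomic field, its automorphisms and its trace

module CyclotomicField {c ℓ₁ ℓ₂} (D : CyclotomicData c ℓ₁ ℓ₂) where
  open CyclotomicData D

  N : ℕ
  N = m ℕ.* s

  R : CommutativeRing c ℓ₁
  R = Extensionℚ.commutativeRing L

  open RingTools R
  open RangeSums R
  open ExtensionTools L
  open HeytingTools heytingField
  open FieldTheory L
  open Congruence (suc N)
  open RootOfUnity L N ζ ζ-primitive
  open Iterate R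
  open RingMorphisms rawRing rawRing using (IsRingHomomorphism)
  private
    module ModRing = RingTools modRing
    module End = Homomorphism R R
    module ℚᴿ = RingTools ℚ.+-*-commutativeRing

  p : ℕ
  p = suc N

  0<N : 0 ℕ.< N
  0<N = positive N p-prime
    where
    positive : ∀ N → Prime (suc N) → 0 ℕ.< N
    positive zero    1-prime = contradiction 1-prime ¬prime[1]
    positive (suc N) _       = s≤s z≤n

  σ-isHom : IsRingHomomorphism σ
  σ-isHom = RingMorphisms.IsRingIsomorphism.isRingHomomorphism σ-automorphism
  module σ = IsRingHomomorphism σ-isHom

  σ-injective : ∀ {x y} → σ x ≈ σ y → x ≈ y
  σ-injective = RingMorphisms.IsRingIsomorphism.injective σ-automorphism

  σ^ : ℕ → Carrier → Carrier
  σ^ k x = fold x σ k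

  σ^-isHom : ∀ k → IsRingHomomorphism (σ^ k)
  σ^-isHom = iterate-isHom σ-isHom
  module σ^ (k : ℕ) = IsRingHomomorphism (σ^-isHom k)

  -- Homomorphisms preserve inverses, so they are determined by the image of ζ.
  hom-unique : ∀ {f g} → IsRingHomomorphism f → IsRingHomomorphism g → f ζ ≈ g ζ → ∀ x → f x ≈ g x
  hom-unique {f} {g} f-isHom g-isHom fζ≈gζ x = agree (ζ-generates x)
    where
    module f = IsRingHomomorphism f-isHom
    module g = IsRingHomomorphism g-isHom
    agree : ∀ {x} → x ∈ ℚ⟨ ζ ⟩ → f x ≈ g x
    agree gen         = fζ≈gζ
    agree (rat q)     = trans (hom-ι f-isHom q) (sym (hom-ι g-isHom q))
    agree (add x∈ y∈) = trans (f.+-homo _ _) (trans (+-cong (agree x∈) (agree y∈)) (sym (g.+-homo _ _)))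
    agree (mul x∈ y∈) = trans (f.*-homo _ _) (trans (*-cong (agree x∈) (agree y∈)) (sym (g.*-homo _ _)))
    agree (resp x≈y x∈) = trans (f.⟦⟧-cong (sym x≈y)) (trans (agree x∈) (g.⟦⟧-cong x≈y))
    agree (inv {x} {y} xy≈1 x∈) = begin
      f y                   ≈⟨ *-identityˡ _ ⟨
      1# * f y              ≈⟨ *-congʳ (trans (sym (trans (g.⟦⟧-cong xy≈1) g.1#-homo)) (g.*-homo x y)) ⟩
      g x * g y * f y       ≈⟨ solve 3 (λ a b c → a :* b :* c := b :* (a :* c)) refl _ _ _ ⟩
      g y * (g x * f y)     ≈⟨ *-congˡ (*-congʳ (agree x∈)) ⟨
      g y * (f x * f y)     ≈⟨ *-congˡ (trans (sym (f.*-homo x y)) (trans (f.⟦⟧-cong xy≈1) f.1#-homo)) ⟩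
      g y * 1#              ≈⟨ *-identityʳ _ ⟩
      g y                   ∎
      where
      open ≈-Reasoning
      open Solver

  -- u may be negative; its residue makes σ ζ a power with natural exponent.
  w : ℕ
  w = u ℤ.%ℕ p

  private
    w≡u : + w ≡ₙ u
    w≡u = mod (≡.subst ((+ p) ℤ∣.∣_)
      (≡.trans (solve 2 (λ w x → :- x := w :- (w :+ x)) ≡.refl (+ w) _)
        (≡.cong (λ z → + w ℤ.- z) (≡.sym (ℤ.a≡a%ℕn+[a/ℕn]*n u p))))
      (ℤ∣.∣m⇒∣-m (divides (u ℤ./ℕ p) ≡.refl)))
      where open RingTools.Solver ℤ.+-*-commutativeRing

    σζ≈ζ^w : σ ζ ≈ ζ ^ w
    σζ≈ζ^w = by-sign u w≡u σζ
      where
      by-sign : ∀ u → + w ≡ₙ u → IsPower ζ u (σ ζ) → σ ζ ≈ ζ ^ w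
      by-sign (+ n) w≡n eq = trans eq (ζ^-mod n w (ModRing.sym w≡n))
      by-sign -[1+ n ] w≡-n eq = x∙y⁻¹≈ε⇒x≈y _ _ (cancel-unit (ζ^-inverse (suc n)) (begin
        ζ ^ suc n * (σ ζ - ζ ^ w)
          ≈⟨ solve 3 (λ x y z → x :* (y :- z) := y :* x :- z :* x) refl _ _ _ ⟩
        σ ζ * ζ ^ suc n - ζ ^ w * ζ ^ suc n
          ≈⟨ +-cong eq (-‿cong (trans (sym (^-homo-* ζ w (suc n))) (ζ^-mod (w ℕ.+ suc n) 0 w+n≡0))) ⟩
        1# - 1#
          ≈⟨ -‿inverseʳ 1# ⟩
        0# ∎))
        where
        open ≈-Reasoning
        open Solver
        w+n≡0 : + (w ℕ.+ suc n) ≡ₙ + 0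
        w+n≡0 = ModRing.trans (ModRing.+-congʳ {+ suc n} w≡-n) (≡⇒≡ₙ (ℤ.+-inverseˡ (+ suc n)))

  ε : ℕ → Carrier
  ε k = σ^ k ζ

  ε-power : ∀ k → ε k ≈ ζ ^ (w ℕ.^ k)
  ε-power zero    = sym (*-identityʳ ζ)
  ε-power (suc k) = begin
    σ (ε k)               ≈⟨ σ.⟦⟧-cong (ε-power k) ⟩
    σ (ζ ^ (w ℕ.^ k))     ≈⟨ End.^-hom σ-isHom ζ (w ℕ.^ k) ⟩
    σ ζ ^ (w ℕ.^ k)       ≈⟨ ^-congˡ (w ℕ.^ k) σζ≈ζ^w ⟩
    (ζ ^ w) ^ (w ℕ.^ k)   ≈⟨ ^-assocʳ ζ w (w ℕ.^ k) ⟩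
    ζ ^ (w ℕ.* w ℕ.^ k)   ∎
    where open ≈-Reasoning

  private
    ε≉1 : ∀ k → ¬ (ε k ≈ 1#)
    ε≉1 k eq = proj₂ ζ-primitive 1 (s≤s z≤n) (s≤s 0<N)
      (trans (*-identityʳ ζ) (iterate-injective σ-injective k (trans eq (sym (σ^.1#-homo k)))))

    -- σᵏ is injective, so σᵏ ζ is not 1 and its exponent is one of 1, ..., N. Shifted by one, these
    -- exponents form the `Fin N` on which `Orbit` works.
    exponent : ∀ k → ∃[ a ] ε k ≈ ζ ^ suc (toℕ {N} a)
    exponent k with (w ℕ.^ k) % p in eq
    ... | zero = contradiction (trans (ε-power k) (trans (ζ^-% (w ℕ.^ k)) (ζ^-cong eq))) (ε≉1 k)
    ... | suc r = fromℕ< r<N , trans (ε-power k) (trans (ζ^-% (w ℕ.^ k))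
        (ζ^-cong (≡.trans eq (≡.cong suc (≡.sym (Fin.toℕ-fromℕ< r<N))))))
      where
      r<N : r ℕ.< N
      r<N = ℕ.s≤s⁻¹ (≡.subst (ℕ._< p) eq (m%n<n (w ℕ.^ k) p))

    e : ℕ → Fin N
    e k = proj₁ (exponent k)

    ε-e : ∀ k → ε k ≈ ζ ^ suc (toℕ (e k))
    ε-e k = proj₂ (exponent k)

    e⇒ε : ∀ {i j} → e i ≡ e j → ε i ≈ ε j
    e⇒ε {i} {j} eq = trans (ε-e i) (trans (ζ^-cong (≡.cong (suc ∘ toℕ) eq)) (sym (ε-e j)))

    ζ^⇒≡ : ∀ {a b : Fin N} → ζ ^ suc (toℕ a) ≈ ζ ^ suc (toℕ b) → a ≡ b
    ζ^⇒≡ {a} {b} eq = Fin.toℕ-injective (ℕ.suc-injective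
      (ζ^-injective (s≤s (Fin.toℕ<n a)) (s≤s (Fin.toℕ<n b)) eq))

    ε⇒e : ∀ {i j} → ε i ≈ ε j → e i ≡ e j
    ε⇒e {i} {j} eq = ζ^⇒≡ (trans (sym (ε-e i)) (trans eq (ε-e j)))

    e-onto : ∀ a → ∃[ k ] e k ≡ a
    e-onto a with proj₂ u-generates (+ suc (toℕ a)) (ℕ.>⇒∤ (s≤s (Fin.toℕ<n a)))
    ... | k , p∣ = k , ζ^⇒≡ (trans (sym (ε-e k)) (trans (ε-power k) (ζ^-mod (w ℕ.^ k) (suc (toℕ a)) (begin
      + (w ℕ.^ k)         ≡⟨ pos-^ w k ⟩
      (+ w) ℤ.^ k         ≈⟨ ^-resp k ⟩
      u ℤ.^ k             ≈⟨ mod (ℤ∣.∣ᵤ⇒∣ p∣) ⟩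
      + suc (toℕ a)       ∎))))
      where
      open ModRing.≈-Reasoning
      ^-resp : ∀ k → (+ w) ℤ.^ k ≡ₙ u ℤ.^ k
      ^-resp zero    = ModRing.refl
      ^-resp (suc k) = ModRing.*-cong w≡u (^-resp k)

    module E = Orbit e (λ {i} {j} eq → ε⇒e {suc i} {suc j} (σ.⟦⟧-cong (e⇒ε {i} {j} eq)))
      (λ {i} {j} eq → ε⇒e {i} {j} (σ-injective (e⇒ε {suc i} {suc j} eq))) e-onto

  -- The orbit of ζ has period N, and a homomorphism is determined by its value at ζ.
  σ^N : ∀ x → σ^ N x ≈ x
  σ^N = hom-unique (σ^-isHom N) (σ^-isHom 0) (e⇒ε {N} {0} E.period-n)

  ε-injective : ∀ {i j} → i ℕ.< N → j ℕ.< N → ε i ≈ ε j → i ≡ j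
  ε-injective {i} {j} i<N j<N eq = E.injective i<N j<N (ε⇒e {i} {j} eq)

  ε-onto : ∀ a → 0 ℕ.< a → a ℕ.< p → ∃[ k ] k ℕ.< N × ε k ≈ ζ ^ a
  ε-onto (suc a) _ (s≤s a<N) with e-onto (fromℕ< a<N)
  ... | k , eq = k % N , m%n<n k N , trans (e⇒ε {k % N} {k} (≡.sym (≡.trans (≡.cong e (m≡m%n+[m/n]*n k N))
        (E.periodic-* E.period-n (k / N) (k % N)))))
      (trans (ε-e k) (ζ^-cong (≡.cong suc (≡.trans (≡.cong toℕ eq) (Fin.toℕ-fromℕ< a<N)))))
    where instance _ = ℕ.>-nonZero 0<N

  σ^-periodic : ∀ k j x → σ^ (k ℕ.+ j ℕ.* N) x ≈ σ^ k x
  σ^-periodic k zero    x = reflexive (≡.cong (λ i → σ^ i x) (ℕ.+-identityʳ k))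
  σ^-periodic k (suc j) x = begin
    σ^ (k ℕ.+ (N ℕ.+ j ℕ.* N)) x   ≡⟨ iterate-+ σ x k _ ⟩
    σ^ k (σ^ (N ℕ.+ j ℕ.* N) x)    ≡⟨ ≡.cong (σ^ k) (iterate-+ σ x N _) ⟩
    σ^ k (σ^ N (σ^ (j ℕ.* N) x))   ≈⟨ σ^.⟦⟧-cong k (σ^N _) ⟩
    σ^ k (σ^ (j ℕ.* N) x)          ≡⟨ ≡.sym (iterate-+ σ x k _) ⟩
    σ^ (k ℕ.+ j ℕ.* N) x           ≈⟨ σ^-periodic k j x ⟩
    σ^ k x                         ∎
    where open ≈-Reasoning

  Tr : Carrier → Carrier
  Tr x = Σ< N (λ k → σ^ k x)

  Tr-cong : ∀ {x y} → x ≈ y → Tr x ≈ Tr y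
  Tr-cong x≈y = Σ<-cong N λ k _ → σ^.⟦⟧-cong k x≈y

  Tr-+ : ∀ x y → Tr (x + y) ≈ Tr x + Tr y
  Tr-+ x y = trans (Σ<-cong N λ k _ → σ^.+-homo k x y) (Σ<-+ N _ _)

  σ^-fixed : ∀ {x} → σ x ≈ x → ∀ k → σ^ k x ≈ x
  σ^-fixed σx≈x zero    = refl
  σ^-fixed σx≈x (suc k) = trans (σ.⟦⟧-cong (σ^-fixed σx≈x k)) σx≈x

  Tr-*ˡ : ∀ {a} x → σ a ≈ a → Tr (a * x) ≈ a * Tr x
  Tr-*ˡ {a} x σa≈a = trans (Σ<-cong N λ k _ → trans (σ^.*-homo k a x) (*-congʳ (σ^-fixed σa≈a k)))
    (Σ<-*ˡ N a _)

  Tr-1 : ∀ {x} → x ≈ 1# → Tr x ≈ ⟦ + N ⟧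
  Tr-1 x≈1 = trans (Σ<-cong N λ k _ → trans (σ^.⟦⟧-cong k x≈1) (σ^.1#-homo k))
    (trans (Σ<-const N 1#) (*-identityʳ _))

  -- The conjugates of y = ζⁿ are y, ..., yᴺ in some order, and together with 1 they form a
  -- vanishing geometric sum.
  Tr-ζ^ : ∀ n → ¬ (p ℕ.∣ n) → Tr (ζ ^ n) ≈ - 1#
  Tr-ζ^ n p∤n = begin
    Tr (ζ ^ n)                          ≈⟨ Σ<-cong N (λ k k<N → conjugate k k<N) ⟩
    Σ< N (λ k → y ^ suc (e′ k))         ≈⟨ Σ<-permute N e′ e′<N e′-injective (λ i → y ^ suc i) ⟩
    Σ< N (λ i → y ^ suc i)              ≈⟨ solve 1 (λ a → a := (con (+ 1) :+ a) :- con (+ 1)) refl _ ⟩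
    (1# + Σ< N (λ i → y ^ suc i)) - 1#  ≈⟨ +-congʳ (trans (sym (Σ<-suc N (y ^_)))
                                            (geometric-zero yᵖ≈1 (p∤n ∘ ζ-order n))) ⟩
    0# - 1#                             ≈⟨ +-identityˡ _ ⟩
    - 1#                                ∎
    where
    open ≈-Reasoning
    open Solver
    y = ζ ^ n
    yᵖ≈1 : y ^ p ≈ 1#
    yᵖ≈1 = trans (^-assocʳ ζ n p) (trans (ζ^-cong (ℕ.*-comm n p)) (ζ^-multiple n))
    e′ : ℕ → ℕ
    e′ = toℕ ∘ e
    e′<N : ∀ i → i ℕ.< N → e′ i ℕ.< N
    e′<N i _ = Fin.toℕ<n (e i)
    e′-injective : ∀ i j → i ℕ.< N → j ℕ.< N → e′ i ≡ e′ j → i ≡ j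
    e′-injective i j i<N j<N eq = E.injective i<N j<N (Fin.toℕ-injective eq)
    conjugate : ∀ k → k ℕ.< N → σ^ k y ≈ y ^ suc (e′ k)
    conjugate k _ = begin
      σ^ k (ζ ^ n)                 ≈⟨ End.^-hom (σ^-isHom k) ζ n ⟩
      ε k ^ n                      ≈⟨ ^-congˡ n (ε-e k) ⟩
      (ζ ^ suc (e′ k)) ^ n         ≈⟨ ^-assocʳ ζ (suc (e′ k)) n ⟩
      ζ ^ (suc (e′ k) ℕ.* n)       ≈⟨ ζ^-cong (ℕ.*-comm (suc (e′ k)) n) ⟩
      ζ ^ (n ℕ.* suc (e′ k))       ≈⟨ ^-assocʳ ζ n (suc (e′ k)) ⟨
      y ^ suc (e′ k)               ∎

  -- Instantiated with ℚ for the fixed field of σ and for decidable equality, and with ℤ for the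
  -- integrality of the periods.
  record IsFixedSubring {ℓ} (P : Pred Carrier ℓ) : Set (c ⊔ ℓ₁ ⊔ ℓ) where
    field
      ∈-resp   : ∀ {x y} → x ≈ y → x ∈ P → y ∈ P
      0∈       : 0# ∈ P
      1∈       : 1# ∈ P
      +-closed : ∀ {x y} → x ∈ P → y ∈ P → x + y ∈ P
      *-closed : ∀ {x y} → x ∈ P → y ∈ P → x * y ∈ P
      -‿closed : ∀ {x} → x ∈ P → - x ∈ P
      fixed    : ∀ {x} → x ∈ P → σ x ≈ x

  IsRational : Pred Carrier ℓ₁
  IsRational x = ∃[ q ] x ≈ ι q

  IsInteger : Pred Carrier ℓ₁
  IsInteger x = ∃[ a ] x ≈ ⟦ a ⟧

  private module ι = RingMorphisms.IsRingHomomorphism ι-isHomomorphism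

  rational-isFixedSubring : IsFixedSubring IsRational
  rational-isFixedSubring = record
    { ∈-resp   = λ x≈y (q , x≈) → q , trans (sym x≈y) x≈
    ; 0∈       = 0ℚ , sym ι.0#-homo
    ; 1∈       = 1ℚ , sym ι.1#-homo
    ; +-closed = λ (q , x≈) (r , y≈) → q ℚ.+ r , trans (+-cong x≈ y≈) (sym (ι.+-homo q r))
    ; *-closed = λ (q , x≈) (r , y≈) → q ℚ.* r , trans (*-cong x≈ y≈) (sym (ι.*-homo q r))
    ; -‿closed = λ (q , x≈) → ℚ.- q , trans (-‿cong x≈) (sym (ι.-‿homo q))
    ; fixed    = λ (q , x≈) → trans (σ.⟦⟧-cong x≈) (trans (hom-ι σ-isHom q) (sym x≈))
    }

  integer-isFixedSubring : IsFixedSubring IsInteger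
  integer-isFixedSubring = record
    { ∈-resp   = λ x≈y (a , x≈) → a , trans (sym x≈y) x≈
    ; 0∈       = ℤ.0ℤ , refl
    ; 1∈       = ℤ.1ℤ , sym ⟦⟧-homo-1
    ; +-closed = λ (a , x≈) (b , y≈) → a ℤ.+ b , trans (+-cong x≈ y≈) (sym (⟦⟧-homo-+ a b))
    ; *-closed = λ (a , x≈) (b , y≈) → a ℤ.* b , trans (*-cong x≈ y≈) (sym (⟦⟧-homo-* a b))
    ; -‿closed = λ (a , x≈) → ℤ.- a , trans (-‿cong x≈) (sym (⟦⟧-homo-- a))
    ; fixed    = λ (a , x≈) → trans (σ.⟦⟧-cong x≈) (trans (End.⟦⟧-hom σ-isHom a) (sym x≈))
    }

  σ-fromRoots : ∀ r n i → σ (fromRoots r n i) ≈ fromRoots (σ ∘ r) n i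
  σ-fromRoots r zero    zero    = σ.1#-homo
  σ-fromRoots r zero    (suc i) = σ.0#-homo
  σ-fromRoots r (suc n) zero    = trans (σ.-‿homo _) (-‿cong (trans (σ.*-homo _ _) (*-congˡ (σ-fromRoots r n 0))))
  σ-fromRoots r (suc n) (suc i) = trans (σ.+-homo _ _) (+-cong (σ-fromRoots r n i)
    (trans (σ.-‿homo _) (-‿cong (trans (σ.*-homo _ _) (*-congˡ (σ-fromRoots r n (suc i)))))))

  -- The subring P[ζ].
  data Span {ℓ} (P : Pred Carrier ℓ) : Pred Carrier (c ⊔ ℓ₁ ⊔ ℓ) where
    monomial : ∀ {a} → a ∈ P → ∀ n → a * ζ ^ n ∈ Span P
    add      : ∀ {x y} → x ∈ Span P → y ∈ Span P → x + y ∈ Span P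
    resp     : ∀ {x y} → x ≈ y → x ∈ Span P → y ∈ Span P

  module _ {ℓ} {P : Pred Carrier ℓ} (P-subring : IsFixedSubring P) where
    open IsFixedSubring P-subring

    span-base : ∀ {a} → a ∈ P → a ∈ Span P
    span-base a∈ = resp (*-identityʳ _) (monomial a∈ 0)

    span-ζ^ : ∀ n → ζ ^ n ∈ Span P
    span-ζ^ n = resp (*-identityˡ _) (monomial 1∈ n)

    span-* : ∀ {x y} → x ∈ Span P → y ∈ Span P → x * y ∈ Span P
    span-* (add x∈ x′∈) y∈ = resp (sym (distribʳ _ _ _)) (add (span-* x∈ y∈) (span-* x′∈ y∈))
    span-* (resp x≈ x∈) y∈ = resp (*-congʳ x≈) (span-* x∈ y∈)
    span-* {x} (monomial {a} a∈ m) y∈ = go y∈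
      where
      go : ∀ {y} → y ∈ Span P → a * ζ ^ m * y ∈ Span P
      go (add y∈ y′∈) = resp (sym (distribˡ _ _ _)) (add (go y∈) (go y′∈))
      go (resp y≈ y∈) = resp (*-congˡ y≈) (go y∈)
      go (monomial {b} b∈ n) = resp
        (trans (*-congˡ (^-homo-* ζ m n))
          (solve 4 (λ a b x y → a :* b :* (x :* y) := a :* x :* (b :* y)) refl a b (ζ ^ m) (ζ ^ n)))
        (monomial (*-closed a∈ b∈) (m ℕ.+ n))
        where open Solver

    span-neg : ∀ {x} → x ∈ Span P → - x ∈ Span P
    span-neg {x} x∈ = resp (solve 1 (λ x → :- con (+ 1) :* x := :- x) refl x)
      (span-* (span-base (-‿closed 1∈)) x∈)
      where open Solver

    span-Σ : ∀ n {f} → (∀ i → f i ∈ Span P) → Σ< n f ∈ Span P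
    span-Σ zero    f∈ = resp (sym (Σ<-0 _)) (span-base 0∈)
    span-Σ (suc n) f∈ = resp (sym (Σ<-suc n _)) (add (f∈ 0) (span-Σ n (λ i → f∈ (suc i))))

    span-^ : ∀ {x} → x ∈ Span P → ∀ n → x ^ n ∈ Span P
    span-^ x∈ zero    = span-base 1∈
    span-^ x∈ (suc n) = span-* x∈ (span-^ x∈ n)

    span-σ^ : ∀ k {x} → x ∈ Span P → σ^ k x ∈ Span P
    span-σ^ k (add x∈ y∈)  = resp (sym (σ^.+-homo k _ _)) (add (span-σ^ k x∈) (span-σ^ k y∈))
    span-σ^ k (resp x≈ x∈) = resp (σ^.⟦⟧-cong k x≈) (span-σ^ k x∈)
    span-σ^ k (monomial {a} a∈ n) = resp (sym (trans (σ^.*-homo k a _) (*-cong (σ^-fixed (fixed a∈) k)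
        (trans (End.^-hom (σ^-isHom k) ζ n) (^-congˡ n (ε-power k))))))
      (span-* (span-base a∈) (span-^ (span-ζ^ (w ℕ.^ k)) n))

    -- The functional x ↦ Tr (x / ζ) - Tr x maps P[ζ] to p P, and is - p x at a fixed x.
    private
      functional : Carrier → Carrier
      functional x = Tr (x * ζ ^ N) - Tr x

      -- Each trace is N or -1 according to whether p divides the exponent, so the difference is p,
      -- - p or 0. Both exponents cannot be divisible, since they differ by N < p.
      ζ^-functional : ∀ n → ∃[ a ] a ∈ P × Tr (ζ ^ (n ℕ.+ N)) - Tr (ζ ^ n) ≈ ⟦ + p ⟧ * a
      ζ^-functional n with p ℕ.∣? (n ℕ.+ N) | p ℕ.∣? n
      ... | yes p∣n+N | yes p∣n = contradiction (ℕ.∣m+n∣m⇒∣n p∣n+N p∣n)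
        (ℕ.>⇒∤ {{ℕ.>-nonZero 0<N}} (ℕ.n<1+n N))
      ... | yes p∣n+N | no p∤n = 1# , 1∈ , (begin
        Tr (ζ ^ (n ℕ.+ N)) - Tr (ζ ^ n) ≈⟨ +-cong (Tr-1 (ζ^-∣ p∣n+N)) (-‿cong (Tr-ζ^ n p∤n)) ⟩
        ⟦ + N ⟧ - - 1#                  ≈⟨ solve 1 (λ a → a :- :- con (+ 1) := (con (+ 1) :+ a) :* con (+ 1)) refl _ ⟩
        ⟦ + p ⟧ * 1#                    ∎)
        where
        open ≈-Reasoning
        open Solver
      ... | no p∤n+N | yes p∣n = - 1# , -‿closed 1∈ , (begin
        Tr (ζ ^ (n ℕ.+ N)) - Tr (ζ ^ n) ≈⟨ +-cong (Tr-ζ^ (n ℕ.+ N) p∤n+N) (-‿cong (Tr-1 (ζ^-∣ p∣n))) ⟩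
        - 1# - ⟦ + N ⟧                  ≈⟨ solve 1 (λ a → :- con (+ 1) :- a := (con (+ 1) :+ a) :* :- con (+ 1)) refl _ ⟩
        ⟦ + p ⟧ * - 1#                  ∎)
        where
        open ≈-Reasoning
        open Solver
      ... | no p∤n+N | no p∤n = 0# , 0∈ , (begin
        Tr (ζ ^ (n ℕ.+ N)) - Tr (ζ ^ n) ≈⟨ +-cong (Tr-ζ^ (n ℕ.+ N) p∤n+N) (-‿cong (Tr-ζ^ n p∤n)) ⟩
        - 1# - - 1#                     ≈⟨ -‿inverseʳ _ ⟩
        0#                              ≈⟨ zeroʳ _ ⟨
        ⟦ + p ⟧ * 0#                    ∎)
        where open ≈-Reasoning

      functional-span : ∀ {x} → x ∈ Span P → ∃[ a ] a ∈ P × functional x ≈ ⟦ + p ⟧ * a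
      functional-span (resp x≈y x∈) with functional-span x∈
      ... | a , a∈ , eq = a , a∈ , trans (sym (+-cong (Tr-cong (*-congʳ x≈y)) (-‿cong (Tr-cong x≈y)))) eq
      functional-span (add {x} {y} x∈ y∈) with functional-span x∈ | functional-span y∈
      ... | a , a∈ , eqᵃ | b , b∈ , eqᵇ = a + b , +-closed a∈ b∈ , (begin
        Tr ((x + y) * ζ ^ N) - Tr (x + y)
          ≈⟨ +-cong (trans (Tr-cong (distribʳ _ x y)) (Tr-+ _ _)) (-‿cong (Tr-+ x y)) ⟩
        (Tr (x * ζ ^ N) + Tr (y * ζ ^ N)) - (Tr x + Tr y)
          ≈⟨ solve 4 (λ a b c d → (a :+ b) :- (c :+ d) := (a :- c) :+ (b :- d)) refl _ _ _ _ ⟩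
        functional x + functional y
          ≈⟨ trans (+-cong eqᵃ eqᵇ) (sym (distribˡ _ a b)) ⟩
        ⟦ + p ⟧ * (a + b) ∎)
        where
        open ≈-Reasoning
        open Solver
      functional-span (monomial {a} a∈ n) with ζ^-functional n
      ... | b , b∈ , eq = a * b , *-closed a∈ b∈ , (begin
        Tr (a * ζ ^ n * ζ ^ N) - Tr (a * ζ ^ n)
          ≈⟨ +-cong (trans (Tr-cong (trans (*-assoc a _ _) (*-congˡ (sym (^-homo-* ζ n N)))))
               (Tr-*ˡ _ (fixed a∈))) (-‿cong (Tr-*ˡ _ (fixed a∈))) ⟩
        a * Tr (ζ ^ (n ℕ.+ N)) - a * Tr (ζ ^ n)
          ≈⟨ solve 3 (λ a x y → a :* x :- a :* y := a :* (x :- y)) refl _ _ _ ⟩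
        a * (Tr (ζ ^ (n ℕ.+ N)) - Tr (ζ ^ n))
          ≈⟨ *-congˡ eq ⟩
        a * (⟦ + p ⟧ * b)
          ≈⟨ solve 3 (λ a q b → a :* (q :* b) := q :* (a :* b)) refl _ _ _ ⟩
        ⟦ + p ⟧ * (a * b) ∎)
        where
        open ≈-Reasoning
        open Solver

      functional-fixed : ∀ {x} → σ x ≈ x → functional x ≈ ⟦ + p ⟧ * - x
      functional-fixed {x} σx≈x = begin
        Tr (x * ζ ^ N) - Tr x
          ≈⟨ +-cong (Tr-*ˡ _ σx≈x) (-‿cong (trans (Tr-cong (sym (*-identityʳ x))) (Tr-*ˡ 1# σx≈x))) ⟩
        x * Tr (ζ ^ N) - x * Tr 1#
          ≈⟨ +-cong (*-congˡ (Tr-ζ^ N (ℕ.>⇒∤ {{ℕ.>-nonZero 0<N}} (ℕ.n<1+n N)))) (-‿cong (*-congˡ (Tr-1 refl))) ⟩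
        x * - 1# - x * ⟦ + N ⟧
          ≈⟨ solve 2 (λ x n → x :* :- con (+ 1) :- x :* n := (con (+ 1) :+ n) :* :- x) refl _ _ ⟩
        ⟦ + p ⟧ * - x ∎
        where
        open ≈-Reasoning
        open Solver

    fixed-span : ∀ {x} → x ∈ Span P → σ x ≈ x → x ∈ P
    fixed-span {x} x∈ σx≈x with functional-span x∈
    ... | a , a∈ , eq = ∈-resp -a≈x (-‿closed a∈)
      where
      open Solver
      -a≈x : - a ≈ x
      -a≈x = sym (x∙y⁻¹≈ε⇒x≈y _ _ (cancel-ℕ N (begin
        ⟦ + p ⟧ * (x - - a)
          ≈⟨ solve 3 (λ q x a → q :* (x :- :- a) := q :* a :- q :* :- x) refl _ _ _ ⟩
        ⟦ + p ⟧ * a - ⟦ + p ⟧ * - x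
          ≈⟨ +-cong (sym eq) (-‿cong (sym (functional-fixed σx≈x))) ⟩
        functional x - functional x
          ≈⟨ -‿inverseʳ _ ⟩
        0# ∎)))
        where open ≈-Reasoning

    -- The coefficients are polynomial expressions in the conjugates of x, and σ only permutes the
    -- roots cyclically.
    charpoly-∈ : ∀ {x} → x ∈ Span P → ∀ i → fromRoots (λ k → σ^ k x) N i ∈ P
    charpoly-∈ {x} x∈ i = fixed-span (coefficient-span N i) σ-fixed
      where
      roots : ℕ → Carrier
      roots k = σ^ k x
      mulLinear-span : ∀ {r a} → r ∈ Span P → (∀ i → a i ∈ Span P) → ∀ i → mulLinear r a i ∈ Span P
      mulLinear-span r∈ a∈ zero    = span-neg (span-* r∈ (a∈ 0))
      mulLinear-span r∈ a∈ (suc i) = add (a∈ i) (span-neg (span-* r∈ (a∈ (suc i))))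
      coefficient-span : ∀ n i → fromRoots roots n i ∈ Span P
      coefficient-span zero    zero    = span-base 1∈
      coefficient-span zero    (suc i) = span-base 0∈
      coefficient-span (suc n) i       = mulLinear-span (span-σ^ n x∈) (coefficient-span n) i
      σ-fixed : σ (fromRoots roots N i) ≈ fromRoots roots N i
      σ-fixed = trans (σ-fromRoots roots N i) (fromRoots-cyclic roots N (σ^N x) i)

  charpoly : Carrier → ℕ → Carrier
  charpoly x = fromRoots (λ k → σ^ k x) N

  charpoly-root : ∀ x → x ^ N + Σ< N (λ i → charpoly x i * x ^ i) ≈ 0#
  charpoly-root x = trans (+-comm _ _) (trans
    (+-congˡ (sym (trans (*-congʳ (fromRoots-monic _ N)) (*-identityˡ _))))
    (trans (sym (Σ<-last N _)) (fromRoots-root _ N (suc N) (ℕ.n<1+n N) 0 0<N x refl)))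

  private
    -- The value at x of (f - f(0)) / X, for f the characteristic polynomial of x.
    quotient : Carrier → Carrier
    quotient x = Σ< N (λ i → charpoly x (suc i) * x ^ i)

    charpoly-quotient : ∀ x → x * quotient x ≈ - charpoly x 0
    charpoly-quotient x = x∙y⁻¹≈ε⇒x≈y _ _ (begin
      x * quotient x - - charpoly x 0
        ≈⟨ solve 2 (λ a b → a :- :- b := b :* con (+ 1) :+ a) refl _ _ ⟩
      charpoly x 0 * 1# + x * quotient x
        ≈⟨ +-congˡ (trans (sym (Σ<-*ˡ N x _)) (Σ<-cong N λ i _ →
             solve 3 (λ a b c → a :* (b :* c) := b :* (a :* c)) refl x (charpoly x (suc i)) (x ^ i))) ⟩
      charpoly x 0 * 1# + Σ< N (λ i → charpoly x (suc i) * x ^ suc i)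
        ≈⟨ Σ<-suc N _ ⟨
      Σ< (suc N) (λ i → charpoly x i * x ^ i)
        ≈⟨ fromRoots-root _ N (suc N) (ℕ.n<1+n N) 0 0<N x refl ⟩
      0# ∎)
      where
      open ≈-Reasoning
      open Solver

    -- Up to sign the constant term is the norm, a product of conjugates none of which vanishes.
    charpoly-nonzero : ∀ {x} → ¬ (x ≈ 0#) → ¬ (charpoly x 0 ≈ 0#)
    charpoly-nonzero {x} x≉0 = go N
      where
      go : ∀ n → ¬ (fromRoots (λ k → σ^ k x) n 0 ≈ 0#)
      go zero    eq = 1≉0 eq
      go (suc n) eq = go n (noZeroDivisors
        (trans (sym (-‿involutive _)) (trans (-‿cong eq) -0#≈0#))
        (λ σⁿx≈0 → x≉0 (iterate-injective σ-injective n (trans σⁿx≈0 (sym (σ^.0#-homo n))))))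

    -- The quotient of the characteristic polynomial by X inverts x up to its constant term.
    inverse-span : ∀ {x} → x ∈ Span IsRational → ¬ (x ≈ 0#) → ∃[ y ] y ∈ Span IsRational × x * y ≈ 1#
    inverse-span {x} x∈ x≉0 = invert (charpoly-∈ rational-isFixedSubring x∈ 0)
      where
      open ≈-Reasoning
      quotient∈ : quotient x ∈ Span IsRational
      quotient∈ = span-Σ rational-isFixedSubring N λ i → span-* rational-isFixedSubring
        (span-base rational-isFixedSubring (charpoly-∈ rational-isFixedSubring x∈ (suc i)))
        (span-^ rational-isFixedSubring x∈ i)

      rearrange : ∀ x q r → x * (q * - r) ≈ - (x * q) * r
      rearrange = solve 3 (λ x q r → x :* (q :* :- r) := :- (x :* q) :* r) refl
        where open Solver

      invert : IsRational (charpoly x 0) → ∃[ y ] y ∈ Span IsRational × x * y ≈ 1#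
      invert (q , a₀≈ιq) = quotient x * - ι r ,
        span-* rational-isFixedSubring quotient∈
          (span-neg rational-isFixedSubring (span-base rational-isFixedSubring (r , refl))) ,
        (begin
          x * (quotient x * - ι r)  ≈⟨ rearrange x (quotient x) (ι r) ⟩
          - (x * quotient x) * ι r  ≈⟨ *-congʳ (trans (-‿cong (charpoly-quotient x)) (-‿involutive _)) ⟩
          charpoly x 0 * ι r        ≈⟨ *-congʳ a₀≈ιq ⟩
          ι q * ι r                 ≈⟨ proj₂ unit ⟩
          1#                        ∎)
        where
        unit : ∃[ r ] ι q * ι r ≈ 1#
        unit = ι-unit λ q≡0 → charpoly-nonzero x≉0 (trans a₀≈ιq (trans (ι.⟦⟧-cong q≡0) ι.0#-homo))
        r : ℚ
        r = proj₁ unit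

  rational-span : ∀ x → x ∈ Span IsRational
  rational-span x = go (ζ-generates x)
    where
    go : ∀ {x} → x ∈ ℚ⟨ ζ ⟩ → x ∈ Span IsRational
    go gen           = resp (*-identityʳ ζ) (span-ζ^ rational-isFixedSubring 1)
    go (rat q)       = span-base rational-isFixedSubring (q , refl)
    go (add x∈ y∈)   = add (go x∈) (go y∈)
    go (mul x∈ y∈)   = span-* rational-isFixedSubring (go x∈) (go y∈)
    go (resp x≈y x∈) = resp x≈y (go x∈)
    go (inv {x} {y} xy≈1 x∈) = same
      (inverse-span (go x∈) (λ x≈0 → 1≉0 (trans (sym xy≈1) (trans (*-congʳ x≈0) (zeroˡ y)))))
      where
      expand : ∀ x y z → x * (y - z) ≈ x * y - x * z
      expand = solve 3 (λ x y z → x :* (y :- z) := x :* y :- x :* z) refl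
        where open Solver
      same : ∃[ z ] z ∈ Span IsRational × x * z ≈ 1# → y ∈ Span IsRational
      same (z , z∈ , xz≈1) = resp (sym (x∙y⁻¹≈ε⇒x≈y y z (cancel-unit xy≈1
        (trans (expand x y z) (trans (+-cong xy≈1 (-‿cong xz≈1)) (-‿inverseʳ 1#)))))) z∈

  fixed⇒rational : ∀ {x} → σ x ≈ x → ∃[ q ] x ≈ ι q
  fixed⇒rational {x} = fixed-span rational-isFixedSubring (rational-span x)

  opaque
    -- The norm is rational up to sign, and rationals can be compared with 0: if it is zero then so
    -- is x, by stability of equality; otherwise x has an inverse.
    discreteField : LinearDependence.IsDiscreteField R
    discreteField = 1≉0 , zero-or-unit
      where
      zero-or-unit : ∀ x → x ≈ 0# ⊎ ∃[ y ] x * y ≈ 1#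
      zero-or-unit x = decide (charpoly-∈ rational-isFixedSubring (rational-span x) 0)
        where
        decide : IsRational (charpoly x 0) → x ≈ 0# ⊎ ∃[ y ] x * y ≈ 1#
        decide (q , a₀≈ιq) with q ℚ.≟ 0ℚ
        ... | yes q≡0 = inj₁ (≈-stable λ x≉0 → charpoly-nonzero x≉0
            (trans a₀≈ιq (trans (ι.⟦⟧-cong q≡0) ι.0#-homo)))
        ... | no q≢0 = inj₂ (proj₁ unit , proj₂ (proj₂ unit))
          where
          x≉0 : ¬ (x ≈ 0#)
          x≉0 x≈0 = q≢0 (ι-injective (trans (sym a₀≈ιq) (trans (sym (-‿involutive _))
            (trans (-‿cong (trans (sym (charpoly-quotient x)) (trans (*-congʳ x≈0) (zeroˡ _)))) -0#≈0#))))
          unit : ∃[ y ] y ∈ Span IsRational × x * y ≈ 1#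
          unit = inverse-span (rational-span x) x≉0

  infix 4 _≈?_
  opaque
    _≈?_ : ∀ x y → Dec (x ≈ y)
    x ≈? y = decide (proj₂ discreteField (x - y))
      where
      decide : x - y ≈ 0# ⊎ (∃[ z ] (x - y) * z ≈ 1#) → Dec (x ≈ y)
      decide (inj₁ x-y≈0)    = yes (x∙y⁻¹≈ε⇒x≈y x y x-y≈0)
      decide (inj₂ (z , eq)) = no λ x≈y → 1≉0 (trans (sym eq) (trans
        (*-congʳ (trans (+-congʳ x≈y) (-‿inverseʳ y))) (zeroˡ z)))

  integer-span⇒integral : ∀ {x} → x ∈ Span IsInteger →
    ∃[ n ] Σ (Fin n → ℤ) λ a → x ^ n + sum (λ i → a i ·ℤ x ^ toℕ i) ≈ 0#
  integer-span⇒integral {x} x∈ = N , (λ i → proj₁ (coefficient (toℕ i))) , trans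
    (+-congˡ (trans (sum≈∑ (λ (i : Fin N) → proj₁ (coefficient (toℕ i)) ·ℤ x ^ toℕ i))
      (trans (∑-cong λ i → trans (·ℤ-* (proj₁ (coefficient (toℕ i))) _) (*-congʳ (sym (proj₂ (coefficient (toℕ i))))))
        (sym (Σ<≈∑ N (λ i → charpoly x i * x ^ i))))))
    (charpoly-root x)
    where
    coefficient : ∀ i → IsInteger (charpoly x i)
    coefficient = charpoly-∈ integer-isFixedSubring x∈

  -- ζᴺ is the inverse of ζ, so these are the inverses of the `ε k`.
  ε′ : ℕ → Carrier
  ε′ k = σ^ k (ζ ^ N)

  ε-inverse : ∀ k → ε k * ε′ k ≈ 1#
  ε-inverse k = trans (sym (σ^.*-homo k ζ _)) (trans (σ^.⟦⟧-cong k ζ*ζ^N) (σ^.1#-homo k))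
    where
    ζ*ζ^N : ζ * ζ ^ N ≈ 1#
    ζ*ζ^N = proj₁ ζ-primitive

  σ^-comm : ∀ j k x → σ^ j (σ^ k x) ≈ σ^ k (σ^ j x)
  σ^-comm j k x = reflexive (≡.trans (≡.sym (iterate-+ σ x j k))
    (≡.trans (≡.cong (λ i → σ^ i x) (ℕ.+-comm j k)) (iterate-+ σ x k j)))

  σ^-+ : ∀ j k x → σ^ j (σ^ k x) ≈ σ^ (j ℕ.+ k) x
  σ^-+ j k x = reflexive (≡.sym (iterate-+ σ x j k))

  private
    ε*ε′-power : ∀ i l → ε i * ε′ l ≈ ζ ^ (w ℕ.^ i ℕ.+ w ℕ.^ l ℕ.* N)
    ε*ε′-power i l = trans (*-cong (ε-power i) (trans (End.^-hom (σ^-isHom l) ζ N)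
        (trans (^-congˡ N (ε-power l)) (^-assocʳ ζ (w ℕ.^ l) N))))
      (sym (^-homo-* ζ (w ℕ.^ i) _))

  Tr-pairing-equal : ∀ i l → ε i ≈ ε l → Tr (ε i * ε′ l) ≈ ⟦ + N ⟧
  Tr-pairing-equal i l eq = Tr-1 (trans (*-congʳ eq) (ε-inverse l))

  Tr-pairing-distinct : ∀ i l → ¬ (ε i ≈ ε l) → Tr (ε i * ε′ l) ≈ - 1#
  Tr-pairing-distinct i l distinct = trans (Tr-cong (ε*ε′-power i l)) (Tr-ζ^ (w ℕ.^ i ℕ.+ w ℕ.^ l ℕ.* N) λ p∣ →
    distinct (x∙y⁻¹≈ε⇒x≈y _ _ (cancel-unit (trans (*-comm (ε′ l) (ε l)) (ε-inverse l))
      (trans (expand (ε′ l) (ε i) (ε l))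
        (trans (+-cong (trans (ε*ε′-power i l) (ζ^-∣ p∣)) (-‿cong (ε-inverse l))) (-‿inverseʳ 1#))))))
    where
    open Solver
    expand : ∀ x y z → x * (y - z) ≈ y * x - z * x
    expand = solve 3 (λ x y z → x :* (y :- z) := y :* x :- z :* x) refl

  -- p times the k-th coordinate of x in the normal basis ε.
  coordinate : ℕ → Carrier → Carrier
  coordinate k x = Tr (x * ε′ k) - Tr x

  σ-Tr : ∀ x → σ (Tr x) ≈ Tr x
  σ-Tr x = trans (End.Σ<-hom σ-isHom N _) (Σ<-cyclic N (λ k → σ^ k x) periodic 1)
    where
    periodic : ∀ i → σ^ (N ℕ.+ i) x ≈ σ^ i x
    periodic i = trans (sym (σ^-+ N i x)) (σ^N _)

  Tr-σ : ∀ x → Tr (σ x) ≈ Tr x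
  Tr-σ x = trans (Σ<-cong N λ k _ → σ^-comm k 1 x) (trans (sym (End.Σ<-hom σ-isHom N _)) (σ-Tr x))

  coordinate-fixed : ∀ k x → σ (coordinate k x) ≈ coordinate k x
  coordinate-fixed k x = trans (σ.+-homo _ _) (+-cong (σ-Tr _) (trans (σ.-‿homo _) (-‿cong (σ-Tr x))))

  coordinate-cong : ∀ k {x y} → x ≈ y → coordinate k x ≈ coordinate k y
  coordinate-cong k x≈y = +-cong (Tr-cong (*-congʳ x≈y)) (-‿cong (Tr-cong x≈y))

  coordinate-+ : ∀ k x y → coordinate k (x + y) ≈ coordinate k x + coordinate k y
  coordinate-+ k x y = trans
    (+-cong (trans (Tr-cong (distribʳ _ x y)) (Tr-+ _ _)) (-‿cong (Tr-+ x y)))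
    (rearrange (Tr (x * ε′ k)) (Tr (y * ε′ k)) (Tr x) (Tr y))
    where
    open Solver
    rearrange : ∀ a b c d → (a + b) - (c + d) ≈ (a - c) + (b - d)
    rearrange = solve 4 (λ a b c d → (a :+ b) :- (c :+ d) := (a :- c) :+ (b :- d)) refl

  coordinate-*ˡ : ∀ k {a} x → σ a ≈ a → coordinate k (a * x) ≈ a * coordinate k x
  coordinate-*ˡ k {a} x σa≈a = trans
    (+-cong (trans (Tr-cong (*-assoc a x _)) (Tr-*ˡ _ σa≈a)) (-‿cong (Tr-*ˡ x σa≈a)))
    (factor a (Tr (x * ε′ k)) (Tr x))
    where
    open Solver
    factor : ∀ a x y → a * x - a * y ≈ a * (x - y)
    factor = solve 3 (λ a x y → a :* x :- a :* y := a :* (x :- y)) refl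

  coordinate-0 : ∀ k → coordinate k 0# ≈ 0#
  coordinate-0 k = trans (coordinate-cong k (sym (zeroˡ 0#))) (trans (coordinate-*ˡ k 0# σ.0#-homo) (zeroˡ _))

  coordinate-∑ : ∀ {n} k (a v : Fin n → Carrier) → (∀ i → σ (a i) ≈ a i) →
                 coordinate k (∑ λ i → a i * v i) ≈ ∑ λ i → a i * coordinate k (v i)
  coordinate-∑ {zero}  k a v fixed = trans (coordinate-cong k (∑-empty _)) (trans (coordinate-0 k) (sym (∑-empty _)))
  coordinate-∑ {suc n} k a v fixed = trans (coordinate-cong k (∑-suc _)) (trans (coordinate-+ k _ _)
    (trans (+-cong (coordinate-*ˡ k _ (fixed zero)) (coordinate-∑ k (a ∘ suc) (v ∘ suc) (fixed ∘ suc)))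
      (sym (∑-suc _))))

  coordinate-σ : ∀ k x → coordinate (suc k) (σ x) ≈ coordinate k x
  coordinate-σ k x = +-cong (trans (Tr-cong (sym (σ.*-homo x _))) (Tr-σ _)) (-‿cong (Tr-σ x))

  coordinate-σ^ : ∀ d k x → coordinate (d ℕ.+ k) (σ^ d x) ≈ coordinate k x
  coordinate-σ^ zero    k x = refl
  coordinate-σ^ (suc d) k x = trans (coordinate-σ (d ℕ.+ k) _) (coordinate-σ^ d k x)

  -- Interchanging the sums gives Σ σᵛ x Tr (ζ ε′ᵥ), while - Tr x Tr ζ = Tr x adds one σᵛ x to each
  -- term. As Tr (ζ ε′ᵥ) is -1 for v ≠ 0 and N for v = 0, only (N + 1) x remains.
  coordinate-expansion : ∀ x → Σ< N (λ k → coordinate k x * ε k) ≈ ⟦ + p ⟧ * x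
  coordinate-expansion x = begin
    Σ< N (λ k → coordinate k x * ε k)
      ≈⟨ Σ<-cong N (λ k _ → expand (Tr (x * ε′ k)) (Tr x) (ε k)) ⟩
    Σ< N (λ k → Tr (x * ε′ k) * ε k + - Tr x * ε k)
      ≈⟨ trans (Σ<-+ N _ _) (+-congˡ (Σ<-*ˡ N (- Tr x) _)) ⟩
    Σ< N (λ k → Tr (x * ε′ k) * ε k) + - Tr x * Tr ζ
      ≈⟨ +-cong first (*-congˡ Tr-ζ) ⟩
    Σ< N (λ v → σ^ v x * Tr (ε 0 * ε′ v)) + - Tr x * - 1#
      ≈⟨ +-congˡ (solve 1 (λ a → :- a :* :- con (+ 1) := a) refl (Tr x)) ⟩
    Σ< N (λ v → σ^ v x * Tr (ε 0 * ε′ v)) + Tr x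
      ≈⟨ Σ<-+ N _ _ ⟨
    Σ< N (λ v → σ^ v x * Tr (ε 0 * ε′ v) + σ^ v x)
      ≈⟨ Σ<-single N _ 0 0<N off-diagonal ⟩
    x * Tr (ε 0 * ε′ 0) + x
      ≈⟨ +-congʳ (*-congˡ (Tr-pairing-equal 0 0 refl)) ⟩
    x * ⟦ + N ⟧ + x
      ≈⟨ solve 2 (λ x n → x :* n :+ x := (con (+ 1) :+ n) :* x) refl x ⟦ + N ⟧ ⟩
    ⟦ + p ⟧ * x ∎
    where
    open ≈-Reasoning
    open Solver
    expand : ∀ a b c → (a - b) * c ≈ a * c + - b * c
    expand = solve 3 (λ a b c → (a :- b) :* c := a :* c :+ :- b :* c) refl

    Tr-ζ : Tr ζ ≈ - 1#
    Tr-ζ = trans (Tr-cong (sym (*-identityʳ ζ))) (Tr-ζ^ 1 (ℕ.>⇒∤ (s≤s 0<N)))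

    first : Σ< N (λ k → Tr (x * ε′ k) * ε k) ≈ Σ< N (λ v → σ^ v x * Tr (ε 0 * ε′ v))
    first = begin
      Σ< N (λ k → Tr (x * ε′ k) * ε k)
        ≈⟨ Σ<-cong N (λ k _ → sym (Σ<-*ʳ N _ (ε k))) ⟩
      Σ< N (λ k → Σ< N λ v → σ^ v (x * ε′ k) * ε k)
        ≈⟨ Σ<-swap N N _ ⟩
      Σ< N (λ v → Σ< N λ k → σ^ v (x * ε′ k) * ε k)
        ≈⟨ Σ<-cong N (λ v _ → Σ<-cong N λ k _ → term v k) ⟩
      Σ< N (λ v → Σ< N λ k → σ^ v x * σ^ k (ε 0 * ε′ v))
        ≈⟨ Σ<-cong N (λ v _ → Σ<-*ˡ N (σ^ v x) _) ⟩
      Σ< N (λ v → σ^ v x * Tr (ε 0 * ε′ v)) ∎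
      where
      term : ∀ v k → σ^ v (x * ε′ k) * ε k ≈ σ^ v x * σ^ k (ε 0 * ε′ v)
      term v k = begin
        σ^ v (x * ε′ k) * ε k            ≈⟨ *-congʳ (trans (σ^.*-homo v x _) (*-congˡ (σ^-comm v k _))) ⟩
        σ^ v x * σ^ k (ε′ v) * ε k       ≈⟨ trans (*-assoc _ _ _) (*-congˡ (*-comm _ _)) ⟩
        σ^ v x * (σ^ k ζ * σ^ k (ε′ v))  ≈⟨ *-congˡ (σ^.*-homo k ζ _) ⟨
        σ^ v x * σ^ k (ε 0 * ε′ v)       ∎

    off-diagonal : ∀ v → v ℕ.< N → v ≢ 0 → σ^ v x * Tr (ε 0 * ε′ v) + σ^ v x ≈ 0#
    off-diagonal v v<N v≢0 = trans
      (+-congʳ (*-congˡ (Tr-pairing-distinct 0 v λ eq → v≢0 (≡.sym (ε-injective 0<N v<N eq)))))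
      (solve 1 (λ a → a :* :- con (+ 1) :+ a := con (+ 0)) refl (σ^ v x))

  -- If σᵈ fixes x, then its coordinates are periodic in the index with period d, so the first d of
  -- them determine x.
  coordinates-zero : ∀ {d x} .{{_ : NonZero d}} → d ℕ.∣ N → σ^ d x ≈ x →
                     (∀ k → k ℕ.< d → coordinate k x ≈ 0#) → x ≈ 0#
  coordinates-zero {d} {x} d∣N fixed coordinate≈0 = cancel-ℕ N (trans (sym (coordinate-expansion x))
    (Σ<-zero N λ k _ → trans (*-congʳ (all k)) (zeroˡ _)))
    where
    shift : ∀ k j → coordinate (k ℕ.+ j ℕ.* d) x ≈ coordinate k x
    shift k zero    = reflexive (≡.cong (λ i → coordinate i x) (ℕ.+-identityʳ k))
    shift k (suc j) = trans (reflexive (≡.cong (λ i → coordinate i x) (rearrange k (j ℕ.* d))))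
      (trans (coordinate-cong (d ℕ.+ (k ℕ.+ j ℕ.* d)) (sym fixed))
        (trans (coordinate-σ^ d (k ℕ.+ j ℕ.* d) x) (shift k j)))
      where
      rearrange : ∀ k i → k ℕ.+ (d ℕ.+ i) ≡ d ℕ.+ (k ℕ.+ i)
      rearrange k i = ≡.trans (≡.sym (ℕ.+-assoc k d i)) (≡.trans (≡.cong (ℕ._+ i) (ℕ.+-comm k d)) (ℕ.+-assoc d k i))
    all : ∀ k → coordinate k x ≈ 0#
    all k = trans (reflexive (≡.cong (λ i → coordinate i x) (m≡m%n+[m/n]*n k d)))
      (trans (shift (k % d) (k / d)) (coordinate≈0 (k % d) (m%n<n k d)))

  -- The fixed field of σᵈ has dimension at most d over ℚ: the coordinates are rational, the first d
  -- decide, and elimination on n ≥ d of them yields a relation.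
  fixed-dependent : ∀ {d n} .{{_ : NonZero d}} → d ℕ.∣ N → d ℕ.≤ n →
    (v : Fin (suc n) → Carrier) → (∀ i → σ^ d (v i) ≈ v i) →
    Σ (Fin (suc n) → ℚ) λ a → (∃[ i ] a i ≢ 0ℚ) × ∑ (λ i → ι (a i) * v i) ≈ 0#
  fixed-dependent {d} {n} d∣N d≤n v fixed = a , proj₁ (proj₂ relation) , coordinates-zero d∣N sum-fixed vanish
    where
    rational : ∀ i k → ∃[ q ] coordinate k (v i) ≈ ι q
    rational i k = fixed⇒rational (coordinate-fixed k (v i))
    relation = LinearDependence.dependent ℚ.+-*-commutativeRing ℚ-isDiscreteField n
      (λ i k → proj₁ (rational i (toℕ k)))
    a = proj₁ relation
    sum-fixed : σ^ d (∑ λ i → ι (a i) * v i) ≈ ∑ λ i → ι (a i) * v i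
    sum-fixed = trans (End.∑-hom (σ^-isHom d) _) (∑-cong λ i →
      trans (σ^.*-homo d _ _) (*-cong (hom-ι (σ^-isHom d) (a i)) (fixed i)))
    vanish : ∀ k → k ℕ.< d → coordinate k (∑ λ i → ι (a i) * v i) ≈ 0#
    vanish k k<d = begin
      coordinate k (∑ λ i → ι (a i) * v i)
        ≈⟨ coordinate-∑ k (ι ∘ a) v (λ i → hom-ι σ-isHom (a i)) ⟩
      ∑ (λ i → ι (a i) * coordinate k (v i))
        ≈⟨ ∑-cong (λ i → *-congˡ (trans (proj₂ (rational i k))
             (reflexive (≡.cong (λ l → ι (proj₁ (rational i l))) (≡.sym (Fin.toℕ-fromℕ< k<n)))))) ⟩
      ∑ (λ i → ι (a i) * ι (proj₁ (rational i (toℕ (fromℕ< k<n)))))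
        ≈⟨ ∑-cong (λ i → sym (ι.*-homo (a i) _)) ⟩
      ∑ (λ i → ι (a i ℚ.* proj₁ (rational i (toℕ (fromℕ< k<n)))))
        ≈⟨ Homomorphism.∑-hom ℚ.+-*-commutativeRing R ι-isHomomorphism _ ⟨
      ι (ℚᴿ.∑ λ i → a i ℚ.* proj₁ (rational i (toℕ (fromℕ< k<n))))
        ≈⟨ trans (ι.⟦⟧-cong (proj₂ (proj₂ relation) (fromℕ< k<n))) ι.0#-homo ⟩
      0# ∎
      where
      open ≈-Reasoning
      k<n = ℕ.<-≤-trans k<d d≤n

  private
    s∣N : s ℕ.∣ N
    s∣N = ℕ.divides m ≡.refl

  -- K as the fixed field of σˢ

  module Subextension {ℓ} (K : Subfield L ℓ) (K-degree : HasDegree K s) where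
    open Subfield K using (Member; 0∈; 1∈; +-closed; *-closed; -‿closed; ⁻¹-closed) renaming (resp to Member-resp)

    private
      basis : Fin s → Carrier
      basis = proj₁ K-degree
      basis∈ : ∀ i → basis i ∈ Member
      basis∈ = proj₁ (proj₂ K-degree)

      basis-spans : ∀ {x} → x ∈ Member → Σ (Fin s → ℚ) λ q → x ≈ ∑ λ i → ι (q i) * basis i
      basis-spans x∈ = proj₁ spans , trans (proj₂ spans) (sum≈∑ (λ i → ι (proj₁ spans i) * basis i))
        where spans = proj₁ (proj₂ (proj₂ K-degree)) _ x∈

      basis-independent : ∀ (q : Fin s → ℚ) → ∑ (λ i → ι (q i) * basis i) ≈ 0# → ∀ i → q i ≡ 0ℚ
      basis-independent q eq = proj₂ (proj₂ (proj₂ K-degree)) q (trans (sum≈∑ (λ i → ι (q i) * basis i)) eq)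

    Fixes : ℕ → Set (c ⊔ ℓ₁ ⊔ ℓ)
    Fixes k = ∀ x → x ∈ Member → σ^ k x ≈ x

    private
      -- A decidable substitute for `Fixes`: finitely many equations in L, sufficient because
      -- homomorphisms fix ℚ.
      FixesBasis : ℕ → Set ℓ₁
      FixesBasis k = ∀ i → σ^ k (basis i) ≈ basis i

      fixesBasis⇒fixes : ∀ k → FixesBasis k → Fixes k
      fixesBasis⇒fixes k fixes x x∈ = trans (σ^.⟦⟧-cong k x≈) (trans (End.∑-hom (σ^-isHom k) _)
        (trans (∑-cong λ i → trans (σ^.*-homo k _ _) (*-cong (hom-ι (σ^-isHom k) (q i)) (fixes i))) (sym x≈)))
        where
        q = proj₁ (basis-spans x∈)
        x≈ = proj₂ (basis-spans x∈)

      fixes⇒fixesBasis : ∀ k → Fixes k → FixesBasis k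
      fixes⇒fixesBasis k fixes i = fixes _ (basis∈ i)

      fixesBasis? : ∀ k → Dec (FixesBasis k)
      fixesBasis? k = Fin.all? λ i → σ^ k (basis i) ≈? basis i

    -- Subtracting σⁿ y times the relation at x from the relation at y x removes the last term. By
    -- induction aᵢ (σⁱ y - σⁿ y) = 0 for all y in K; were aᵢ nonzero, σⁿ⁻ⁱ would fix K.
    characters-independent : ∀ n → (∀ k → 0 ℕ.< k → k ℕ.< n → ¬ Fixes k) → (a : ℕ → Carrier) →
      (∀ x → x ∈ Member → Σ< n (λ i → a i * σ^ i x) ≈ 0#) → ∀ i → i ℕ.< n → a i ≈ 0#
    characters-independent (suc n) distinct a relation = coefficients
      where
      open ≈-Reasoning
      open Solver
      shorter : ∀ y → y ∈ Member → ∀ x → x ∈ Member →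
                Σ< n (λ i → a i * (σ^ i y - σ^ n y) * σ^ i x) ≈ 0#
      shorter y y∈ x x∈ = begin
        Σ< n (λ i → a i * (σ^ i y - σ^ n y) * σ^ i x)
          ≈⟨ solve 2 (λ u t → u := u :+ t :* con (+ 0)) refl _ (a n * σ^ n x) ⟩
        Σ< n (λ i → a i * (σ^ i y - σ^ n y) * σ^ i x) + a n * σ^ n x * 0#
          ≈⟨ +-congˡ (solve 3 (λ a x y → a :* x :* con (+ 0) := a :* (y :- y) :* x) refl (a n) (σ^ n x) (σ^ n y)) ⟩
        Σ< n (λ i → a i * (σ^ i y - σ^ n y) * σ^ i x) + a n * (σ^ n y - σ^ n y) * σ^ n x
          ≈⟨ Σ<-last n _ ⟨
        Σ< (suc n) (λ i → a i * (σ^ i y - σ^ n y) * σ^ i x)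
          ≈⟨ Σ<-cong (suc n) (λ i _ → trans (expand (a i) (σ^ i y) (σ^ n y) (σ^ i x))
               (+-congʳ (*-congˡ (sym (σ^.*-homo i y x))))) ⟩
        Σ< (suc n) (λ i → a i * σ^ i (y * x) + - σ^ n y * (a i * σ^ i x))
          ≈⟨ trans (Σ<-+ (suc n) _ _) (+-congˡ (Σ<-*ˡ (suc n) (- σ^ n y) _)) ⟩
        Σ< (suc n) (λ i → a i * σ^ i (y * x)) + - σ^ n y * Σ< (suc n) (λ i → a i * σ^ i x)
          ≈⟨ +-cong (relation (y * x) (*-closed y∈ x∈)) (*-congˡ (relation x x∈)) ⟩
        0# + - σ^ n y * 0#
          ≈⟨ trans (+-identityˡ _) (zeroʳ _) ⟩
        0# ∎
        where
        expand : ∀ a y z x → a * (y - z) * x ≈ a * (y * x) + - z * (a * x)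
        expand = solve 4 (λ a y z x → a :* (y :- z) :* x := a :* (y :* x) :+ :- z :* (a :* x)) refl

      initial : ∀ i → i ℕ.< n → a i ≈ 0#
      initial i i<n = ≈-stable λ a≉0 → distinct (n ℕ.∸ i) (ℕ.m<n⇒0<n∸m i<n) (s≤s (ℕ.m∸n≤m n i)) λ y y∈ →
        iterate-injective σ-injective i (begin
          σ^ i (σ^ (n ℕ.∸ i) y)    ≈⟨ σ^-+ i (n ℕ.∸ i) y ⟩
          σ^ (i ℕ.+ (n ℕ.∸ i)) y   ≡⟨ ≡.cong (λ k → σ^ k y) (ℕ.m+[n∸m]≡n (ℕ.<⇒≤ i<n)) ⟩
          σ^ n y                   ≈⟨ x∙y⁻¹≈ε⇒x≈y _ _ (noZeroDivisors
                                        (characters-independent n (λ k 0<k k<n → distinct k 0<k (ℕ.m<n⇒m<1+n k<n))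
                                          (λ i → a i * (σ^ i y - σ^ n y)) (shorter y y∈) i i<n) a≉0) ⟨
          σ^ i y                   ∎)

      coefficients : ∀ i → i ℕ.< suc n → a i ≈ 0#
      coefficients i i<1+n with i ℕ.≟ n
      ... | no i≢n     = initial i (ℕ.≤∧≢⇒< (ℕ.s≤s⁻¹ i<1+n) i≢n)
      ... | yes ≡.refl = begin
        -- The last coefficient is read off at x = 1, the others being zero.
        a n                                       ≈⟨ trans (*-congˡ (σ^.1#-homo n)) (*-identityʳ _) ⟨
        a n * σ^ n 1#                             ≈⟨ +-identityˡ _ ⟨
        0# + a n * σ^ n 1#                        ≈⟨ +-congʳ (Σ<-zero n λ j j<n → trans (*-congʳ (initial j j<n)) (zeroˡ _)) ⟨
        Σ< n (λ i → a i * σ^ i 1#) + a n * σ^ n 1# ≈⟨ Σ<-last n _ ⟨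
        Σ< (suc n) (λ i → a i * σ^ i 1#)          ≈⟨ relation 1# 1∈ ⟩
        0#                                        ∎

    private
      -- If none of σ, ..., σˢ fixed K, then 1, σ, ..., σˢ would be independent on K. But their
      -- values on a basis of K are s + 1 vectors of length s.
      some-fixes : ¬ (∀ k → 0 ℕ.< k → k ℕ.≤ s → ¬ FixesBasis k)
      some-fixes none = proj₂ (proj₁ (proj₂ relation)) (trans (reflexive (≡.sym (extend-toℕ 0# a i₀)))
        (characters-independent (suc s)
          (λ k 0<k k<1+s fixes → none k 0<k (ℕ.s≤s⁻¹ k<1+s) (fixes⇒fixesBasis k fixes))
          a′ vanish (toℕ i₀) (Fin.toℕ<n i₀)))
        where
        relation = LinearDependence.dependent R discreteField s (λ i j → σ^ (toℕ i) (basis j))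
        a : Fin (suc s) → Carrier
        a = proj₁ relation
        i₀ = proj₁ (proj₁ (proj₂ relation))
        a′ : ℕ → Carrier
        a′ = extend 0# a
        vanish : ∀ x → x ∈ Member → Σ< (suc s) (λ i → a′ i * σ^ i x) ≈ 0#
        vanish x x∈ = begin
          Σ< (suc s) (λ i → a′ i * σ^ i x)
            ≈⟨ Σ<≈∑ (suc s) _ ⟩
          ∑ {suc s} (λ i → a′ (toℕ i) * σ^ (toℕ i) x)
            ≈⟨ ∑-cong (λ i → *-cong (reflexive (extend-toℕ 0# a i)) (σ^x (toℕ i))) ⟩
          ∑ (λ i → a i * ∑ λ j → ι (q j) * σ^ (toℕ i) (basis j))
            ≈⟨ ∑-cong (λ i → trans (sym (∑-*ˡ (a i) _)) (∑-cong λ j → rearrange (a i) (ι (q j)) _)) ⟩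
          ∑ (λ i → ∑ λ j → ι (q j) * (a i * σ^ (toℕ i) (basis j)))
            ≈⟨ ∑-swap _ ⟩
          ∑ (λ j → ∑ λ i → ι (q j) * (a i * σ^ (toℕ i) (basis j)))
            ≈⟨ ∑-zero (λ j → trans (∑-*ˡ (ι (q j)) _) (trans (*-congˡ (proj₂ (proj₂ relation) j)) (zeroʳ _))) ⟩
          0# ∎
          where
          open ≈-Reasoning
          q = proj₁ (basis-spans x∈)
          rearrange : ∀ a b c → a * (b * c) ≈ b * (a * c)
          rearrange = solve 3 (λ a b c → a :* (b :* c) := b :* (a :* c)) refl
            where open Solver
          σ^x : ∀ k → σ^ k x ≈ ∑ λ j → ι (q j) * σ^ k (basis j)
          σ^x k = trans (σ^.⟦⟧-cong k (proj₂ (basis-spans x∈))) (trans (End.∑-hom (σ^-isHom k) _)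
            (∑-cong λ j → trans (σ^.*-homo k _ _) (*-congʳ (hom-ι (σ^-isHom k) (q j)))))

      IsMinimalPeriod : ℕ → Set ℓ₁
      IsMinimalPeriod d = 0 ℕ.< d × d ℕ.≤ s × FixesBasis d × (∀ k → 0 ℕ.< k → k ℕ.< d → ¬ FixesBasis k)

      opaque
        minimal-period : ∃[ d ] IsMinimalPeriod d
        minimal-period = found (least-positive fixesBasis? s)
          where
          found : ∃[ d ] IsMinimalPeriod d ⊎ (∀ k → 0 ℕ.< k → k ℕ.≤ s → ¬ FixesBasis k) → ∃[ d ] IsMinimalPeriod d
          found (inj₁ minimal) = minimal
          found (inj₂ none)    = contradiction none some-fixes

      d : ℕ
      d = proj₁ minimal-period

      instance
        d-nonZero : NonZero d
        d-nonZero = ℕ.>-nonZero (proj₁ (proj₂ minimal-period))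

      d-fixes : Fixes d
      d-fixes = fixesBasis⇒fixes d (proj₁ (proj₂ (proj₂ (proj₂ minimal-period))))

      d-multiples : ∀ j → Fixes (j ℕ.* d)
      d-multiples zero    x x∈ = refl
      d-multiples (suc j) x x∈ = trans (sym (σ^-+ d (j ℕ.* d) x))
        (trans (σ^.⟦⟧-cong d (d-multiples j x x∈)) (d-fixes x x∈))

      d-minimal : ∀ k → Fixes k → d ℕ.∣ k
      d-minimal k fixes with k % d in eq
      ... | zero  = ℕ.m%n≡0⇒n∣m k d eq
      ... | suc r = contradiction (fixes⇒fixesBasis (suc r) λ x x∈ → begin
            σ^ (suc r) x                          ≈⟨ σ^.⟦⟧-cong (suc r) (d-multiples (k / d) x x∈) ⟨
            σ^ (suc r) (σ^ (k / d ℕ.* d) x)       ≈⟨ σ^-+ (suc r) _ x ⟩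
            σ^ (suc r ℕ.+ k / d ℕ.* d) x          ≡⟨ ≡.cong (λ i → σ^ (i ℕ.+ k / d ℕ.* d) x) eq ⟨
            σ^ (k % d ℕ.+ k / d ℕ.* d) x          ≡⟨ ≡.cong (λ i → σ^ i x) (m≡m%n+[m/n]*n k d) ⟨
            σ^ k x                                ≈⟨ fixes x x∈ ⟩
            x                                     ∎)
          (proj₂ (proj₂ (proj₂ (proj₂ minimal-period))) (suc r) (s≤s z≤n)
            (≡.subst (ℕ._< d) eq (m%n<n k d)))
        where open ≈-Reasoning

      d∣N : d ℕ.∣ N
      d∣N = d-minimal N λ x _ → σ^N x

      -- The basis of K lies in the fixed field of σᵈ, whose dimension is at most d.
      s≤d : s ℕ.≤ d
      s≤d = dimension-bound s basis basis-independent (λ i → d-fixes _ (basis∈ i))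
        where
        dimension-bound : ∀ s (v : Fin s → Carrier) →
          (∀ (q : Fin s → ℚ) → ∑ (λ i → ι (q i) * v i) ≈ 0# → ∀ i → q i ≡ 0ℚ) → (∀ i → σ^ d (v i) ≈ v i) → s ℕ.≤ d
        dimension-bound zero    v independent fixed = z≤n
        dimension-bound (suc n) v independent fixed = ℕ.≰⇒> λ d≤n → dependent (fixed-dependent d∣N d≤n v fixed)
          where
          dependent : ¬ (Σ (Fin (suc n) → ℚ) λ a → (∃[ i ] a i ≢ 0ℚ) × ∑ (λ i → ι (a i) * v i) ≈ 0#)
          dependent (a , (i , aᵢ≢0) , eq) = aᵢ≢0 (independent a eq i)

      d≡s : d ≡ s
      d≡s = ℕ.≤-antisym (proj₁ (proj₂ (proj₂ minimal-period))) s≤d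

    fixes-s : Fixes s
    fixes-s = ≡.subst Fixes d≡s d-fixes

    fixes-multiple : ∀ j → Fixes (j ℕ.* s)
    fixes-multiple j = ≡.subst (λ k → Fixes (j ℕ.* k)) d≡s (d-multiples j)

    fixes⇒∣ : ∀ k → Fixes k → s ℕ.∣ k
    fixes⇒∣ k fixes = ≡.subst (ℕ._∣ k) d≡s (d-minimal k fixes)

    private
      ∑∈ : ∀ {n} {f : Fin n → Carrier} → (∀ i → f i ∈ Member) → ∑ f ∈ Member
      ∑∈ {zero}  f∈ = Member-resp (sym (∑-empty _)) 0∈
      ∑∈ {suc n} f∈ = Member-resp (sym (∑-suc _)) (+-closed (f∈ zero) (∑∈ (f∈ ∘ suc)))

    ⟦⟧∈ : ∀ a → ⟦ a ⟧ ∈ Member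
    ⟦⟧∈ (+ n) = natural∈ n
      where
      natural∈ : ∀ n → ⟦ + n ⟧ ∈ Member
      natural∈ zero    = 0∈
      natural∈ (suc n) = +-closed 1∈ (natural∈ n)
    ⟦⟧∈ -[1+ n ] = -‿closed (⟦⟧∈ (+ suc n))

    rational∈ : ∀ q → ι q ∈ Member
    rational∈ q = Member-resp (begin
        ⟦ ℚ.↥ q ⟧ * proj₁ unit           ≈⟨ *-congʳ (ι-denominator q) ⟨
        ι q * ⟦ ℚ.↧ q ⟧ * proj₁ unit     ≈⟨ trans (*-assoc _ _ _) (*-congˡ (proj₂ unit)) ⟩
        ι q * 1#                         ≈⟨ *-identityʳ _ ⟩
        ι q                              ∎)
      (*-closed (⟦⟧∈ (ℚ.↥ q)) (⁻¹-closed (proj₂ unit) (⟦⟧∈ (ℚ.↧ q))))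
      where
      open ≈-Reasoning
      unit : ∃[ y ] ⟦ ℚ.↧ q ⟧ * y ≈ 1#
      unit = unitOf (proj₂ discreteField ⟦ ℚ.↧ q ⟧)
        where
        unitOf : ⟦ ℚ.↧ q ⟧ ≈ 0# ⊎ (∃[ y ] ⟦ ℚ.↧ q ⟧ * y ≈ 1#) → ∃[ y ] ⟦ ℚ.↧ q ⟧ * y ≈ 1#
        unitOf (inj₁ eq)   = contradiction eq (⟦⟧≉0 (ℚ.ℚ.denominator-1 q))
        unitOf (inj₂ unit) = unit

    -- x and the basis of K are s + 1 elements fixed by σˢ, hence related over ℚ. The coefficient of
    -- x is nonzero, since the basis is independent, and the relation is solved for x.
    fixed⇒∈ : ∀ {x} → σ^ s x ≈ x → x ∈ Member
    fixed⇒∈ {x} fixed = solveFor (fixed-dependent s∣N ℕ.≤-refl (x ∷ basis) λ where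
        zero    → fixed
        (suc i) → fixes-s _ (basis∈ i))
      where
      solveFor : (Σ (Fin (suc s) → ℚ) λ a → (∃[ i ] a i ≢ 0ℚ) × ∑ (λ i → ι (a i) * (x ∷ basis) i) ≈ 0#) →
                 x ∈ Member
      solveFor (a , nonzero , eq) with a zero ℚ.≟ 0ℚ
      ... | yes a₀≡0 = contradiction nonzero λ (i , aᵢ≢0) → aᵢ≢0 (all-zero i)
        where
        all-zero : ∀ i → a i ≡ 0ℚ
        all-zero zero    = a₀≡0
        all-zero (suc i) = basis-independent (a ∘ suc) (begin
          ∑ (λ i → ι (a (suc i)) * basis i)                    ≈⟨ +-identityˡ _ ⟨
          0# + ∑ (λ i → ι (a (suc i)) * basis i)               ≈⟨ +-congʳ (trans (*-congʳ (trans (ι.⟦⟧-cong a₀≡0) ι.0#-homo)) (zeroˡ x)) ⟨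
          ι (a zero) * x + ∑ (λ i → ι (a (suc i)) * basis i)   ≈⟨ ∑-suc _ ⟨
          ∑ (λ i → ι (a i) * (x ∷ basis) i)                    ≈⟨ eq ⟩
          0#                                                   ∎) i
          where open ≈-Reasoning
      ... | no a₀≢0 = Member-resp (sym x≈) (*-closed (-‿closed (rational∈ r))
          (∑∈ λ i → *-closed (rational∈ (a (suc i))) (basis∈ i)))
        where
        open ≈-Reasoning
        open Solver
        r = proj₁ (ι-unit a₀≢0)
        S = ∑ (λ i → ι (a (suc i)) * basis i)
        x≈ : x ≈ - ι r * S
        x≈ = begin
          x                                      ≈⟨ *-identityˡ x ⟨
          1# * x                                 ≈⟨ *-congʳ (proj₂ (ι-unit a₀≢0)) ⟨
          ι (a zero) * ι r * x                   ≈⟨ solve 4 (λ a r x s → a :* r :* x := r :* (a :* x :+ s) :- r :* s) refl _ (ι r) x S ⟩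
          ι r * (ι (a zero) * x + S) - ι r * S   ≈⟨ +-congʳ (*-congˡ (trans (sym (∑-suc _)) eq)) ⟩
          ι r * 0# - ι r * S                     ≈⟨ solve 2 (λ r s → r :* con (+ 0) :- r :* s := :- r :* s) refl (ι r) S ⟩
          - ι r * S                              ∎

  σ^-automorphism : ∀ k → IsAutomorphism (σ^ k)
  σ^-automorphism zero    = Identity.isRingIsomorphism rawRing refl
  σ^-automorphism (suc k) = Composition.isRingIsomorphism trans (σ^-automorphism k) σ-automorphism

  -- Fourier inversion: if y were none of the powers of ζ, the sums of (y / ζᵃ)ⁱ over i would
  -- all vanish, whereas their sum over a is p.
  p-th-root : ∀ {y} → y ^ p ≈ 1# → ∃[ a ] a ℕ.< p × y ≈ ζ ^ a
  p-th-root {y} yᵖ≈1 = found (Fin.any? λ (a : Fin p) → y ≈? ζ ^ toℕ a)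
    where
    open ≈-Reasoning
    found : Dec (∃[ a ] y ≈ ζ ^ toℕ {p} a) → ∃[ a ] a ℕ.< p × y ≈ ζ ^ a
    found (yes (a , y≈)) = toℕ a , Fin.toℕ<n a , y≈
    found (no none) = contradiction p≈0 (⟦⟧≉0 N)
      where
      z : ℕ → Carrier
      z a = y * ζ ^ (N ℕ.* a)
      zᵖ≈1 : ∀ a → z a ^ p ≈ 1#
      zᵖ≈1 a = trans (^-distrib-* y _ p) (trans (*-cong yᵖ≈1 (trans (^-assocʳ ζ (N ℕ.* a) p)
        (trans (ζ^-cong (ℕ.*-comm (N ℕ.* a) p)) (ζ^-multiple (N ℕ.* a))))) (*-identityˡ 1#))
      z≉1 : ∀ a → a ℕ.< p → ¬ (z a ≈ 1#)
      z≉1 a a<p z≈1 = none (fromℕ< a<p , trans y≈ (ζ^-cong (≡.sym (Fin.toℕ-fromℕ< a<p))))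
        where
        y≈ : y ≈ ζ ^ a
        y≈ = begin
          y                                 ≈⟨ *-identityʳ y ⟨
          y * 1#                            ≈⟨ *-congˡ (trans (*-comm _ _) (ζ^-inverse a)) ⟨
          y * (ζ ^ (N ℕ.* a) * ζ ^ a)       ≈⟨ *-assoc _ _ _ ⟨
          z a * ζ ^ a                       ≈⟨ trans (*-congʳ z≈1) (*-identityˡ _) ⟩
          ζ ^ a                             ∎
      column : ∀ i → i ℕ.< p → i ≢ 0 → Σ< p (λ a → z a ^ i) ≈ 0#
      column i i<p i≢0 = trans (Σ<-cong p λ a _ → term a)
        (trans (Σ<-*ˡ p (y ^ i) _) (trans (*-congˡ (geometric-zero xᵖ≈1 x≉1)) (zeroʳ _)))
        where
        x = ζ ^ (N ℕ.* i)
        term : ∀ a → z a ^ i ≈ y ^ i * x ^ a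
        term a = trans (^-distrib-* y _ i) (*-congˡ (trans (^-assocʳ ζ (N ℕ.* a) i)
          (trans (ζ^-cong (rearrange N a i)) (sym (^-assocʳ ζ (N ℕ.* i) a)))))
          where
          rearrange : ∀ n a i → n ℕ.* a ℕ.* i ≡ n ℕ.* i ℕ.* a
          rearrange n a i = ≡.trans (ℕ.*-assoc n a i) (≡.trans (≡.cong (n ℕ.*_) (ℕ.*-comm a i)) (≡.sym (ℕ.*-assoc n i a)))
        xᵖ≈1 : x ^ p ≈ 1#
        xᵖ≈1 = trans (^-assocʳ ζ (N ℕ.* i) p) (trans (ζ^-cong (ℕ.*-comm (N ℕ.* i) p)) (ζ^-multiple (N ℕ.* i)))
        x≉1 : ¬ (x ≈ 1#)
        x≉1 x≈1 = i≢0 (ζ^-injective i<p (s≤s z≤n) (trans (sym (*-identityʳ _))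
          (trans (*-congˡ (sym x≈1)) (ζ^-inverse i))))
      p≈0 : ⟦ + p ⟧ ≈ 0#
      p≈0 = begin
        ⟦ + p ⟧                              ≈⟨ *-identityʳ _ ⟨
        ⟦ + p ⟧ * 1#                         ≈⟨ Σ<-const p 1# ⟨
        Σ< p (λ a → z a ^ 0)                 ≈⟨ Σ<-single p (λ i → Σ< p (λ a → z a ^ i)) 0 (s≤s z≤n) column ⟨
        Σ< p (λ i → Σ< p (λ a → z a ^ i))    ≈⟨ Σ<-swap p p _ ⟩
        Σ< p (λ a → Σ< p (λ i → z a ^ i))    ≈⟨ Σ<-zero p (λ a a<p → geometric-zero (zᵖ≈1 a) (z≉1 a a<p)) ⟩
        0#                                   ∎

  -- g ζ is a p-th root of unity other than 1, hence a nontrivial power of ζ, and all of these lie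
  -- in the orbit of σ.
  automorphism-power : ∀ {g} → IsAutomorphism g → ∃[ k ] k ℕ.< N × (∀ x → g x ≈ σ^ k x)
  automorphism-power {g} g-automorphism = proj₁ index , proj₁ (proj₂ index) ,
    hom-unique g.isRingHomomorphism (σ^-isHom (proj₁ index))
      (trans (proj₂ (proj₂ root)) (sym (proj₂ (proj₂ index))))
    where
    module g = RingMorphisms.IsRingIsomorphism g-automorphism
    root : ∃[ a ] a ℕ.< p × g ζ ≈ ζ ^ a
    root = p-th-root (trans (sym (End.^-hom g.isRingHomomorphism ζ p))
      (trans (g.⟦⟧-cong (proj₁ ζ-primitive)) g.1#-homo))
    nonzero : ∀ a → g ζ ≈ ζ ^ a → 0 ℕ.< a
    nonzero zero gζ≈1 = contradiction
      (trans (*-identityʳ ζ) (g.injective (trans gζ≈1 (sym g.1#-homo))))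
      (proj₂ ζ-primitive 1 (s≤s z≤n) (s≤s 0<N))
    nonzero (suc a) _ = s≤s z≤n
    index : ∃[ k ] k ℕ.< N × ε k ≈ ζ ^ proj₁ root
    index = ε-onto (proj₁ root) (nonzero _ (proj₂ (proj₂ root))) (proj₁ (proj₂ root))

  -- Gaussian periods and their trace pairing

  private
    N≡m*s : N ≡ m ℕ.* s
    N≡m*s = ≡.refl

  -- The Gaussian periods of length m.
  η : ℕ → Carrier
  η i = Σ< m (λ j → ε (i ℕ.+ j ℕ.* s))

  σ^-η : ∀ k i → σ^ k (η i) ≈ η (k ℕ.+ i)
  σ^-η k i = trans (End.Σ<-hom (σ^-isHom k) m _) (Σ<-cong m λ j _ →
    trans (σ^-+ k _ ζ) (reflexive (≡.cong ε (≡.sym (ℕ.+-assoc k i _)))))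

  -- Adding s to i replaces j by j + 1, a cyclic shift of the m summands because σᵐˢ is the
  -- identity.
  η-periodic : ∀ i → η (s ℕ.+ i) ≈ η i
  η-periodic i = trans (Σ<-cong m λ j _ → reflexive (≡.cong ε (rearrange (j ℕ.* s))))
    (Σ<-cyclic m (λ j → ε (i ℕ.+ j ℕ.* s)) periodic 1)
    where
    rearrange : ∀ k → s ℕ.+ i ℕ.+ k ≡ i ℕ.+ (s ℕ.+ k)
    rearrange k = ≡.trans (≡.cong (ℕ._+ k) (ℕ.+-comm s i)) (ℕ.+-assoc i s k)
    periodic : ∀ j → ε (i ℕ.+ (m ℕ.+ j) ℕ.* s) ≈ ε (i ℕ.+ j ℕ.* s)
    periodic j = trans (reflexive (≡.cong ε index)) (σ^-periodic (i ℕ.+ j ℕ.* s) 1 ζ)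
      where
      open ≡-Reasoning
      index : i ℕ.+ (m ℕ.+ j) ℕ.* s ≡ i ℕ.+ j ℕ.* s ℕ.+ 1 ℕ.* N
      index = begin
        i ℕ.+ (m ℕ.+ j) ℕ.* s          ≡⟨ ≡.cong (i ℕ.+_) (ℕ.*-distribʳ-+ s m j) ⟩
        i ℕ.+ (m ℕ.* s ℕ.+ j ℕ.* s)    ≡⟨ ≡.cong (i ℕ.+_) (ℕ.+-comm (m ℕ.* s) _) ⟩
        i ℕ.+ (j ℕ.* s ℕ.+ m ℕ.* s)    ≡⟨ ℕ.+-assoc i _ _ ⟨
        i ℕ.+ j ℕ.* s ℕ.+ m ℕ.* s      ≡⟨ ≡.cong (i ℕ.+ j ℕ.* s ℕ.+_) (≡.trans (ℕ.*-identityˡ N) N≡m*s) ⟨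
        i ℕ.+ j ℕ.* s ℕ.+ 1 ℕ.* N      ∎

  σ^s-η : ∀ i → σ^ s (η i) ≈ η i
  σ^s-η i = trans (σ^-η s i) (η-periodic i)

  η-% : ∀ i → η i ≈ η (i % s)
  η-% i = trans (reflexive (≡.cong η (≡.trans (m≡m%n+[m/n]*n i s) (ℕ.+-comm (i % s) _)))) (multiple (i / s))
    where
    multiple : ∀ k → η (k ℕ.* s ℕ.+ (i % s)) ≈ η (i % s)
    multiple zero    = refl
    multiple (suc k) = trans (reflexive (≡.cong η (ℕ.+-assoc s _ _))) (trans (η-periodic _) (multiple k))

  -- The power of σ that sends ζ to ζᴺ = ζ⁻¹, the algebraic counterpart of complex conjugation.
  inversion : ℕ
  inversion = proj₁ (ε-onto N 0<N (ℕ.n<1+n N))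

  ε-inversion : ε inversion ≈ ζ ^ N
  ε-inversion = proj₂ (proj₂ (ε-onto N 0<N (ℕ.n<1+n N)))

  σ^inversion-ε : ∀ k → σ^ inversion (ε k) ≈ ε′ k
  σ^inversion-ε k = trans (σ^-comm inversion k ζ) (σ^.⟦⟧-cong k ε-inversion)

  σ^inversion-involutive : ∀ x → σ^ inversion (σ^ inversion x) ≈ x
  σ^inversion-involutive x = trans (σ^-+ inversion inversion x)
    (hom-unique (σ^-isHom (inversion ℕ.+ inversion)) (σ^-isHom 0)
      (trans (sym (σ^-+ inversion inversion ζ)) (trans (σ^inversion-ε inversion) ε′≈ζ)) x)
    where
    ε′≈ζ : ε′ inversion ≈ ζ
    ε′≈ζ = x∙y⁻¹≈ε⇒x≈y _ _ (cancel-unit (trans (*-comm _ _) (proj₁ ζ-primitive))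
      (trans (solve 3 (λ u x z → u :* (x :- z) := u :* x :- z :* u) refl (ζ ^ N) (ε′ inversion) ζ)
        (trans (+-cong (trans (*-congʳ (sym ε-inversion)) (ε-inverse inversion)) (-‿cong (proj₁ ζ-primitive)))
          (-‿inverseʳ 1#))))
      where open Solver

  η′ : ℕ → Carrier
  η′ i = σ^ inversion (η i)

  -- On the fixed field of σˢ this is the trace to ℚ.
  trace : Carrier → Carrier
  trace x = Σ< s (λ k → σ^ k x)

  private
    η′-sum : ∀ i → η′ i ≈ Σ< m (λ j → ε′ (i ℕ.+ j ℕ.* s))
    η′-sum i = trans (End.Σ<-hom (σ^-isHom inversion) m _) (Σ<-cong m λ j _ → σ^inversion-ε (i ℕ.+ j ℕ.* s))

    -- Transitivity of the trace: `η i` sums the conjugates of `ε i` over the fixed field of σˢ, and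
    -- k + j s with k < s, j < m runs once through 0, ..., N - 1.
    trace-η : ∀ i {x} → σ^ s x ≈ x → trace (η i * x) ≈ Tr (ε i * x)
    trace-η i {x} fixed = begin
      Σ< s (λ k → σ^ k (η i * x))
        ≈⟨ Σ<-cong s (λ k _ → trans (σ^.*-homo k _ _) (*-congʳ (σ^-η k i))) ⟩
      Σ< s (λ k → η (k ℕ.+ i) * σ^ k x)
        ≈⟨ Σ<-cong s (λ k _ → trans (sym (Σ<-*ʳ m _ _)) (Σ<-cong m λ j _ → term k j)) ⟩
      Σ< s (λ k → Σ< m λ j → σ^ (k ℕ.+ j ℕ.* s) (ε i * x))
        ≈⟨ Σ<-blocks m s (λ k → σ^ k (ε i * x)) ⟨
      Σ< (m ℕ.* s) (λ k → σ^ k (ε i * x))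
        ≡⟨ ≡.cong (λ n → Σ< n (λ k → σ^ k (ε i * x))) N≡m*s ⟨
      Tr (ε i * x) ∎
      where
      open ≈-Reasoning
      σ^-multiple : ∀ j → σ^ (j ℕ.* s) x ≈ x
      σ^-multiple zero    = refl
      σ^-multiple (suc j) = trans (sym (σ^-+ s _ x)) (trans (σ^.⟦⟧-cong s (σ^-multiple j)) fixed)
      term : ∀ k j → ε (k ℕ.+ i ℕ.+ j ℕ.* s) * σ^ k x ≈ σ^ (k ℕ.+ j ℕ.* s) (ε i * x)
      term k j = begin
        ε (k ℕ.+ i ℕ.+ j ℕ.* s) * σ^ k x
          ≈⟨ *-cong (trans (reflexive (≡.cong ε (rearrange k i (j ℕ.* s)))) (sym (σ^-+ (k ℕ.+ j ℕ.* s) i ζ)))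
               (trans (σ^.⟦⟧-cong k (sym (σ^-multiple j))) (σ^-+ k _ x)) ⟩
        σ^ (k ℕ.+ j ℕ.* s) (ε i) * σ^ (k ℕ.+ j ℕ.* s) x
          ≈⟨ σ^.*-homo (k ℕ.+ j ℕ.* s) _ _ ⟨
        σ^ (k ℕ.+ j ℕ.* s) (ε i * x) ∎
        where
        rearrange : ∀ k i l → k ℕ.+ i ℕ.+ l ≡ k ℕ.+ l ℕ.+ i
        rearrange k i l = ≡.trans (ℕ.+-assoc k i l) (≡.trans (≡.cong (k ℕ.+_) (ℕ.+-comm i l)) (≡.sym (ℕ.+-assoc k l i)))

    trace-pairing : ∀ i j → trace (η i * η′ j) ≈ Σ< m (λ b → Tr (ε i * ε′ (j ℕ.+ b ℕ.* s)))
    trace-pairing i j = trans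
      (trace-η i (trans (σ^-comm s inversion (η j)) (σ^.⟦⟧-cong inversion (σ^s-η j))))
      (trans (Tr-cong (trans (*-congˡ (η′-sum j)) (sym (Σ<-*ˡ m _ _)))) (Tr-Σ< m _))
      where
      Tr-Σ< : ∀ n f → Tr (Σ< n f) ≈ Σ< n (Tr ∘ f)
      Tr-Σ< n f = trans (Σ<-cong N λ k _ → End.Σ<-hom (σ^-isHom k) n f) (Σ<-swap N n _)

    -- Both indices lie below N, so equal conjugates have equal indices i = j + b s; reducing modulo
    -- s gives i = j, and then b = 0.
    ε-distinct : ∀ {i j} b → i ℕ.< s → j ℕ.< s → b ℕ.< m → i ≢ j ⊎ b ≢ 0 → ¬ (ε i ≈ ε (j ℕ.+ b ℕ.* s))
    ε-distinct {i} {j} b i<s j<s b<m differ eq = absurd differ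
      where
      below : ∀ {i b} → i ℕ.< s → b ℕ.< m → i ℕ.+ b ℕ.* s ℕ.< N
      below {i} {b} i<s b<m = ≡.subst (i ℕ.+ b ℕ.* s ℕ.<_) (≡.sym N≡m*s)
        (ℕ.<-≤-trans (ℕ.+-monoˡ-< (b ℕ.* s) i<s) (ℕ.*-monoˡ-≤ s b<m))
      i<N : i ℕ.< N
      i<N = ≡.subst (ℕ._< N) (ℕ.+-identityʳ i) (below i<s (ℕ.≤-<-trans z≤n b<m))
      i≡j+bs : i ≡ j ℕ.+ b ℕ.* s
      i≡j+bs = ε-injective i<N (below j<s b<m) eq
      i≡j : i ≡ j
      i≡j = ≡.trans (≡.sym (m<n⇒m%n≡m i<s)) (≡.trans (≡.cong (_% s) i≡j+bs)
        (≡.trans ([m+kn]%n≡m%n j b s) (m<n⇒m%n≡m j<s)))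
      b≡0 : ∀ b → i ≡ j ℕ.+ b ℕ.* s → b ≡ 0
      b≡0 zero    _  = ≡.refl
      b≡0 (suc b) eq = contradiction (≡.subst (ℕ._< s) eq i<s)
        (ℕ.≤⇒≯ (ℕ.≤-trans (ℕ.m≤m+n s (b ℕ.* s)) (ℕ.m≤n+m _ j)))
      absurd : i ≢ j ⊎ b ≢ 0 → _
      absurd (inj₁ i≢j) = i≢j i≡j
      absurd (inj₂ b≢0) = b≢0 (b≡0 b i≡j+bs)

  trace-distinct : ∀ {i j} → i ℕ.< s → j ℕ.< s → i ≢ j → trace (η i * η′ j) ≈ - ⟦ + m ⟧
  trace-distinct {i} {j} i<s j<s i≢j = begin
    trace (η i * η′ j)
      ≈⟨ trace-pairing i j ⟩
    Σ< m (λ b → Tr (ε i * ε′ (j ℕ.+ b ℕ.* s)))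
      ≈⟨ Σ<-cong m (λ b b<m → Tr-pairing-distinct i (j ℕ.+ b ℕ.* s) (ε-distinct b i<s j<s b<m (inj₁ i≢j))) ⟩
    Σ< m (λ _ → - 1#)
      ≈⟨ Σ<-const m (- 1#) ⟩
    ⟦ + m ⟧ * - 1#
      ≈⟨ solve 1 (λ m → m :* :- con (+ 1) := :- m) refl _ ⟩
    - ⟦ + m ⟧ ∎
    where
    open ≈-Reasoning
    open Solver

  trace-equal : ∀ {i} → i ℕ.< s → trace (η i * η′ i) ≈ ⟦ + p ⟧ - ⟦ + m ⟧
  trace-equal {i} i<s = begin
    trace (η i * η′ i)
      ≈⟨ trace-pairing i i ⟩
    Σ< m T
      ≈⟨ solve 2 (λ x m → x := (x :+ m :* con (+ 1)) :- m) refl _ ⟦ + m ⟧ ⟩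
    -- Adding 1 to each summand annihilates those with b ≠ 0, where the pairing is -1, and turns the
    -- remaining one from N into p.
    (Σ< m T + ⟦ + m ⟧ * 1#) - ⟦ + m ⟧
      ≈⟨ +-congʳ (trans (+-congˡ (sym (Σ<-const m 1#))) (sym (Σ<-+ m _ _))) ⟩
    Σ< m (λ b → T b + 1#) - ⟦ + m ⟧
      ≈⟨ +-congʳ (Σ<-single m _ 0 0<m λ b b<m b≢0 → trans (+-congʳ
           (Tr-pairing-distinct i (i ℕ.+ b ℕ.* s) (ε-distinct b i<s i<s b<m (inj₂ b≢0)))) (-‿inverseˡ 1#)) ⟩
    (T 0 + 1#) - ⟦ + m ⟧
      ≈⟨ +-congʳ (trans (+-congʳ (Tr-pairing-equal i (i ℕ.+ 0) (reflexive (≡.cong ε (≡.sym (ℕ.+-identityʳ i)))))) (+-comm _ _)) ⟩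
    ⟦ + p ⟧ - ⟦ + m ⟧ ∎
    where
    open ≈-Reasoning
    open Solver
    T : ℕ → Carrier
    T b = Tr (ε i * ε′ (i ℕ.+ b ℕ.* s))
    0<m : 0 ℕ.< m
    0<m = positive m N≡m*s
      where
      positive : ∀ m → N ≡ m ℕ.* s → 0 ℕ.< m
      positive zero    N≡0 = contradiction 0<N (ℕ.<-irrefl (≡.sym N≡0))
      positive (suc m) _   = s≤s z≤n

  module _ {ℓ} (K : Subfield L ℓ) (K-degree : HasDegree K s) where
    open Subextension K K-degree

    opaque
      η∈ : ∀ i → η i ∈ Subfield.Member K
      η∈ i = fixed⇒∈ (σ^s-η i)

      σ^∈ : ∀ k {x} → x ∈ Subfield.Member K → σ^ k x ∈ Subfield.Member K
      σ^∈ k {x} x∈ = fixed⇒∈ (trans (σ^-comm s k x) (σ^.⟦⟧-cong k (fixes-s x x∈)))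

    private
      period-index : ∀ {g} → InGal K g → ∃[ j ] (∀ x → g x ≈ σ^ (toℕ {m} j ℕ.* s) x)
      period-index {g} (g-automorphism , g-fixes) = index (automorphism-power g-automorphism)
        where
        index : ∃[ k ] k ℕ.< N × (∀ x → g x ≈ σ^ k x) → ∃[ j ] (∀ x → g x ≈ σ^ (toℕ {m} j ℕ.* s) x)
        index (k , k<N , g≈) = divisor (fixes⇒∣ k λ x x∈ → trans (sym (g≈ x)) (g-fixes x x∈))
          where
          divisor : s ℕ.∣ k → ∃[ j ] (∀ x → g x ≈ σ^ (toℕ {m} j ℕ.* s) x)
          divisor (ℕ.divides q k≡q*s) = fromℕ< q<m , λ x → trans (g≈ x)
            (reflexive (≡.cong (λ k → σ^ k x) (≡.trans k≡q*s (≡.cong (ℕ._* s) (≡.sym (Fin.toℕ-fromℕ< q<m))))))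
            where
            q<m : q ℕ.< m
            q<m = ℕ.*-cancelʳ-< s q m (≡.subst₂ ℕ._<_ k≡q*s N≡m*s k<N)

      period-index-injective : ∀ {j j′ : Fin m} → σ^ (toℕ j ℕ.* s) ζ ≈ σ^ (toℕ j′ ℕ.* s) ζ → j ≡ j′
      period-index-injective {j} {j′} same = Fin.toℕ-injective (ℕ.*-cancelʳ-≡ _ _ s
        (ε-injective (below j) (below j′) same))
        where
        below : ∀ (j : Fin m) → toℕ j ℕ.* s ℕ.< N
        below j = ≡.subst (toℕ j ℕ.* s ℕ.<_) (≡.sym N≡m*s) (ℕ.*-monoˡ-< s (Fin.toℕ<n j))

      -- The Galois group is listed in unknown order and length. Sending each entry to its exponent
      -- of σˢ is a bijection onto `Fin m`, which reorders the sum into a period.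
      conjugates-sum : ∀ {n} (g : Fin n → Carrier → Carrier) →
        (∀ i → ∃[ j ] (∀ x → g i x ≈ σ^ (toℕ {m} j ℕ.* s) x)) →
        (∀ j → ∃[ i ] (∀ x → σ^ (toℕ {m} j ℕ.* s) x ≈ g i x)) →
        (∀ i j → (∀ x → g i x ≈ g j x) → i ≡ j) → ∑ (λ i → g i ζ) ≈ η 0
      conjugates-sum {n} g indexed listed distinct = begin
        ∑ (λ i → g i ζ)
          ≈⟨ ∑-cong (λ i → proj₂ (indexed i) ζ) ⟩
        ∑ (λ i → ε (toℕ (index i) ℕ.* s))
          ≈⟨ ∑-permutation (λ j → ε (toℕ j ℕ.* s)) π ⟨
        ∑ {m} (λ j → ε (toℕ j ℕ.* s))
          ≈⟨ Σ<≈∑ m (λ j → ε (j ℕ.* s)) ⟨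
        η 0 ∎
        where
        open ≈-Reasoning
        index : Fin n → Fin m
        index i = proj₁ (indexed i)
        π : Permutation n m
        π = permutation index (λ j → proj₁ (listed j))
          (λ j → period-index-injective (trans (sym (proj₂ (indexed _) ζ)) (sym (proj₂ (listed j) ζ))))
          (λ i → distinct _ _ λ x → trans (sym (proj₂ (listed (index i)) x)) (sym (proj₂ (indexed i) x)))

    trace≈η : ∀ {t} → IsTrace K ζ t → t ≈ η 0
    trace≈η {t} (n , g , (g-gal , g-distinct , g-complete) , t≈) = trans t≈ (trans (sum≈∑ (λ i → g i ζ))
      (conjugates-sum g (λ i → period-index (g-gal i))
        (λ j → g-complete _ (σ^-automorphism (toℕ j ℕ.* s) , fixes-multiple (toℕ j))) g-distinct))

  -- Embeddings of K and the canonical inner product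

  module EmbeddedField {a b d ℓ} (ℝ : Reals a b d) (K : Subfield L ℓ) (K-degree : HasDegree K s)
                       (embeddings : Embeddings ℝ K s) where
    open Subextension K K-degree using (⟦⟧∈)
    open Subfield K using (Member) renaming
      (resp to Member-resp; 0∈ to 0∈K; 1∈ to 1∈K; +-closed to +∈; *-closed to *∈; ⁻¹-closed to ⁻¹∈)
    open Embeddings embeddings
    open Complex ℝ
    private
      module ℝ = RealTools ℝ
      module K = RawRing (Subfield.rawRing′ K)
      module ℂ = RawRing ℂ

    θ : ℕ → K.Carrier → K.Carrier
    θ k (x , x∈) = σ^ k x , σ^∈ K K-degree k x∈

    θ-isHom : ∀ k → RingMorphisms.IsRingHomomorphism (Subfield.rawRing′ K) (Subfield.rawRing′ K) (θ k)
    θ-isHom k = record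
      { isSemiringHomomorphism = record
        { isNearSemiringHomomorphism = record
          { +-isMonoidHomomorphism = record
            { isMagmaHomomorphism = record
              { isRelHomomorphism = record { cong = σ^.⟦⟧-cong k }
              ; homo = λ _ _ → σ^.+-homo k _ _ }
            ; ε-homo = σ^.0#-homo k }
          ; *-homo = λ _ _ → σ^.*-homo k _ _ }
        ; 1#-homo = σ^.1#-homo k }
      ; -‿homo = λ _ → σ^.-‿homo k _ }

    ℂ-trans : ∀ {x y z} → x ℂ.≈ y → y ℂ.≈ z → x ℂ.≈ z
    ℂ-trans (p , q) (r , t) = ℝ.trans p r , ℝ.trans q t

    ℂ-sym : ∀ {x y} → x ℂ.≈ y → y ℂ.≈ x
    ℂ-sym (p , q) = ℝ.sym p , ℝ.sym q

    -- The canonical coordinates are real and imaginary parts, which need not be multiplicative;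
    -- additivity is enough to respect integer combinations.
    record IsAdditive (h : K.Carrier → ℝ.Carrier) : Set (a ⊔ b ⊔ c ⊔ ℓ₁ ⊔ ℓ) where
      field
        cong   : ∀ {x y} → x K.≈ y → h x ℝ.≈ h y
        homo-+ : ∀ x y → h (x K.+ y) ℝ.≈ h x ℝ.+ h y

      homo-0 : h K.0# ℝ.≈ ℝ.0#
      homo-0 = ℝ.trans (double (h K.0#)) (ℝ.trans (ℝ.+-congʳ (ℝ.sym (ℝ.trans (cong (sym (+-identityˡ 0#))) (homo-+ K.0# K.0#))))
        (ℝ.-‿inverseʳ _))
        where
        open ℝ.Solver
        double : ∀ x → x ℝ.≈ (x ℝ.+ x) ℝ.- x
        double = solve 1 (λ x → x := (x :+ x) :- x) ℝ.refl

      homo-neg : ∀ x → h (K.- x) ℝ.≈ ℝ.- h x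
      homo-neg x = ℝ.trans (expand (h (K.- x)) (h x)) (ℝ.trans
        (ℝ.+-congʳ (ℝ.trans (ℝ.sym (homo-+ (K.- x) x)) (ℝ.trans (cong {(K.- x) K.+ x} {K.0#} (-‿inverseˡ _)) homo-0)))
        (ℝ.+-identityˡ _))
        where
        open ℝ.Solver
        expand : ∀ y x → y ℝ.≈ (y ℝ.+ x) ℝ.- x
        expand = solve 2 (λ y x → y := (y :+ x) :- x) ℝ.refl

      -- An element of K carries a membership proof, so T stands for any element with the required
      -- value.
      homo-ℕ : ∀ n T x → proj₁ T ≈ ⟦ + n ⟧ * proj₁ x → h T ℝ.≈ ℝ.⟦ + n ⟧ ℝ.* h x
      homo-ℕ zero T x T≈ = ℝ.trans (cong {T} {K.0#} (trans T≈ (zeroˡ _))) (ℝ.trans homo-0 (ℝ.sym (ℝ.zeroˡ _)))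
      homo-ℕ (suc n) T x T≈ = ℝ.trans (cong {T} {x K.+ T′} (trans T≈ (trans (distribʳ _ _ _) (+-congʳ (*-identityˡ _)))))
        (ℝ.trans (homo-+ x T′) (ℝ.trans (ℝ.+-congˡ (homo-ℕ n T′ x refl))
          (ℝ.sym (ℝ.trans (ℝ.distribʳ _ _ _) (ℝ.+-congʳ (ℝ.*-identityˡ _))))))
        where
        T′ : K.Carrier
        T′ = ⟦ + n ⟧ * proj₁ x , *∈ (⟦⟧∈ (+ n)) (proj₂ x)

      homo-scale : ∀ n T x → proj₁ T ≈ ⟦ n ⟧ * proj₁ x → h T ℝ.≈ ℝ.⟦ n ⟧ ℝ.* h x
      homo-scale (+ n)    T x T≈ = homo-ℕ n T x T≈
      homo-scale -[1+ n ] T x T≈ = ℝ.trans (cong {T} {K.- T′} (trans T≈ (sym (-‿distribˡ-* _ _))))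
        (ℝ.trans (homo-neg T′) (ℝ.trans (ℝ.-‿cong (homo-ℕ (suc n) T′ x refl)) (ℝ.-‿distribˡ-* _ _)))
        where
        T′ : K.Carrier
        T′ = ⟦ + suc n ⟧ * proj₁ x , *∈ (⟦⟧∈ (+ suc n)) (proj₂ x)

      homo-∑ : ∀ {n} (z : Fin n → K.Carrier) T → proj₁ T ≈ ∑ (proj₁ ∘ z) → h T ℝ.≈ ℝ.∑ (h ∘ z)
      homo-∑ {zero}  z T T≈ = ℝ.trans (cong {T} {K.0#} (trans T≈ (∑-empty _))) (ℝ.trans homo-0 (ℝ.sym (ℝ.∑-empty _)))
      homo-∑ {suc n} z T T≈ = ℝ.trans (cong {T} {z zero K.+ T′} (trans T≈ (∑-suc _)))
        (ℝ.trans (homo-+ (z zero) T′) (ℝ.trans (ℝ.+-congˡ (homo-∑ (z ∘ suc) T′ refl)) (ℝ.sym (ℝ.∑-suc _))))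
        where
        ∑∈ : ∀ {n} (z : Fin n → K.Carrier) → ∑ (proj₁ ∘ z) ∈ Member
        ∑∈ {zero}  z = Member-resp (sym (∑-empty _)) 0∈K
        ∑∈ {suc n} z = Member-resp (sym (∑-suc _)) (+∈ (proj₂ (z zero)) (∑∈ (z ∘ suc)))
        T′ : K.Carrier
        T′ = ∑ (proj₁ ∘ z ∘ suc) , ∑∈ (z ∘ suc)

    Re-additive : ∀ {g} → IsEmbedding ℝ K g → IsAdditive (proj₁ ∘ g)
    Re-additive g-isHom = record { cong = λ x≈y → proj₁ (g.⟦⟧-cong x≈y) ; homo-+ = λ x y → proj₁ (g.+-homo x y) }
      where module g = RingMorphisms.IsRingHomomorphism g-isHom

    Im-additive : ∀ {g} → IsEmbedding ℝ K g → IsAdditive (proj₂ ∘ g)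
    Im-additive g-isHom = record { cong = λ x≈y → proj₂ (g.⟦⟧-cong x≈y) ; homo-+ = λ x y → proj₂ (g.+-homo x y) }
      where module g = RingMorphisms.IsRingHomomorphism g-isHom

    canonical-additive : ∀ i → IsAdditive (λ x → canonical x i)
    canonical-additive i = block (splitAt r₁ i)
      where
      component : K.Carrier → Fin r₁ ⊎ Fin (r₂ ℕ.* 2) → ℝ.Carrier
      component x = [ (λ i → proj₁ (real i x)) , concat (λ i → proj₁ (nonreal i x) ∷ proj₂ (nonreal i x) ∷ []) ]
      pair : ∀ (z : Fin 2 × Fin r₂) →
        IsAdditive (λ x → uncurry (flip (λ i → proj₁ (nonreal i x) ∷ proj₂ (nonreal i x) ∷ [])) z)
      pair (zero     , j) = Re-additive (nonreal-embedding j)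
      pair (suc zero , j) = Im-additive (nonreal-embedding j)
      block : ∀ z → IsAdditive (λ x → component x z)
      block (inj₁ i) = Re-additive (real-embedding i)
      block (inj₂ j) = pair (quotRem 2 j)

    infixl 7 _⊙_
    _⊙_ : ℂ.Carrier → ℂ.Carrier → ℝ.Carrier
    (a , b) ⊙ (c , d) = a ℝ.* c ℝ.+ b ℝ.* d

    ⊙-cong : ∀ {z z′ w w′} → z ℂ.≈ z′ → w ℂ.≈ w′ → z ⊙ w ℝ.≈ z′ ⊙ w′
    ⊙-cong (p , q) (r , t) = ℝ.+-cong (ℝ.*-cong p r) (ℝ.*-cong q t)

    open Lattice ℝ using (⟨_,_⟩)
    open CanonicalDot ℝ

    canonical-dot : ∀ x y → ⟨ canonical x , canonical y ⟩ ℝ.≈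
      ℝ.∑ (λ i → proj₁ (real i x) ℝ.* proj₁ (real i y)) ℝ.+ ℝ.∑ (λ j → nonreal j x ⊙ nonreal j y)
    canonical-dot x y = ℝ.trans (ℝ.sum≈∑ (λ i → canonical x i ℝ.* canonical y i))
      (ℝ.trans (∑-++ ℝ._*_ (λ i → proj₁ (real i x)) (λ i → proj₁ (real i y)) (concat (pairs x)) (concat (pairs y)))
        (ℝ.+-congˡ (ℝ.trans (∑-concat 2 r₂ ℝ._*_ (pairs x) (pairs y)) (ℝ.∑-cong λ j →
          ℝ.trans (ℝ.∑-suc _) (ℝ.+-congˡ (ℝ.trans (ℝ.∑-suc _) (ℝ.trans (ℝ.+-congˡ (ℝ.∑-empty _)) (ℝ.+-identityʳ _))))))))
      where
      pairs : K.Carrier → Vector (Vector ℝ.Carrier 2) r₂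
      pairs x i = proj₁ (nonreal i x) ∷ proj₂ (nonreal i x) ∷ []

    dot-nonneg : ∀ x → ℝ.0# ℝ.≤ ⟨ canonical x , canonical x ⟩
    dot-nonneg x = ℝ.≤-resp ℝ.refl (ℝ.sym (ℝ.sum≈∑ (λ i → canonical x i ℝ.* canonical x i)))
      (sum-nonneg (λ i → ℝ.square-nonneg (canonical x i)))
      where
      sum-nonneg : ∀ {n} {f : Fin n → ℝ.Carrier} → (∀ i → ℝ.0# ℝ.≤ f i) → ℝ.0# ℝ.≤ ℝ.∑ f
      sum-nonneg {zero}  f≥0 = ℝ.≈⇒≤ (ℝ.sym (ℝ.∑-empty _))
      sum-nonneg {suc n} f≥0 = ℝ.≤-resp ℝ.refl (ℝ.sym (ℝ.∑-suc _)) (ℝ.+-nonneg (f≥0 zero) (sum-nonneg (f≥0 ∘ suc)))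

    -- If two periods with different indices agreed, their pairing with `η′ j` would be both p - m
    -- and - m, and p would vanish in L.
    η-distinct : ∀ {i j} → i ℕ.< s → j ℕ.< s → η i ≈ η j → i ≡ j
    η-distinct {i} {j} i<s j<s ηi≈ηj = decide (i ℕ.≟ j)
      where
      open Solver
      decide : Dec (i ≡ j) → i ≡ j
      decide (yes i≡j) = i≡j
      decide (no i≢j)  = contradiction p≈0 (⟦⟧≉0 N)
        where
        p≈0 : ⟦ + suc N ⟧ ≈ 0#
        p≈0 = trans (solve 2 (λ p m → p := (p :- m) :+ m) refl _ ⟦ + m ⟧)
          (trans (+-congʳ (trans (sym (trace-equal j<s)) (trans
              (Σ<-cong s λ k _ → σ^.⟦⟧-cong k (*-congʳ (sym ηi≈ηj))) (trace-distinct i<s j<s i≢j))))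
            (-‿inverseˡ _))

    embedding-injective : ∀ {g} → IsEmbedding ℝ K g → ∀ x y → g x ℂ.≈ g y → x K.≈ y
    embedding-injective {g} g-isHom x y gx≈gy = decide (proj₂ discreteField (proj₁ z))
      where
      module g = RingMorphisms.IsRingHomomorphism g-isHom
      open ℝ.Solver
      z : K.Carrier
      z = x K.+ (K.- y)
      gz≈0 : proj₁ (g z) ℝ.≈ ℝ.0# × proj₂ (g z) ℝ.≈ ℝ.0#
      gz≈0 = ℝ.trans (proj₁ (g.+-homo x (K.- y))) (ℝ.trans (ℝ.+-cong (proj₁ gx≈gy) (proj₁ (g.-‿homo y))) (ℝ.-‿inverseʳ _)) ,
             ℝ.trans (proj₂ (g.+-homo x (K.- y))) (ℝ.trans (ℝ.+-cong (proj₂ gx≈gy) (proj₂ (g.-‿homo y))) (ℝ.-‿inverseʳ _))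
      decide : proj₁ z ≈ 0# ⊎ (∃[ w ] proj₁ z * w ≈ 1#) → x K.≈ y
      decide (inj₁ z≈0)       = x∙y⁻¹≈ε⇒x≈y _ _ z≈0
      decide (inj₂ (w , zw≈1)) = contradiction 1≈0 ℝ.1≉0
        where
        w′ : K.Carrier
        w′ = w , ⁻¹∈ zw≈1 (proj₂ z)
        1≈0 : ℝ.1# ℝ.≈ ℝ.0#
        1≈0 = ℝ.trans (ℝ.sym (proj₁ (ℂ-trans (g.⟦⟧-cong {z K.* w′} {K.1#} zw≈1) g.1#-homo)))
          (ℝ.trans (proj₁ (g.*-homo z w′)) (ℝ.trans (ℝ.+-cong (ℝ.*-congʳ (proj₁ gz≈0)) (ℝ.-‿cong (ℝ.*-congʳ (proj₂ gz≈0))))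
            (solve 2 (λ a b → con (+ 0) :* a :- con (+ 0) :* b := con (+ 0)) ℝ.refl (proj₁ (g w′)) (proj₂ (g w′)))))

    conjugate : (K.Carrier → ℂ.Carrier) → Fin s → K.Carrier → ℂ.Carrier
    conjugate g i = g ∘ θ (toℕ i)

    conjugate-isHom : ∀ {g} → IsEmbedding ℝ K g → ∀ i → IsEmbedding ℝ K (conjugate g i)
    conjugate-isHom g-isHom i = Composition.isRingHomomorphism ℂ-trans (θ-isHom (toℕ i)) g-isHom

    -- The period `η 0` separates the conjugates: θⁱ sends it to `η i`, and embeddings are
    -- injective.
    conjugate-distinct : ∀ {g} → IsEmbedding ℝ K g → ∀ i j →
                         (∀ x → conjugate g i x ℂ.≈ conjugate g j x) → i ≡ j
    conjugate-distinct g-isHom i j same = Fin.toℕ-injective (η-distinct (Fin.toℕ<n i) (Fin.toℕ<n j)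
      (trans (sym (η-shift (toℕ i))) (trans (embedding-injective g-isHom (θ (toℕ i) η₀) (θ (toℕ j) η₀) (same η₀)) (η-shift (toℕ j)))))
      where
      η₀ : K.Carrier
      η₀ = η 0 , η∈ K K-degree 0
      η-shift : ∀ i → σ^ i (η 0) ≈ η i
      η-shift i = trans (σ^-η i 0) (reflexive (≡.cong η (ℕ.+-identityʳ i)))

    -- The embeddings of K are g ∘ θⁱ for i < s; the canonical embedding sees each of
    -- them once if K is real, and one of each conjugate pair otherwise.
    record IsGaloisOrbit (k : ℕ) (g : K.Carrier → ℂ.Carrier) (j : ℕ) : Set (a ⊔ b ⊔ c ⊔ ℓ₁ ⊔ ℓ) where
      field
        embedding   : IsEmbedding ℝ K g
        inner-product         : ∀ x y → ℝ.⟦ + suc k ⟧ ℝ.* ⟨ canonical x , canonical y ⟩ ℝ.≈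
                              ℝ.∑ (λ i → conjugate g i x ⊙ conjugate g i y)
        conjugation : ∀ x → conj (g x) ℂ.≈ g (θ j x)

    private
      ∑-empty′ : ∀ {n} {f : Fin n → ℝ.Carrier} → n ≡ 0 → ℝ.∑ f ℝ.≈ ℝ.0#
      ∑-empty′ ≡.refl = ℝ.∑-empty _

    -- The s conjugates of a real embedding are real and distinct. Since s = r₁ + 2 r₂, this forces
    -- r₂ = 0, and they exhaust the list.
    real-orbit : Fin r₁ → ∃[ g ] IsGaloisOrbit 0 g 0
    real-orbit i₀ = g , record { embedding = g-isHom ; inner-product = inner-product ; conjugation = λ x → ℂ-trans
        (ℝ.refl , ℝ.trans (ℝ.-‿cong (real-isReal i₀ x)) (ℝ.trans ℝ.-0#≈0# (ℝ.sym (real-isReal i₀ x))))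
        (RingMorphisms.IsRingHomomorphism.⟦⟧-cong g-isHom {x} {θ 0 x} refl) }
      where
      g : K.Carrier → ℂ.Carrier
      g = real i₀
      g-isHom : IsEmbedding ℝ K g
      g-isHom = real-embedding i₀
      classify : ∀ i → (∃[ j ] (∀ x → conjugate g i x ℂ.≈ real j x)) ⊎
                       (∃[ j ] (∀ x → conjugate g i x ℂ.≈ nonreal j x)) ⊎
                       (∃[ j ] (∀ x → conjugate g i x ℂ.≈ conj (nonreal j x))) →
                 ∃[ j ] (∀ x → conjugate g i x ℂ.≈ real j x)
      classify i (inj₁ found) = found
      classify i (inj₂ (inj₁ (j , same))) = contradiction
        (λ x → ℝ.trans (ℝ.sym (proj₂ (same x))) (real-isReal i₀ (θ (toℕ i) x))) (nonreal-notReal j)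
      classify i (inj₂ (inj₂ (j , same))) = contradiction
        (λ x → ℝ.trans (ℝ.sym (ℝ.-‿involutive _)) (ℝ.trans (ℝ.-‿cong
          (ℝ.trans (ℝ.sym (proj₂ (same x))) (real-isReal i₀ (θ (toℕ i) x)))) ℝ.-0#≈0#)) (nonreal-notReal j)
      indexed : ∀ i → ∃[ j ] (∀ x → conjugate g i x ℂ.≈ real j x)
      indexed i = classify i (exhaustive (conjugate g i) (conjugate-isHom g-isHom i))
      index : Fin s → Fin r₁
      index i = proj₁ (indexed i)
      index-injective : Injective _≡_ _≡_ index
      index-injective {i} {j} eq = conjugate-distinct g-isHom i j λ x → ℂ-trans (proj₂ (indexed i) x)
        (ℂ-sym (≡.subst (λ l → conjugate g j x ℂ.≈ real l x) (≡.sym eq) (proj₂ (indexed j) x)))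
      r₂≡0 : r₂ ≡ 0
      r₂≡0 = go r₂ (ℕ.+-cancelˡ-≤ r₁ (2 ℕ.* r₂) 0
        (≡.subst₂ ℕ._≤_ signature (≡.sym (ℕ.+-identityʳ r₁)) (Fin.injective⇒≤ index-injective)))
        where
        go : ∀ r → 2 ℕ.* r ℕ.≤ 0 → r ≡ 0
        go zero _ = ≡.refl
      permuted = injective⇒permutation′ (≡.subst (r₁ ℕ.≤_) (≡.sym signature) (ℕ.m≤m+n r₁ _)) index index-injective
      π = proj₁ permuted
      inner-product : ∀ x y → ℝ.⟦ + 1 ⟧ ℝ.* ⟨ canonical x , canonical y ⟩ ℝ.≈ ℝ.∑ (λ i → conjugate g i x ⊙ conjugate g i y)
      inner-product x y = begin
        ℝ.⟦ + 1 ⟧ ℝ.* ⟨ canonical x , canonical y ⟩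
          ≈⟨ ℝ.trans (ℝ.*-congʳ ℝ.⟦⟧-homo-1) (ℝ.*-identityˡ _) ⟩
        ⟨ canonical x , canonical y ⟩
          ≈⟨ ℝ.trans (canonical-dot x y) (ℝ.trans (ℝ.+-congˡ (∑-empty′ r₂≡0)) (ℝ.+-identityʳ _)) ⟩
        ℝ.∑ (λ j → proj₁ (real j x) ℝ.* proj₁ (real j y))
          ≈⟨ ℝ.∑-permutation _ π ⟩
        ℝ.∑ (λ i → proj₁ (real (π ⟨$⟩ʳ i) x) ℝ.* proj₁ (real (π ⟨$⟩ʳ i) y))
          ≈⟨ ℝ.∑-cong (λ i → ℝ.trans (ℝ.reflexive (≡.cong (λ j → proj₁ (real j x) ℝ.* proj₁ (real j y)) (proj₂ permuted i))) (term i)) ⟩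
        ℝ.∑ (λ i → conjugate g i x ⊙ conjugate g i y) ∎
        where
        open ℝ.≈-Reasoning
        term : ∀ i → proj₁ (real (index i) x) ℝ.* proj₁ (real (index i) y) ℝ.≈ conjugate g i x ⊙ conjugate g i y
        term i = ℝ.sym (ℝ.trans (ℝ.+-cong
            (ℝ.*-cong (proj₁ (proj₂ (indexed i) x)) (proj₁ (proj₂ (indexed i) y)))
            (ℝ.trans (ℝ.*-congʳ (real-isReal i₀ (θ (toℕ i) x))) (ℝ.zeroˡ _)))
          (ℝ.+-identityʳ _))

    -- The s = 2 r₂ conjugates of g inject into the listed embeddings together with their complex
    -- conjugates, hence fill them. So conj ∘ g is itself some g ∘ θᶜ, and the sum over the orbit
    -- counts each listed pair twice.
    nonreal-orbit : r₁ ≡ 0 → ∃[ g ] ∃[ c ] IsGaloisOrbit 1 g c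
    nonreal-orbit r₁≡0 = g , toℕ (proj₁ conjugate-index) , record
      { embedding = g-isHom ; inner-product = inner-product ; conjugation = λ x → ℂ-sym (conjugation x) }
      where
      s≡2r₂ : s ≡ r₂ ℕ.+ r₂
      s≡2r₂ = ≡.trans signature (≡.trans (≡.cong (ℕ._+ 2 ℕ.* r₂) r₁≡0) (≡.cong (r₂ ℕ.+_) (ℕ.+-identityʳ r₂)))
      i₀ : Fin r₂
      i₀ = inhabited r₂ (≡.subst (0 ℕ.<_) s≡2r₂ (ℕ.>-nonZero⁻¹ s))
        where
        inhabited : ∀ r → 0 ℕ.< r ℕ.+ r → Fin r
        inhabited (suc r) _ = zero
      g : K.Carrier → ℂ.Carrier
      g = nonreal i₀
      g-isHom : IsEmbedding ℝ K g
      g-isHom = nonreal-embedding i₀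
      select′ : Fin r₂ ⊎ Fin r₂ → K.Carrier → ℂ.Carrier
      select′ (inj₁ j) = nonreal j
      select′ (inj₂ j) = conj ∘ nonreal j
      select : Fin (r₂ ℕ.+ r₂) → K.Carrier → ℂ.Carrier
      select l = select′ (splitAt r₂ l)
      ℂ-reflexive : ∀ {z w} → z ≡ w → z ℂ.≈ w
      ℂ-reflexive ≡.refl = ℝ.refl , ℝ.refl
      select-ˡ : ∀ j x → select (j ↑ˡ r₂) x ℂ.≈ nonreal j x
      select-ˡ j x = ℂ-reflexive (≡.cong (λ z → select′ z x) (Fin.splitAt-↑ˡ r₂ j r₂))
      select-ʳ : ∀ j x → select (r₂ ↑ʳ j) x ℂ.≈ conj (nonreal j x)
      select-ʳ j x = ℂ-reflexive (≡.cong (λ z → select′ z x) (Fin.splitAt-↑ʳ r₂ r₂ j))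
      classify : ∀ i → (∃[ j ] (∀ x → conjugate g i x ℂ.≈ real j x)) ⊎
                       (∃[ j ] (∀ x → conjugate g i x ℂ.≈ nonreal j x)) ⊎
                       (∃[ j ] (∀ x → conjugate g i x ℂ.≈ conj (nonreal j x))) →
                 ∃[ l ] (∀ x → conjugate g i x ℂ.≈ select l x)
      classify i (inj₁ (j , _)) = contradiction (≡.subst Fin r₁≡0 j) λ ()
      classify i (inj₂ (inj₁ (j , same))) = j ↑ˡ r₂ , λ x → ℂ-trans (same x) (ℂ-sym (select-ˡ j x))
      classify i (inj₂ (inj₂ (j , same))) = r₂ ↑ʳ j , λ x → ℂ-trans (same x) (ℂ-sym (select-ʳ j x))
      indexed : ∀ i → ∃[ l ] (∀ x → conjugate g i x ℂ.≈ select l x)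
      indexed i = classify i (exhaustive (conjugate g i) (conjugate-isHom g-isHom i))
      index : Fin s → Fin (r₂ ℕ.+ r₂)
      index i = proj₁ (indexed i)
      index-injective : Injective _≡_ _≡_ index
      index-injective {i} {j} eq = conjugate-distinct g-isHom i j λ x → ℂ-trans (proj₂ (indexed i) x)
        (ℂ-sym (≡.subst (λ l → conjugate g j x ℂ.≈ select l x) (≡.sym eq) (proj₂ (indexed j) x)))
      permuted = injective⇒permutation′ (ℕ.≤-reflexive (≡.sym s≡2r₂)) index index-injective
      π = proj₁ permuted
      conjugate-index : ∃[ i ] index i ≡ r₂ ↑ʳ i₀
      conjugate-index = π ⟨$⟩ˡ (r₂ ↑ʳ i₀) , ≡.trans (≡.sym (proj₂ permuted _)) (inverseʳ π)
      conjugation : ∀ x → g (θ (toℕ (proj₁ conjugate-index)) x) ℂ.≈ conj (g x)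
      conjugation x = ℂ-trans (proj₂ (indexed (proj₁ conjugate-index)) x)
        (≡.subst (λ l → select l x ℂ.≈ conj (g x)) (≡.sym (proj₂ conjugate-index)) (select-ʳ i₀ x))
      inner-product : ∀ x y → ℝ.⟦ + 2 ⟧ ℝ.* ⟨ canonical x , canonical y ⟩ ℝ.≈ ℝ.∑ (λ i → conjugate g i x ⊙ conjugate g i y)
      inner-product x y = begin
        ℝ.⟦ + 2 ⟧ ℝ.* ⟨ canonical x , canonical y ⟩
          ≈⟨ ℝ.*-congˡ (ℝ.trans (canonical-dot x y) (ℝ.trans (ℝ.+-congʳ (∑-empty′ r₁≡0)) (ℝ.+-identityˡ _))) ⟩
        ℝ.⟦ + 2 ⟧ ℝ.* S
          ≈⟨ solve 1 (λ x → con (+ 2) :* x := x :+ x) ℝ.refl S ⟩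
        S ℝ.+ S
          ≈⟨ ℝ.+-cong (ℝ.∑-cong λ j → ⊙-cong (ℂ-sym (select-ˡ j x)) (ℂ-sym (select-ˡ j y)))
               (ℝ.∑-cong λ j → ℝ.trans (conj-⊙ (nonreal j x) (nonreal j y)) (⊙-cong (ℂ-sym (select-ʳ j x)) (ℂ-sym (select-ʳ j y)))) ⟩
        ℝ.∑ (λ j → select (j ↑ˡ r₂) x ⊙ select (j ↑ˡ r₂) y) ℝ.+ ℝ.∑ (λ j → select (r₂ ↑ʳ j) x ⊙ select (r₂ ↑ʳ j) y)
          ≈⟨ ∑-↑ r₂ r₂ (λ l → select l x ⊙ select l y) ⟨
        ℝ.∑ (λ l → select l x ⊙ select l y)
          ≈⟨ ℝ.∑-permutation _ π ⟩
        ℝ.∑ (λ i → select (π ⟨$⟩ʳ i) x ⊙ select (π ⟨$⟩ʳ i) y)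
          ≈⟨ ℝ.∑-cong (λ i → ℝ.trans (ℝ.reflexive (≡.cong (λ l → select l x ⊙ select l y) (proj₂ permuted i)))
               (⊙-cong (ℂ-sym (proj₂ (indexed i) x)) (ℂ-sym (proj₂ (indexed i) y)))) ⟩
        ℝ.∑ (λ i → conjugate g i x ⊙ conjugate g i y) ∎
        where
        open ℝ.≈-Reasoning
        open ℝ.Solver
        S = ℝ.∑ (λ j → nonreal j x ⊙ nonreal j y)
        conj-⊙ : ∀ z w → z ⊙ w ℝ.≈ conj z ⊙ conj w
        conj-⊙ (a , b) (c , d) = solve 4 (λ a b c d → a :* c :+ b :* d := a :* c :+ (:- b) :* (:- d)) ℝ.refl a b c d

    galois-orbit : ∃[ k ] ∃[ g ] ∃[ c ] IsGaloisOrbit k g c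
    galois-orbit = decide r₁ real-orbit nonreal-orbit
      where
      decide : ∀ r → (Fin r → ∃[ g ] IsGaloisOrbit 0 g 0) → (r ≡ 0 → ∃[ g ] ∃[ c ] IsGaloisOrbit 1 g c) →
               ∃[ k ] ∃[ g ] ∃[ c ] IsGaloisOrbit k g c
      decide zero    _    orbit = 1 , orbit ≡.refl
      decide (suc r) orbit _    = 0 , proj₁ (orbit zero) , 0 , proj₂ (orbit zero)

    -- The image of the code lattice under the canonical embedding

    module CodeLatticeEmbedding (2∣s : 2 ℕ.∣ s) (t : Carrier) (t-trace : IsTrace K ζ t)
                                (β : ℤ) (β-primitive : IsPrimitiveRootMod p β) where
      open TraceForm s m using (Q; G; Q-matrix)
      open CodeLattice s m p-prime 2∣s β β-primitive using (IsCodeword)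
      open CodeLatticeDensity ℝ s m p-prime 2∣s β β-primitive
      open Lattice ℝ using (_≋_; ℤ-combination)

      module OrbitLattice {k g c} (orbit : IsGaloisOrbit k g c) where
        open IsGaloisOrbit orbit
        private module g = RingMorphisms.IsRingHomomorphism embedding

        -- `⊙` is the real part of z times the conjugate of w. As conjugation acts through σᶜ, the
        -- summands are real parts of the images under g of the conjugates of x σᶜ y, and these add
        -- up to the image of a trace.
        inner-product-trace : ∀ x y a → trace (proj₁ x * σ^ c (proj₁ y)) ≈ ⟦ a ⟧ →
          ℝ.⟦ + suc k ⟧ ℝ.* ⟨ canonical x , canonical y ⟩ ℝ.≈ ℝ.⟦ a ⟧
        inner-product-trace x y a trace≈a = begin
          ℝ.⟦ + suc k ⟧ ℝ.* ⟨ canonical x , canonical y ⟩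
            ≈⟨ inner-product x y ⟩
          ℝ.∑ (λ i → conjugate g i x ⊙ conjugate g i y)
            ≈⟨ ℝ.∑-cong (λ i → term (toℕ i)) ⟩
          ℝ.∑ (λ i → proj₁ (g (z i)))
            ≈⟨ homo-∑ z T (trans (sym trace≈a) (Σ<≈∑ s _)) ⟨
          proj₁ (g T)
            ≈⟨ homo-scale a T K.1# (sym (*-identityʳ _)) ⟩
          ℝ.⟦ a ⟧ ℝ.* proj₁ (g K.1#)
            ≈⟨ ℝ.trans (ℝ.*-congˡ (proj₁ g.1#-homo)) (ℝ.*-identityʳ _) ⟩
          ℝ.⟦ a ⟧ ∎
          where
          open ℝ.≈-Reasoning
          open IsAdditive (Re-additive embedding)
          xy : K.Carrier
          xy = x K.* θ c y
          z : Fin s → K.Carrier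
          z i = θ (toℕ i) xy
          T : K.Carrier
          T = ⟦ a ⟧ , ⟦⟧∈ a
          Re-* : ∀ u v v′ → v′ ℂ.≈ conj v → proj₁ (u ℂ.* v′) ℝ.≈ u ⊙ v
          Re-* (a , b) (c , d) (c′ , d′) (p , q) = ℝ.trans
            (ℝ.+-cong (ℝ.*-congˡ p) (ℝ.-‿cong (ℝ.*-congˡ q)))
            (solve 4 (λ a b c d → a :* c :- b :* (:- d) := a :* c :+ b :* d) ℝ.refl a b c d)
            where open ℝ.Solver
          term : ∀ i → g (θ i x) ⊙ g (θ i y) ℝ.≈ proj₁ (g (θ i xy))
          term i = ℝ.sym (ℝ.trans
            (proj₁ (ℂ-trans (g.⟦⟧-cong {θ i xy} {θ i x K.* θ c (θ i y)}
                (trans (σ^.*-homo i _ _) (*-congˡ (σ^-comm i c _)))) (g.*-homo (θ i x) (θ c (θ i y)))))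
            (Re-* (g (θ i x)) (g (θ i y)) (g (θ c (θ i y))) (ℂ-sym (conjugation (θ i y)))))

        private
          -- The offset between σᶜ and inversion on the periods: as inversion is an involution, σᶜ
          -- sends `η 0` to `η′ j₀`.
          j₀ : ℕ
          j₀ = (inversion ℕ.+ c) % s

          j₀<s : j₀ ℕ.< s
          j₀<s = m%n<n (inversion ℕ.+ c) s

          η-c : η c ≈ η′ j₀
          η-c = sym (trans (σ^.⟦⟧-cong inversion (trans (sym (η-% (inversion ℕ.+ c))) (sym (σ^-η inversion c))))
            (σ^inversion-involutive (η c)))

          -- Otherwise the squared norm of η 0 would be a negative multiple of m.
          j₀≡0 : j₀ ≡ 0
          j₀≡0 = decide (j₀ ℕ.≟ 0)
            where
            η₀ : K.Carrier
            η₀ = η 0 , η∈ K K-degree 0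
            m-suc : ∃[ n ] m ≡ suc n
            m-suc = go m 0<N
              where
              go : ∀ m → 0 ℕ.< m ℕ.* s → ∃[ n ] m ≡ suc n
              go (suc n) _ = n , ≡.refl
            decide : Dec (j₀ ≡ 0) → j₀ ≡ 0
            decide (yes j₀≡0) = j₀≡0
            decide (no j₀≢0)  = contradiction
              (ℝ.<-respˡ (ℝ.trans (ℝ.sym (ℝ.⟦⟧-homo-- (+ m))) (ℝ.sym norm)) -m<0)
              (ℝ.*-nonneg (ℝ.0≤⟦⟧ (suc k)) (dot-nonneg η₀))
              where
              trace≈-m : trace (η 0 * σ^ c (η 0)) ≈ ⟦ ℤ.- + m ⟧
              trace≈-m = trans (Σ<-cong s λ i _ → σ^.⟦⟧-cong i (*-congˡ
                  (trans (σ^-η c 0) (trans (reflexive (≡.cong η (ℕ.+-identityʳ c))) η-c))))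
                (trans (trace-distinct (ℕ.>-nonZero⁻¹ s) j₀<s (λ eq → j₀≢0 (≡.sym eq))) (sym (⟦⟧-homo-- (+ m))))
              norm : ℝ.⟦ + suc k ⟧ ℝ.* ⟨ canonical η₀ , canonical η₀ ⟩ ℝ.≈ ℝ.⟦ ℤ.- + m ⟧
              norm = inner-product-trace η₀ η₀ (ℤ.- + m) trace≈-m
              -m<0 : ℝ.- ℝ.⟦ + m ⟧ ℝ.< ℝ.0#
              -m<0 = ℝ.<-respˡ (ℝ.+-identityˡ _) (ℝ.<-respʳ (ℝ.-‿inverseʳ _) (ℝ.+-monoˡ-< (ℝ.- ℝ.⟦ + m ⟧)
                (≡.subst (λ m → ℝ.0# ℝ.< ℝ.⟦ + m ⟧) (≡.sym (proj₂ m-suc)) (ℝ.0<⟦⟧ (proj₁ m-suc)))))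

        σ^c-η : ∀ i → σ^ c (η i) ≈ η′ i
        σ^c-η i = begin
          σ^ c (η i)             ≈⟨ trans (σ^-η c i) (trans (reflexive (≡.cong η (ℕ.+-comm c i))) (sym (σ^-η i c))) ⟩
          σ^ i (η c)             ≈⟨ σ^.⟦⟧-cong i (trans η-c (reflexive (≡.cong η′ j₀≡0))) ⟩
          σ^ i (η′ 0)            ≈⟨ σ^-comm i inversion (η 0) ⟩
          σ^ inversion (σ^ i (η 0)) ≈⟨ σ^.⟦⟧-cong inversion (trans (σ^-η i 0) (reflexive (≡.cong η (ℕ.+-identityʳ i)))) ⟩
          η′ i                   ∎
          where open ≈-Reasoning

        point : (Fin s → ℤ) → Carrier
        point a = ∑ λ i → ⟦ a i ⟧ * η (toℕ i)

        private
          ∑∈ : ∀ {n} {f : Fin n → Carrier} → (∀ i → f i ∈ Member) → ∑ f ∈ Member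
          ∑∈ {zero}  f∈ = Member-resp (sym (∑-empty _)) 0∈K
          ∑∈ {suc n} f∈ = Member-resp (sym (∑-suc _)) (+∈ (f∈ zero) (∑∈ (f∈ ∘ suc)))

        opaque
          point∈ : ∀ a → point a ∈ Member
          point∈ a = ∑∈ λ i → *∈ (⟦⟧∈ (a i)) (η∈ K K-degree (toℕ i))

        Φ : (Fin s → ℤ) → Vector ℝ.Carrier dimension
        Φ a = canonical (point a , point∈ a)

        private
          trace-∑ : ∀ {n} (f : Fin n → Carrier) → trace (∑ f) ≈ ∑ (trace ∘ f)
          trace-∑ f = trans (Σ<≈∑ s _) (trans (∑-cong λ i → End.∑-hom (σ^-isHom (toℕ i)) f)
            (trans (∑-swap _) (∑-cong λ j → sym (Σ<≈∑ s _))))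

          trace-scale : ∀ a x → trace (⟦ a ⟧ * x) ≈ ⟦ a ⟧ * trace x
          trace-scale a x = trans (Σ<-cong s λ i _ → trans (σ^.*-homo i _ x) (*-congʳ (End.⟦⟧-hom (σ^-isHom i) a)))
            (Σ<-*ˡ s ⟦ a ⟧ _)

          trace-G : ∀ i j → trace (η (toℕ i) * η′ (toℕ j)) ≈ ⟦ G i j ⟧
          trace-G i j = decide (i Fin.≟ j)
            where
            G-value : ∀ d → δ i j ≡ d → ⟦ G i j ⟧ ≈ ⟦ + p ⟧ * ⟦ d ⟧ - ⟦ + m ⟧
            G-value d δ≡d = trans (⟦⟧-cong (≡.cong (λ d → + p ℤ.* d ℤ.- + m) δ≡d))
              (trans (⟦⟧-homo-+ (+ p ℤ.* d) (ℤ.- + m)) (+-cong (⟦⟧-homo-* (+ p) d) (⟦⟧-homo-- (+ m))))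
            decide : Dec (i ≡ j) → trace (η (toℕ i) * η′ (toℕ j)) ≈ ⟦ G i j ⟧
            decide (yes ≡.refl) = trans (trace-equal (Fin.toℕ<n i)) (sym (trans (G-value (+ 1) (δ-refl i))
              (+-congʳ (trans (*-congˡ ⟦⟧-homo-1) (*-identityʳ _)))))
            decide (no i≢j) = trans (trace-distinct (Fin.toℕ<n i) (Fin.toℕ<n j) (i≢j ∘ Fin.toℕ-injective))
              (sym (trans (G-value (+ 0) (δ-≢ i≢j)) (trans (+-congʳ (zeroʳ _)) (+-identityˡ _))))

        form : ∀ a b → ℝ.⟦ + suc k ⟧ ℝ.* ⟨ Φ a , Φ b ⟩ ℝ.≈ ℝ.⟦ Q a b ⟧
        form a b = inner-product-trace (point a , point∈ a) (point b , point∈ b) (Q a b) (begin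
          trace (point a * σ^ c (point b))
            ≈⟨ Σ<-cong s (λ i _ → σ^.⟦⟧-cong i (*-congˡ σ^c-point)) ⟩
          trace (point a * ∑ (λ j → ⟦ b j ⟧ * η′ (toℕ j)))
            ≈⟨ Σ<-cong s (λ i _ → σ^.⟦⟧-cong i (trans (sym (∑-*ʳ _ _)) (∑-cong λ l → trans (*-assoc _ _ _)
                 (*-congˡ (trans (sym (∑-*ˡ _ _)) (∑-cong λ j → exchange (η (toℕ l)) ⟦ b j ⟧ (η′ (toℕ j)))))))) ⟩
          trace (∑ λ l → ⟦ a l ⟧ * ∑ λ j → ⟦ b j ⟧ * (η (toℕ l) * η′ (toℕ j)))
            ≈⟨ trans (trace-∑ _) (∑-cong λ l → trans (trace-scale (a l) _) (*-congˡ (trans (trace-∑ _)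
                 (∑-cong λ j → trans (trace-scale (b j) _) (trans (*-congˡ (trace-G l j)) (*-comm _ _)))))) ⟩
          ∑ (λ l → ⟦ a l ⟧ * ∑ λ j → ⟦ G l j ⟧ * ⟦ b j ⟧)
            ≈⟨ ∑-cong (λ l → *-congˡ (trans (∑-cong λ j → sym (⟦⟧-homo-* (G l j) (b j))) (sym (∑-homo _)))) ⟩
          ∑ (λ l → ⟦ a l ⟧ * ⟦ ∑ℤ (λ j → G l j ℤ.* b j) ⟧)
            ≈⟨ trans (∑-cong λ l → sym (⟦⟧-homo-* (a l) _)) (sym (∑-homo _)) ⟩
          ⟦ ∑ℤ (λ l → a l ℤ.* ∑ℤ λ j → G l j ℤ.* b j) ⟧
            ≈⟨ ⟦⟧-cong (≡.sym (Q-matrix a b)) ⟩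
          ⟦ Q a b ⟧ ∎)
          where
          open ≈-Reasoning
          open DeterminantHomomorphism R using (∑-homo)
          exchange : ∀ x y z → x * (y * z) ≈ y * (x * z)
          exchange = solve 3 (λ x y z → x :* (y :* z) := y :* (x :* z)) refl
            where open Solver
          σ^c-point : σ^ c (point b) ≈ ∑ (λ j → ⟦ b j ⟧ * η′ (toℕ j))
          σ^c-point = trans (End.∑-hom (σ^-isHom c) _) (∑-cong λ j →
            trans (σ^.*-homo c _ _) (*-cong (End.⟦⟧-hom (σ^-isHom c) (b j)) (σ^c-η (toℕ j))))

        private
          t≈η : ∀ i → fold t σ i ≈ η i
          t≈η i = trans (σ^.⟦⟧-cong i (trace≈η K K-degree t-trace))
            (trans (σ^-η i 0) (reflexive (≡.cong η (ℕ.+-identityʳ i))))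

          point-t : ∀ a → point a ≈ sum (λ i → a i ·ℤ fold t σ (toℕ i))
          point-t a = sym (trans (sum≈∑ (λ (i : Fin s) → a i ·ℤ fold t σ (toℕ i)))
            (∑-cong λ i → trans (·ℤ-* (a i) _) (*-congˡ (t≈η (toℕ i)))))

          point-integral : ∀ a → point a ∈ Span IsInteger
          point-integral a = ∑-span λ i → span-* integer-isFixedSubring
              (span-base integer-isFixedSubring (a i , refl)) (η-span (toℕ i))
            where
            ∑-span : ∀ {n} {f : Fin n → Carrier} → (∀ i → f i ∈ Span IsInteger) → ∑ f ∈ Span IsInteger
            ∑-span {zero}  f∈ = resp (sym (∑-empty _)) (span-base integer-isFixedSubring (ℤ.0ℤ , refl))
            ∑-span {suc n} f∈ = resp (sym (∑-suc _)) (add (f∈ zero) (∑-span (f∈ ∘ suc)))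
            η-span : ∀ i → η i ∈ Span IsInteger
            η-span i = span-Σ integer-isFixedSubring m λ j → span-σ^ integer-isFixedSubring (i ℕ.+ j ℕ.* s)
              (resp (*-identityʳ ζ) (span-ζ^ integer-isFixedSubring 1))

        isCodeLattice : IsCodeLattice (image (ℳ K (suc N) s σ t β)) k Φ
        isCodeLattice = record
          { form       = form
          ; member     = λ v → λ where
              (x , (_ , a , x≈ , a∈) , v≈) → a , a∈ , λ i → ℝ.trans (v≈ i)
                (IsAdditive.cong (canonical-additive i) {x} {point a , point∈ a} (trans x≈ (sym (point-t a))))
          -- Integrality of the point comes from its monic characteristic polynomial, whose
          -- coefficients are integers.
          ; codeword∈  = λ a a∈ → (point a , point∈ a) ,
              ((point∈ a , integer-span⇒integral (point-integral a)) , a , point-t a , a∈) , λ _ → ℝ.refl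
          ; Φ-cong     = λ {a} {b} a≡b i → IsAdditive.cong (canonical-additive i) {point a , point∈ a} {point b , point∈ b}
              (∑-cong λ j → *-congʳ (⟦⟧-cong (a≡b j)))
          ; Φ-additive = additive
          }
          where
          open DeterminantHomomorphism R using (∑-homo)
          additive : ∀ {r} (d : Vector ℤ r) (A : Fin r → Fin s → ℤ) →
                     ℤ-combination d (Φ ∘ A) ≋ Φ (λ i → ∑ℤ λ j → d j ℤ.* A j i)
          additive {r} d A i = ℝ.trans (ℝ.sum≈∑ (λ j → d j ℝ.·ℤ Φ (A j) i)) (ℝ.sym (ℝ.trans
            (homo-∑ z T point-∑)
            (ℝ.∑-cong λ j → ℝ.trans (homo-scale (d j) (z j) (point (A j) , point∈ (A j)) refl) (ℝ.sym (ℝ.·ℤ-* (d j) _)))))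
            where
            open IsAdditive (canonical-additive i)
            z : Fin r → K.Carrier
            z j = ⟦ d j ⟧ * point (A j) , *∈ (⟦⟧∈ (d j)) (point∈ (A j))
            dA : Fin s → ℤ
            dA i = ∑ℤ λ j → d j ℤ.* A j i
            T : K.Carrier
            T = point dA , point∈ dA
            point-∑ : point dA ≈ ∑ (λ j → ⟦ d j ⟧ * point (A j))
            point-∑ = begin
              ∑ (λ i → ⟦ dA i ⟧ * η (toℕ i))
                ≈⟨ ∑-cong (λ i → trans (*-congʳ (trans (∑-homo _) (∑-cong λ j → ⟦⟧-homo-* (d j) (A j i))))
                     (trans (sym (∑-*ʳ _ _)) (∑-cong λ j → *-assoc _ _ _))) ⟩
              ∑ (λ i → ∑ λ j → ⟦ d j ⟧ * (⟦ A j i ⟧ * η (toℕ i)))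
                ≈⟨ trans (∑-swap _) (∑-cong λ j → ∑-*ˡ ⟦ d j ⟧ _) ⟩
              ∑ (λ j → ⟦ d j ⟧ * point (A j)) ∎
              where open ≈-Reasoning

      dimension≡s : dimension ≡ s
      dimension≡s = ≡.sym (≡.trans signature (≡.cong (r₁ ℕ.+_) (ℕ.*-comm 2 r₂)))

      center-density : ∀ δ → Lattice.IsCenterDensity ℝ (image (ℳ K (suc N) s σ t β)) δ →
        ∀ √p → ℝ.IsSqrt (suc N ℝ.·ℕ ℝ.1#) √p →
        ∀ b → ℝ.IsQuotient ℝ.1# ((2 ℝ.·ℕ ℝ.1#) ℝ.^ s ℝ.* √p) b → b ℝ.≤ δ
      center-density = conclude galois-orbit
        where
        conclude : (∃[ k ] ∃[ g ] ∃[ c ] IsGaloisOrbit k g c) →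
          ∀ δ → Lattice.IsCenterDensity ℝ (image (ℳ K (suc N) s σ t β)) δ →
          ∀ √p → ℝ.IsSqrt (suc N ℝ.·ℕ ℝ.1#) √p →
          ∀ b → ℝ.IsQuotient ℝ.1# ((2 ℝ.·ℕ ℝ.1#) ℝ.^ s ℝ.* √p) b → b ℝ.≤ δ
        conclude (k , g , c , orbit) = density dimension≡s k (OrbitLattice.isCodeLattice orbit)

mainTheorem4 :
  ∀ {c ℓ₁ ℓ₂ c′ ℓ₁′ ℓ₂′ ℓ} (ℝ : Reals c ℓ₁ ℓ₂) (L : Extensionℚ c′ ℓ₁′ ℓ₂′) →
  let module ℝ = Reals ℝ
      module L = Extensionℚ L
      open FieldTheory L
  in
  (p : ℕ) → Prime p →
  (ζ : L.Carrier) → IsPrimitiveRootOfUnity p ζ → (∀ x → x ∈ ℚ⟨ ζ ⟩) →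
  (s : ℕ) .{{_ : NonZero s}} → 2 ∣ s → s ∣ p ∸ 1 →
  (K : Subfield L ℓ) → HasDegree K s →
  (u : ℤ) → GeneratesUnits p u →
  (σᵤ : L.Carrier → L.Carrier) → IsAutomorphism σᵤ → IsPower ζ u (σᵤ ζ) →
  (t : L.Carrier) → IsTrace K ζ t →
  (β : ℤ) → IsPrimitiveRootMod p β →
  (σ : Embeddings ℝ K s) →
  let Λ = Embeddings.image σ (ℳ K p s σᵤ t β) in
  ∀ δ → Lattice.IsCenterDensity ℝ Λ δ →
  ∀ √p → ℝ.IsSqrt (p ℝ.·ℕ ℝ.1#) √p →
  ∀ b → ℝ.IsQuotient ℝ.1# ((2 ℝ.·ℕ ℝ.1#) ℝ.^ s ℝ.* √p) b →
  b ℝ.≤ δ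
mainTheorem4 ℝ L zero    () ζ ζ-primitive ζ-generates s
-- Matching the divisibility with `≡.refl` makes p literally `suc (m ℕ.* s)`, so that p - 1 = m s
-- holds by computation.
mainTheorem4 ℝ L (suc _) p-prime ζ ζ-primitive ζ-generates s 2∣s (ℕ.divides m ≡.refl) K K-degree
    u u-generates σᵤ σᵤ-automorphism σᵤζ t t-trace β β-primitive σ =
  CodeLatticeEmbedding.center-density 2∣s t t-trace β β-primitive
  where
  D : CyclotomicData _ _ _
  D = record
    -- `NonZero s` is given irrelevantly but stored relevantly; it is rebuilt from 0 < s.
    { L = L ; s = s ; m = m ; s-nonZero = ℕ.>-nonZero (ℕ.>-nonZero⁻¹ s) ; p-prime = p-prime
    ; ζ = ζ ; ζ-primitive = ζ-primitive ; ζ-generates = ζ-generates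
    ; u = u ; u-generates = u-generates ; σ = σᵤ ; σ-automorphism = σᵤ-automorphism ; σζ = σᵤζ }
  open CyclotomicField D
  open EmbeddedField ℝ K K-degree σ
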